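{- For every integer $r\geq 4$, let $k=\lceil r/e\rceil$. Then $\pi(\mathcal{F}_{r,k})=r!/r^r$.
   Context: For a family $\mathcal{F}$ of $r$-uniform hypergraphs, an $r$-uniform hypergraph is $\mathcal{F}$-free if it contains no member of $\mathcal{F}$ as a subgraph; $\mathrm{ex}(n,\mathcal{F})$ is the maximum number of edges in an $\mathcal{F}$-free $r$-uniform hypergraph on $n$ vertices, and the Turán density is $\pi(\mathcal{F})=\lim_{n\to\infty}\mathrm{ex}(n,\mathcal{F})/\binom{n}{r}$. For $1\leq i\leq\lfloor r/2\rfloor$, the $(r-i,i)$-tent $\Delta_{(r-i,i)}$ is the $r$-uniform hypergraph with vertex set $\{1,\dots,2r-1\}$ and the three edges $\{1,2,\ldots,r\}$, $\{1,\ldots,i,r+1,\ldots,2r-i-1,2r-1\}$, $\{i+1,\ldots,r,2r-i,\ldots,2r-1\}$. For $1\leq k\leq\lfloor r/2\rfloor$, $\mathcal{F}_{r,k}=\{\Delta_{(r-i,i)}: 1\leq i\leq k\}$. -}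

module Defs where

open import Data.Nat using (ℕ; zero; suc; _+_; _*_; _∸_; _^_; _≤_; _<_; _≤ᵇ_; _≡ᵇ_)
open import Data.Nat using (_!)
open import Data.Nat.Combinatorics using (_C_)
open import Data.Integer using (ℤ; +_; _-_) renaming (∣_∣ to ∣_∣ℤ)
open import Data.Bool using (Bool; _∧_; _∨_)
open import Data.Fin using (Fin; toℕ)
open import Data.Fin.Subset using (Subset; _∈_; ∣_∣)
open import Data.Vec using (tabulate)
open import Data.List using (List; []; _∷_; length)
import Data.List.Membership.Propositional as LM
open import Data.List.Relation.Unary.All using (All)
open import Data.List.Relation.Unary.Unique.Propositional using (Unique)
open import Data.Product using (Σ; _×_; ∃; ∃-syntax; _,_)
open import Function.Definitions using (Injective)
open import Function.Bundles using (_⇔_)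
open import Relation.Binary.PropositionalEquality using (_≡_)
open import Relation.Nullary using (¬_)

record Hypergraph (r n : ℕ) : Set where
  field
    edges   : List (Subset n)
    unique  : Unique edges
    uniform : All (λ e → ∣ e ∣ ≡ r) edges
open Hypergraph public

e[_] : ∀ {r n} → Hypergraph r n → ℕ
e[ H ] = length (edges H)

-- Tent edges, with vertex x : Fin (2r-1) standing for the label toℕ x + 1.
tentEdge₁ tentEdge₂ tentEdge₃ : (r i : ℕ) → Subset (2 * r ∸ 1)
tentEdge₁ r i = tabulate λ x → let v = suc (toℕ x) in (1 ≤ᵇ v) ∧ (v ≤ᵇ r)
tentEdge₂ r i = tabulate λ x → let v = suc (toℕ x) in
  ((1 ≤ᵇ v) ∧ (v ≤ᵇ i)) ∨ ((r + 1 ≤ᵇ v) ∧ (v ≤ᵇ 2 * r ∸ i ∸ 1)) ∨ (v ≡ᵇ 2 * r ∸ 1)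
tentEdge₃ r i = tabulate λ x → let v = suc (toℕ x) in
  ((i + 1 ≤ᵇ v) ∧ (v ≤ᵇ r)) ∨ ((2 * r ∸ i ≤ᵇ v) ∧ (v ≤ᵇ 2 * r ∸ 1))

tentEdges : (r i : ℕ) → List (Subset (2 * r ∸ 1))
tentEdges r i = tentEdge₁ r i ∷ tentEdge₂ r i ∷ tentEdge₃ r i ∷ []

ContainsTent : ∀ {r n} → ℕ → Hypergraph r n → Set
ContainsTent {r} {n} i H =
  Σ (Fin (2 * r ∸ 1) → Fin n) λ φ → Injective _≡_ _≡_ φ ×
    (∀ e → e LM.∈ tentEdges r i →
      Σ (Subset n) λ e′ → e′ LM.∈ edges H ×
        (∀ y → (y ∈ e′) ⇔ (∃[ x ] (x ∈ e × φ x ≡ y))))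

FFree : ∀ {r n} → (k : ℕ) → Hypergraph r n → Set
FFree k H = ∀ i → 1 ≤ i → i ≤ k → ¬ ContainsTent i H

IsEx : (r k n m : ℕ) → Set
IsEx r k n m =
  (Σ (Hypergraph r n) λ H → FFree k H × e[ H ] ≡ m) ×
  (∀ (H : Hypergraph r n) → FFree k H → e[ H ] ≤ m)

-- π(F_{r,k}) = a/b (b > 0):  for every rational ε = p/q > 0 there is N such
-- that for all n ≥ N, |ex(n,F)/C(n,r) - a/b| < ε, i.e. (clearing denominators)
-- q · |ex·b - a·C(n,r)| < p · C(n,r) · b.
TuranDensityIs : (r k a b : ℕ) → Set
TuranDensityIs r k a b =
  ∀ p q → 1 ≤ p → 1 ≤ q → ∃[ N ] ∀ n → N ≤ n → ∀ m → IsEx r k n m →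
    q * ∣ + (m * b) - + (a * (n C r)) ∣ℤ < p * (n C r) * b

-- Euler's number: s_N = Σ_{j≤N} 1/j! = eNum N / N!, where
-- eNum 0 = 1, eNum (N+1) = (N+1)·eNum N + 1.  s_N increases strictly to e.
eNum : ℕ → ℕ
eNum zero    = 1
eNum (suc N) = suc N * eNum N + 1

-- r < k·e  (equivalently, since s_N ↑ e: some partial sum satisfies r < k·s_N)
_<_·e : ℕ → ℕ → Set
r < k ·e = ∃[ N ] (r * N ! < k * eNum N)

-- k = ⌈r/e⌉: k is the least natural with r ≤ k·e; as r/e is irrational for
-- r ≥ 1, this means r < k·e and ¬ (r < (k-1)·e), with k ≥ 1.
IsCeilDivE : (r k : ℕ) → Set
IsCeilDivE r k = 1 ≤ k × (r < k ·e) × ¬ (r < (k ∸ 1) ·e)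

{-# OPTIONS --safe #-}

-- Upper bound.  Discard the few edges of a free hypergraph in which some tuple has only few
-- extensions; among the remaining good edges even degenerate copies of the tents are excluded,
-- because a degenerate copy could be completed anew avoiding all coincidences.  For a tuple p of
-- vertices let y p be the number of vertices that extend it within a good edge.  If C I J is an
-- ordering of a good edge and |I| ≤ k, then no vertex extends both C I and C J, so
-- y (C I) + y (C J) ≤ y C.  Hence the sums X j of y over the (r - j)-prefixes of all ordered
-- good edges satisfy X i + X j ≤ X (i + j) for i ≤ k, and this implies Σ X j / j ≤ X r as soon
-- as Σ_{k < j ≤ r} 1 / j ≤ 1, which is where k ≥ r / e enters.  Revealing an ordered edge one
-- vertex at a time, uniformly among the extending vertices, gives Σ Π 1 / y ≤ 1 over ordered
-- edges and their prefixes, so by AM-GM there are at most r! (n / r)^r ordered good edges.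
--
-- Lower bound.  The balanced complete r-partite hypergraph contains no tent Δ_(r-i,i), i < r.

module Submission where

-- In the complete r-partite hypergraph a prefix that lacks j vertices has y = j n / r, so all the
-- quotients y / j agree; hence the weights 1 / j. The bound Σ X j / j ≤ X r says that Σ y / j is at
-- most n on average over the ordered good edges. For a single edge, AM-GM bounds Π 1 / y from below
-- by a convex function of Σ y / j. Only the average of this sum is controlled, so the function is
-- replaced by its tangent line at the extremal value n, and the linear inequalities are added.
--
-- The other obstacle is that X is superadditive only when one summand is at most k. The least
-- increment `L` of X over windows of given length is superadditive without restriction, is at least
-- X up to k, and yields X j ≤ X r - L (r - j) beyond k. With c = (Σ_{j ≤ k} L j / j) / k and H =
-- Σ_{k < j ≤ r} 1 / j these estimates combine to Σ X j / j ≤ (1 - H) c r + H X r, where c r ≤ X r;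
-- so H ≤ 1 is exactly what makes the right side at most X r.

module Rationals where

  open import Data.Nat as ℕ using (ℕ; zero; suc; _!)
  import Data.Nat.Properties as ℕ
  open import Data.Rational
  open import Data.Rational.Properties
  open import Data.Maybe using (Maybe; just; nothing)
  open import Data.Sum using (inj₁; inj₂)
  open import Data.Product using (_,_)
  open import Data.Empty using (⊥-elim)
  open import Level using (0ℓ)
  open import Relation.Nullary using (yes; no)
  open import Relation.Binary.PropositionalEquality
  open import Tactic.RingSolver using (solve-∀)
  open import Tactic.RingSolver.Core.AlmostCommutativeRing using (AlmostCommutativeRing; fromCommutativeRing)
  open import Defs using (eNum; _<_·e)

  -- Rational inequalities and finite sums

  ℚ-ring : AlmostCommutativeRing 0ℓ 0ℓ
  ℚ-ring = fromCommutativeRing +-*-commutativeRing isZero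
    where
    isZero : ∀ x → Maybe (0ℚ ≡ x)
    isZero x with 0ℚ ≟ x
    ... | yes eq = just eq
    ... | no _ = nothing

  -- Inequalities are proved by exhibiting the difference of the two sides as a visibly
  -- nonnegative term; the remaining identity is left to the ring solver.
  ≤-by : ∀ {p q} d → 0ℚ ≤ d → q ≡ p + d → p ≤ q
  ≤-by {p} {q} d 0≤d eq = begin
    p       ≡⟨ +-identityʳ p ⟨
    p + 0ℚ  ≤⟨ +-monoʳ-≤ p 0≤d ⟩
    p + d   ≡⟨ eq ⟨
    q       ∎
    where open ≤-Reasoning

  0≤q-p : ∀ {p q} → p ≤ q → 0ℚ ≤ q - p
  0≤q-p {p} {q} p≤q = subst (_≤ q - p) (+-inverseʳ p) (+-monoˡ-≤ (- p) p≤q)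

  infixl 6 _⊕_
  _⊕_ : ∀ {p q} → 0ℚ ≤ p → 0ℚ ≤ q → 0ℚ ≤ p + q
  p ⊕ q = +-mono-≤ p q

  infixl 7 _⊗_
  _⊗_ : ∀ {p q} → 0ℚ ≤ p → 0ℚ ≤ q → 0ℚ ≤ p * q
  _⊗_ {p} {q} 0≤p 0≤q = nonNegative⁻¹ (p * q)
    {{nonNeg*nonNeg⇒nonNeg p {{nonNegative 0≤p}} q {{nonNegative 0≤q}}}}

  ι : ℕ → ℚ
  ι zero    = 0ℚ
  ι (suc n) = 1ℚ + ι n

  0≤1ℚ : 0ℚ ≤ 1ℚ
  0≤1ℚ = nonNegative⁻¹ 1ℚ

  ι-nonneg : ∀ n → 0ℚ ≤ ι n
  ι-nonneg zero    = ≤-refl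
  ι-nonneg (suc n) = 0≤1ℚ ⊕ ι-nonneg n

  ι-suc-pos : ∀ n → Positive (ι (suc n))
  ι-suc-pos n = pos+nonNeg⇒pos 1ℚ (ι n) {{nonNegative (ι-nonneg n)}}

  ι-+ : ∀ m n → ι (m ℕ.+ n) ≡ ι m + ι n
  ι-+ zero    n = sym (+-identityˡ (ι n))
  ι-+ (suc m) n = trans (cong (λ x → 1ℚ + x) (ι-+ m n)) (sym (+-assoc 1ℚ (ι m) (ι n)))

  ι-* : ∀ m n → ι (m ℕ.* n) ≡ ι m * ι n
  ι-* zero    n = sym (*-zeroˡ (ι n))
  ι-* (suc m) n = begin
    ι (n ℕ.+ m ℕ.* n)   ≡⟨ ι-+ n (m ℕ.* n) ⟩
    ι n + ι (m ℕ.* n)   ≡⟨ cong (λ x → ι n + x) (ι-* m n) ⟩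
    ι n + ι m * ι n     ≡⟨ eq (ι m) (ι n) ⟩
    (1ℚ + ι m) * ι n    ∎
    where
    open ≡-Reasoning
    eq : ∀ a b → b + a * b ≡ (1ℚ + a) * b
    eq = solve-∀ ℚ-ring

  ι-mono : ∀ {m n} → m ℕ.≤ n → ι m ≤ ι n
  ι-mono {n = n} ℕ.z≤n   = ι-nonneg n
  ι-mono (ℕ.s≤s m≤n) = +-monoʳ-≤ 1ℚ (ι-mono m≤n)

  ι-mono-< : ∀ {m n} → m ℕ.< n → ι m < ι n
  ι-mono-< {m} {n} m<n = <-≤-trans (lt (ι m)) (ι-mono m<n)
    where
    lt : ∀ a → a < 1ℚ + a
    lt a = subst (_< 1ℚ + a) (+-identityˡ a) (+-monoˡ-< a (positive⁻¹ 1ℚ))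

  ι-≤⁻¹ : ∀ {m n} → ι m ≤ ι n → m ℕ.≤ n
  ι-≤⁻¹ {m} {n} le with m ℕ.≤? n
  ... | yes m≤n = m≤n
  ... | no m≰n = ⊥-elim (<-irrefl refl (<-≤-trans (ι-mono-< (ℕ.≰⇒> m≰n)) le))

  -- The default 0 at 0 keeps `inv` total and nonnegative, so terms of sums need no proof that their
  -- index is positive.
  inv : ℕ → ℚ
  inv zero    = 0ℚ
  inv (suc n) = (1/ ι (suc n)) {{pos⇒nonZero (ι (suc n)) {{ι-suc-pos n}}}}

  ι*inv : ∀ n → ι (suc n) * inv (suc n) ≡ 1ℚ
  ι*inv n = *-inverseʳ (ι (suc n)) {{pos⇒nonZero (ι (suc n)) {{ι-suc-pos n}}}}

  inv-nonneg : ∀ n → 0ℚ ≤ inv n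
  inv-nonneg zero    = ≤-refl
  inv-nonneg (suc n) = <⇒≤ (positive⁻¹ (inv (suc n)) {{1/pos⇒pos (ι (suc n)) {{ι-suc-pos n}}}})

  cancel-ι : ∀ n {p q} → ι (suc n) * p ≤ ι (suc n) * q → p ≤ q
  cancel-ι n = *-cancelˡ-≤-pos (ι (suc n)) {{ι-suc-pos n}}

  Σ₁ : ℕ → (ℕ → ℚ) → ℚ
  Σ₁ zero    f = 0ℚ
  Σ₁ (suc n) f = Σ₁ n f + f (suc n)

  Σ₁-mono : ∀ n {f g} → (∀ j → 1 ℕ.≤ j → j ℕ.≤ n → f j ≤ g j) → Σ₁ n f ≤ Σ₁ n g
  Σ₁-mono zero    h = ≤-refl
  Σ₁-mono (suc n) h = +-mono-≤ (Σ₁-mono n λ j 1≤j j≤n → h j 1≤j (ℕ.m≤n⇒m≤1+n j≤n))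
                               (h (suc n) (ℕ.s≤s ℕ.z≤n) ℕ.≤-refl)

  Σ₁-cong : ∀ n {f g} → (∀ j → 1 ℕ.≤ j → j ℕ.≤ n → f j ≡ g j) → Σ₁ n f ≡ Σ₁ n g
  Σ₁-cong zero    h = refl
  Σ₁-cong (suc n) h = cong₂ _+_ (Σ₁-cong n λ j 1≤j j≤n → h j 1≤j (ℕ.m≤n⇒m≤1+n j≤n))
                                (h (suc n) (ℕ.s≤s ℕ.z≤n) ℕ.≤-refl)

  Σ₁-+ : ∀ n f g → Σ₁ n (λ j → f j + g j) ≡ Σ₁ n f + Σ₁ n g
  Σ₁-+ zero    f g = refl
  Σ₁-+ (suc n) f g = trans (cong (λ x → x + (f (suc n) + g (suc n))) (Σ₁-+ n f g))
                           (eq (Σ₁ n f) (Σ₁ n g) (f (suc n)) (g (suc n)))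
    where
    eq : ∀ a b c d → (a + b) + (c + d) ≡ (a + c) + (b + d)
    eq = solve-∀ ℚ-ring

  Σ₁-*ˡ : ∀ n c f → Σ₁ n (λ j → c * f j) ≡ c * Σ₁ n f
  Σ₁-*ˡ zero    c f = sym (*-zeroʳ c)
  Σ₁-*ˡ (suc n) c f = trans (cong (λ x → x + c * f (suc n)) (Σ₁-*ˡ n c f))
                            (sym (*-distribˡ-+ c (Σ₁ n f) (f (suc n))))

  Σ₁-const : ∀ n c → Σ₁ n (λ _ → c) ≡ ι n * c
  Σ₁-const zero    c = sym (*-zeroˡ c)
  Σ₁-const (suc n) c = trans (cong (λ x → x + c) (Σ₁-const n c)) (eq (ι n) c)
    where
    eq : ∀ a b → a * b + b ≡ (1ℚ + a) * b
    eq = solve-∀ ℚ-ring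

  Σ₁-split : ∀ m n f → Σ₁ (m ℕ.+ n) f ≡ Σ₁ m f + Σ₁ n (λ d → f (m ℕ.+ d))
  Σ₁-split m zero    f rewrite ℕ.+-identityʳ m = sym (+-identityʳ (Σ₁ m f))
  Σ₁-split m (suc n) f rewrite ℕ.+-suc m n =
    trans (cong (λ x → x + f (suc (m ℕ.+ n))) (Σ₁-split m n f))
          (+-assoc (Σ₁ m f) (Σ₁ n (λ d → f (m ℕ.+ d))) (f (suc (m ℕ.+ n))))

  Σ₁-reflect : ∀ n f → Σ₁ n (λ j → f (suc n ℕ.∸ j)) ≡ Σ₁ n f
  Σ₁-reflect zero    f = refl
  Σ₁-reflect (suc n) f = begin
    Σ₁ (suc n) (λ j → f (suc (suc n) ℕ.∸ j))
      ≡⟨ Σ₁-split 1 n (λ j → f (suc (suc n) ℕ.∸ j)) ⟩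
    (0ℚ + f (suc n)) + Σ₁ n (λ j → f (suc n ℕ.∸ j))
      ≡⟨ cong (λ x → (0ℚ + f (suc n)) + x) (Σ₁-reflect n f) ⟩
    (0ℚ + f (suc n)) + Σ₁ n f
      ≡⟨ eq (f (suc n)) (Σ₁ n f) ⟩
    Σ₁ n f + f (suc n) ∎
    where
    open ≡-Reasoning
    eq : ∀ a b → (0ℚ + a) + b ≡ b + a
    eq = solve-∀ ℚ-ring

  -- Harmonic weights: the fully superadditive case

  β : (ℕ → ℚ) → ℕ → ℚ
  β f n = Σ₁ n (λ j → f j * inv j)

  Superadditive : ℕ → (ℕ → ℚ) → Set
  Superadditive N f = ∀ i j → 1 ℕ.≤ i → 1 ℕ.≤ j → i ℕ.+ j ℕ.≤ N → f i + f j ≤ f (i ℕ.+ j)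

  -- Summation by parts: f i / i occurs in β f i, ..., β f n, that is n + 1 - i times, and so
  -- contributes (n + 1) f i / i - f i to the sum of β.
  β-sum : ∀ f n → ι (suc n) * β f n ≡ Σ₁ n (β f) + Σ₁ n f
  β-sum f zero    = *-zeroʳ (ι 1)
  β-sum f (suc n) = begin
    (1ℚ + ι (suc n)) * (b + x * inv (suc n))
      ≡⟨ eq₁ (ι (suc n)) b x (inv (suc n)) ⟩
    ι (suc n) * b + x * (ι (suc n) * inv (suc n)) + (b + x * inv (suc n))
      ≡⟨ cong₂ (λ s t → s + x * t + (b + x * inv (suc n))) (β-sum f n) (ι*inv n) ⟩
    Σ₁ n (β f) + Σ₁ n f + x * 1ℚ + (b + x * inv (suc n))
      ≡⟨ eq₂ (Σ₁ n (β f)) (Σ₁ n f) x (b + x * inv (suc n)) ⟩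
    Σ₁ n (β f) + (b + x * inv (suc n)) + (Σ₁ n f + x) ∎
    where
    open ≡-Reasoning
    b = β f n
    x = f (suc n)
    eq₁ : ∀ s b x v → (1ℚ + s) * (b + x * v) ≡ s * b + x * (s * v) + (b + x * v)
    eq₁ = solve-∀ ℚ-ring
    eq₂ : ∀ p q x y → p + q + x * 1ℚ + y ≡ p + y + (q + x)
    eq₂ = solve-∀ ℚ-ring

  -- Pair the index j with n + 1 - j.
  Σ₁-superadditive : ∀ N f → Superadditive N f → ∀ n → suc n ℕ.≤ N →
    Σ₁ n f + Σ₁ n f ≤ ι n * f (suc n)
  Σ₁-superadditive N f sup n n<N = begin
    Σ₁ n f + Σ₁ n f
      ≡⟨ cong (λ x → Σ₁ n f + x) (Σ₁-reflect n f) ⟨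
    Σ₁ n f + Σ₁ n (λ j → f (suc n ℕ.∸ j))
      ≡⟨ Σ₁-+ n f (λ j → f (suc n ℕ.∸ j)) ⟨
    Σ₁ n (λ j → f j + f (suc n ℕ.∸ j))
      ≤⟨ Σ₁-mono n pair ⟩
    Σ₁ n (λ _ → f (suc n))
      ≡⟨ Σ₁-const n (f (suc n)) ⟩
    ι n * f (suc n) ∎
    where
    open ≤-Reasoning
    pair : ∀ j → 1 ℕ.≤ j → j ℕ.≤ n → f j + f (suc n ℕ.∸ j) ≤ f (suc n)
    pair j 1≤j j≤n = subst (λ m → f j + f (suc n ℕ.∸ j) ≤ f m) e
      (sup j (suc n ℕ.∸ j) 1≤j (ℕ.m<n⇒0<n∸m (ℕ.s≤s j≤n)) (subst (ℕ._≤ N) (sym e) n<N))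
      where
      e : j ℕ.+ (suc n ℕ.∸ j) ≡ suc n
      e = ℕ.m+[n∸m]≡n (ℕ.m≤n⇒m≤1+n j≤n)

  -- Strong induction with `m` as fuel. Multiplied by n + 1, the claim at n + 1 reads Σ β f j + Σ f
  -- j + f (n + 1) ≤ (n + 1) f (n + 1), with sums over j ≤ n. The induction hypothesis replaces β f
  -- j by f j, and pairing bounds twice the sum of f by n f (n + 1).
  β-below : ∀ N f → Superadditive N f → ∀ m n → n ℕ.≤ m → 1 ℕ.≤ n → n ℕ.≤ N → β f n ≤ f n
  β-below N f sup zero    (suc n) () _ _
  β-below N f sup (suc m) (suc n) (ℕ.s≤s n≤m) _ n<N =
    cancel-ι n (≤-by (ι n * x - (Σ₁ n f + Σ₁ n f) + (Σ₁ n f - Σ₁ n (β f)))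
      (0≤q-p (Σ₁-superadditive N f sup n n<N) ⊕ 0≤q-p smaller) (sym eq))
    where
    b = β f n
    x = f (suc n)
    smaller : Σ₁ n (β f) ≤ Σ₁ n f
    smaller = Σ₁-mono n λ j 1≤j j≤n →
      β-below N f sup m j (ℕ.≤-trans j≤n n≤m) 1≤j (ℕ.≤-trans j≤n (ℕ.<⇒≤ n<N))
    open ≡-Reasoning
    eq₁ : ∀ s b x v → s * (b + x * v) ≡ s * b + x * (s * v)
    eq₁ = solve-∀ ℚ-ring
    eq₂ : ∀ p q x s → p + q + x * 1ℚ + (s * x - (q + q) + (q - p)) ≡ (1ℚ + s) * x
    eq₂ = solve-∀ ℚ-ring
    d = ι n * x - (Σ₁ n f + Σ₁ n f) + (Σ₁ n f - Σ₁ n (β f))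
    eq : ι (suc n) * β f (suc n) + d ≡ ι (suc n) * x
    eq = begin
      ι (suc n) * (b + x * inv (suc n)) + d
        ≡⟨ cong (λ y → y + d) (eq₁ (ι (suc n)) b x (inv (suc n))) ⟩
      ι (suc n) * b + x * (ι (suc n) * inv (suc n)) + d
        ≡⟨ cong₂ (λ s t → s + x * t + d) (β-sum f n) (ι*inv n) ⟩
      Σ₁ n (β f) + Σ₁ n f + x * 1ℚ + d
        ≡⟨ eq₂ (Σ₁ n (β f)) (Σ₁ n f) x (ι n) ⟩
      ι (suc n) * x ∎

  β≤ : ∀ N f → Superadditive N f → ∀ n → 1 ℕ.≤ n → n ℕ.≤ N → β f n ≤ f n
  β≤ N f sup n = β-below N f sup n n ℕ.≤-refl

  -- Superadditive sequences

  inv-suc-≤ : ∀ n → inv (suc (suc n)) ≤ inv (suc n)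
  inv-suc-≤ n = ≤-by (u * v) (inv-nonneg (suc n) ⊗ inv-nonneg (suc (suc n))) eq
    where
    u = inv (suc n)
    v = inv (suc (suc n))
    open ≡-Reasoning
    eq₁ : ∀ s u v → u * ((1ℚ + s) * v) ≡ v * (s * u) + u * v
    eq₁ = solve-∀ ℚ-ring
    eq : u ≡ v + u * v
    eq = begin
      u                               ≡⟨ *-identityʳ u ⟨
      u * 1ℚ                          ≡⟨ cong (λ x → u * x) (ι*inv (suc n)) ⟨
      u * ((1ℚ + ι (suc n)) * v)      ≡⟨ eq₁ (ι (suc n)) u v ⟩
      v * (ι (suc n) * u) + u * v     ≡⟨ cong (λ x → v * x + u * v) (ι*inv n) ⟩
      v * 1ℚ + u * v                  ≡⟨ cong (λ x → x + u * v) (*-identityʳ v) ⟩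
      v + u * v                       ∎

  minUpTo : ℕ → (ℕ → ℚ) → ℚ
  minUpTo zero    g = g zero
  minUpTo (suc m) g = minUpTo m g ⊓ g (suc m)

  minUpTo-≤ : ∀ m g j → j ℕ.≤ m → minUpTo m g ≤ g j
  minUpTo-≤ zero    g zero    _ = ≤-refl
  minUpTo-≤ (suc m) g j j≤1+m with ℕ.m≤n⇒m<n∨m≡n j≤1+m
  ... | inj₁ (ℕ.s≤s j≤m) = ≤-trans (p⊓q≤p (minUpTo m g) (g (suc m))) (minUpTo-≤ m g j j≤m)
  ... | inj₂ refl        = p⊓q≤q (minUpTo m g) (g (suc m))

  minUpTo-glb : ∀ m g {c} → (∀ j → j ℕ.≤ m → c ≤ g j) → c ≤ minUpTo m g
  minUpTo-glb zero    g h = h zero ℕ.z≤n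
  minUpTo-glb (suc m) g h = ⊓-glb (minUpTo-glb m g λ j j≤m → h j (ℕ.m≤n⇒m≤1+n j≤m))
                                  (h (suc m) ℕ.≤-refl)

  SuperadditiveUpTo : ℕ → ℕ → (ℕ → ℚ) → Set
  SuperadditiveUpTo k r X =
    ∀ i j → 1 ℕ.≤ i → i ℕ.≤ k → 1 ℕ.≤ j → i ℕ.+ j ℕ.≤ r → X i + X j ≤ X (i ℕ.+ j)

  -- The shape r = k + 1 + T with T = k + T′ builds in r ≥ 2 k + 1. Then T ≥ k, so the indices 1,
  -- ..., T that arise by reflecting k + 1, ..., r - 1 include all of 1, ..., k.
  module LongRange (k′ T′ : ℕ) (X : ℕ → ℚ) (X0 : X 0 ≡ 0ℚ) where

    k T r : ℕ
    k = suc k′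
    T = k ℕ.+ T′
    r = k ℕ.+ suc T

    module _ (sup : SuperadditiveUpTo k r X)
             (H≤1 : Σ₁ (suc T) (λ d → inv (k ℕ.+ d)) ≤ 1ℚ) where

      -- The least increment of X over a window of length t is superadditive in t for
      -- all arguments, even though X itself is so only for short summands.
      L : ℕ → ℚ
      L t = minUpTo (r ℕ.∸ t) (λ j → X (j ℕ.+ t) - X j)

      L≤increment : ∀ j t → j ℕ.+ t ℕ.≤ r → L t ≤ X (j ℕ.+ t) - X j
      L≤increment j t le = minUpTo-≤ (r ℕ.∸ t) _ j (ℕ.m+n≤o⇒m≤o∸n j le)

      L-superadditive : Superadditive r L
      L-superadditive i j _ _ i+j≤r = minUpTo-glb (r ℕ.∸ (i ℕ.+ j)) _ λ a a≤ →
        let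
          a+ij≤r : a ℕ.+ (i ℕ.+ j) ℕ.≤ r
          a+ij≤r = ℕ.m≤o∸n⇒m+n≤o a i+j≤r a≤
          ai+j≤r : a ℕ.+ i ℕ.+ j ℕ.≤ r
          ai+j≤r = subst (ℕ._≤ r) (sym (ℕ.+-assoc a i j)) a+ij≤r
        in begin
          L i + L j
            ≤⟨ +-mono-≤ (L≤increment a i (ℕ.m+n≤o⇒m≤o (a ℕ.+ i) ai+j≤r))
                        (L≤increment (a ℕ.+ i) j ai+j≤r) ⟩
          X (a ℕ.+ i) - X a + (X (a ℕ.+ i ℕ.+ j) - X (a ℕ.+ i))
            ≡⟨ eq (X (a ℕ.+ i)) (X a) (X (a ℕ.+ i ℕ.+ j)) ⟩
          X (a ℕ.+ i ℕ.+ j) - X a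
            ≡⟨ cong (λ m → X m - X a) (ℕ.+-assoc a i j) ⟩
          X (a ℕ.+ (i ℕ.+ j)) - X a ∎
        where
        open ≤-Reasoning
        eq : ∀ x y z → x - y + (z - x) ≡ z - y
        eq = solve-∀ ℚ-ring

      -- Short superadditivity bounds every increment over a window of length t ≤ k; the window
      -- starting at 0 is covered by X 0 = 0.
      X≤L : ∀ t → 1 ℕ.≤ t → t ℕ.≤ k → X t ≤ L t
      X≤L t 1≤t t≤k = minUpTo-glb (r ℕ.∸ t) _ λ j j≤ → ≤-by (X (j ℕ.+ t) - (X t + X j))
        (0≤q-p (step j (ℕ.m≤o∸n⇒m+n≤o j t≤r j≤)))
        (eq (X (j ℕ.+ t)) (X t) (X j))
        where
        t≤r : t ℕ.≤ r
        t≤r = ℕ.≤-trans t≤k (ℕ.m≤m+n k (suc T))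
        step : ∀ j → j ℕ.+ t ℕ.≤ r → X t + X j ≤ X (j ℕ.+ t)
        step zero    _  = ≤-reflexive (trans (cong (λ x → X t + x) X0) (+-identityʳ (X t)))
        step (suc j) le = subst (λ m → X t + X (suc j) ≤ X m) (ℕ.+-comm t (suc j))
          (sup t (suc j) 1≤t t≤k (ℕ.s≤s ℕ.z≤n) (subst (ℕ._≤ r) (ℕ.+-comm (suc j) t) le))
        eq : ∀ x y z → x - z ≡ y + (x - (y + z))
        eq = solve-∀ ℚ-ring

      L≤Xr : L r ≤ X r
      L≤Xr = subst (L r ≤_) (trans (cong (λ x → X r - x) X0) (+-identityʳ (X r)))
                   (L≤increment 0 r ℕ.≤-refl)

      b : ℕ → ℚ
      b = β L

      b≤L : ∀ n → 1 ℕ.≤ n → n ℕ.≤ r → b n ≤ L n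
      b≤L = β≤ r L L-superadditive

      slope : ℕ → ℚ
      slope n = b n * inv n

      b≡slope : ∀ n → b (suc n) ≡ ι (suc n) * slope (suc n)
      b≡slope n = begin
        b (suc n)                                ≡⟨ *-identityʳ (b (suc n)) ⟨
        b (suc n) * 1ℚ                           ≡⟨ cong (λ x → b (suc n) * x) (ι*inv n) ⟨
        b (suc n) * (ι (suc n) * inv (suc n))    ≡⟨ eq (b (suc n)) (ι (suc n)) (inv (suc n)) ⟩
        ι (suc n) * slope (suc n)                ∎
        where
        open ≡-Reasoning
        eq : ∀ x y z → x * (y * z) ≡ y * (x * z)
        eq = solve-∀ ℚ-ring

      -- With N = n + 1, the definition of `b` gives N b (N + 1) = (N + 1) b N + (L (N + 1) - b (N +
      -- 1)), and the last difference is nonnegative by `b≤L`.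
      slope-suc : ∀ n → suc (suc n) ℕ.≤ r → slope (suc n) ≤ slope (suc (suc n))
      slope-suc n le = cancel-ι (suc n) (cancel-ι n
          (≤-by (x - b₂) (0≤q-p (b≤L (suc (suc n)) (ℕ.s≤s ℕ.z≤n) le)) (begin
            s * ((1ℚ + s) * a₂)
              ≡⟨ cong (λ y → s * y) (b≡slope (suc n)) ⟨
            s * b₂
              ≡⟨ eq₁ s b₁ x v ⟩
            (1ℚ + s) * b₁ + x * ((1ℚ + s) * v) - b₂
              ≡⟨ cong₂ (λ y z → (1ℚ + s) * y + x * z - b₂) (b≡slope n) (ι*inv (suc n)) ⟩
            (1ℚ + s) * (s * a₁) + x * 1ℚ - b₂
              ≡⟨ eq₂ s a₁ x b₂ ⟩
            s * ((1ℚ + s) * a₁) + (x - b₂) ∎)))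
        where
        s = ι (suc n)
        v = inv (suc (suc n))
        x = L (suc (suc n))
        a₁ = slope (suc n)
        a₂ = slope (suc (suc n))
        b₁ = b (suc n)
        b₂ = b (suc (suc n))
        open ≡-Reasoning
        eq₁ : ∀ s b x v → s * (b + x * v) ≡ (1ℚ + s) * b + x * ((1ℚ + s) * v) - (b + x * v)
        eq₁ = solve-∀ ℚ-ring
        eq₂ : ∀ s a x y → (1ℚ + s) * (s * a) + x * 1ℚ - y ≡ s * ((1ℚ + s) * a) + (x - y)
        eq₂ = solve-∀ ℚ-ring

      slope-mono : ∀ n d → suc n ℕ.+ d ℕ.≤ r → slope (suc n) ≤ slope (suc n ℕ.+ d)
      slope-mono n zero    le rewrite ℕ.+-identityʳ n = ≤-refl
      slope-mono n (suc d) le rewrite ℕ.+-suc n d =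
        ≤-trans (slope-mono n d (ℕ.<⇒≤ le)) (slope-suc (n ℕ.+ d) le)

      -- As slopes increase, the line t ↦ c t lies above `b` up to k, touches it at k, and lies
      -- below `b`, hence below `L`, from k on.
      c : ℚ
      c = slope k

      k<r : k ℕ.< r
      k<r = ℕ.m<m+n k (ℕ.s≤s ℕ.z≤n)

      b≤c : ∀ n → n ℕ.≤ k → b n ≤ c * ι n
      b≤c zero    _   = ≤-reflexive (sym (*-zeroʳ c))
      b≤c (suc n) n<k = ≤-by (ι (suc n) * (c - slope (suc n)))
        (ι-nonneg (suc n) ⊗ 0≤q-p s≤c)
        (trans (eq c (ι (suc n)) (slope (suc n)))
               (cong (λ x → x + ι (suc n) * (c - slope (suc n))) (sym (b≡slope n))))
        where
        e : suc n ℕ.+ (k ℕ.∸ suc n) ≡ k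
        e = ℕ.m+[n∸m]≡n n<k
        s≤c : slope (suc n) ≤ c
        s≤c = subst (λ m → slope (suc n) ≤ slope m) e
          (slope-mono n (k ℕ.∸ suc n) (subst (ℕ._≤ r) (sym e) (ℕ.<⇒≤ k<r)))
        eq : ∀ c s a → c * s ≡ s * a + s * (c - a)
        eq = solve-∀ ℚ-ring

      c≤L : ∀ d → k ℕ.+ d ℕ.≤ r → c * ι (k ℕ.+ d) ≤ L (k ℕ.+ d)
      c≤L d le = ≤-trans
        (≤-by (ι n * (slope n - c)) (ι-nonneg n ⊗ 0≤q-p (slope-mono k′ d le))
              (trans (b≡slope (k′ ℕ.+ d)) (eq c (ι n) (slope n))))
        (b≤L n (ℕ.s≤s ℕ.z≤n) le)
        where
        n = k ℕ.+ d
        eq : ∀ c s a → s * a ≡ c * s + s * (a - c)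
        eq = solve-∀ ℚ-ring

      M : ℕ → ℚ
      M t = L t - c * ι t

      -- Summation by parts: b s − c s ≤ 0 for s ≤ k, and s / (r − s) increases with s.
      abel : ∀ s → s ℕ.≤ k →
        ι s * inv (r ℕ.∸ s) * (b s - c * ι s) ≤ Σ₁ s (λ t → M t * inv (r ℕ.∸ t))
      abel zero    _   = ≤-reflexive (eq (inv r) (0ℚ - c * 0ℚ))
        where
        eq : ∀ u x → 0ℚ * u * x ≡ 0ℚ
        eq = solve-∀ ℚ-ring
      abel (suc s) s<k = ≤-trans
          -- The second factor equals (s + 1) v - s u, the increment of s / (r - s).
          (≤-by ((c * ι s - b s) * (v + ι s * (v - u)))
            (0≤q-p (b≤c s (ℕ.<⇒≤ s<k)) ⊗ (inv-nonneg (r ℕ.∸ suc s) ⊕ (ι-nonneg s ⊗ 0≤q-p u≤v)))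
            eq)
          (+-monoˡ-≤ (M (suc s) * v) (abel s (ℕ.<⇒≤ s<k)))
        where
        u = inv (r ℕ.∸ s)
        v = inv (r ℕ.∸ suc s)
        w = inv (suc s)
        x = L (suc s)
        u≤v : u ≤ v
        u≤v = go (r ℕ.∸ suc s) (ℕ.m<n⇒0<n∸m (ℕ.≤-<-trans s<k k<r))
                 (sym (ℕ.+-∸-assoc 1 (ℕ.<-≤-trans s<k (ℕ.<⇒≤ k<r))))
          where
          go : ∀ m → 0 ℕ.< m → suc m ≡ r ℕ.∸ s → inv (r ℕ.∸ s) ≤ inv m
          go (suc m) _ e = subst (λ y → inv y ≤ inv (suc m)) e (inv-suc-≤ m)
        open ≡-Reasoning
        eq₁ : ∀ s u v B c x → s * u * (B - c * s) + (x - c * (1ℚ + s)) * v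
            ≡ (1ℚ + s) * v * B + x * 1ℚ * v - (1ℚ + s) * v * (c * (1ℚ + s)) + (c * s - B) * (v + s * (v - u))
        eq₁ = solve-∀ ℚ-ring
        eq₂ : ∀ s v B c x w → (1ℚ + s) * v * B + x * ((1ℚ + s) * w) * v - (1ℚ + s) * v * (c * (1ℚ + s))
            ≡ (1ℚ + s) * v * (B + x * w - c * (1ℚ + s))
        eq₂ = solve-∀ ℚ-ring
        eq : ι s * u * (b s - c * ι s) + M (suc s) * v
           ≡ ι (suc s) * v * (b (suc s) - c * ι (suc s)) + (c * ι s - b s) * (v + ι s * (v - u))
        eq = begin
          _ ≡⟨ eq₁ (ι s) u v (b s) c x ⟩
          _ ≡⟨ cong (λ y → ι (suc s) * v * b s + x * y * v - ι (suc s) * v * (c * ι (suc s)) + (c * ι s - b s) * (v + ι s * (v - u))) (ι*inv s) ⟨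
          _ ≡⟨ cong (λ y → y + (c * ι s - b s) * (v + ι s * (v - u))) (eq₂ (ι s) v (b s) c x w) ⟩
          _ ∎

      -- Up to k, `abel` bounds the sum below by a multiple of b k - c k = 0; beyond k every term is
      -- nonnegative by `c≤L`.
      0≤ΣM : 0ℚ ≤ Σ₁ T (λ t → M t * inv (r ℕ.∸ t))
      0≤ΣM = begin
        0ℚ
          ≡⟨ eq (ι k * inv (r ℕ.∸ k)) (c * ι k) ⟩
        ι k * inv (r ℕ.∸ k) * (c * ι k - c * ι k) + 0ℚ
          ≡⟨ cong (λ y → ι k * inv (r ℕ.∸ k) * (y - c * ι k) + 0ℚ)
               (trans (b≡slope k′) (*-comm (ι k) c)) ⟨
        ι k * inv (r ℕ.∸ k) * (b k - c * ι k) + 0ℚ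
          ≤⟨ +-mono-≤ (abel k ℕ.≤-refl) tail ⟩
        Σ₁ k f + Σ₁ T′ (λ d → f (k ℕ.+ d))
          ≡⟨ Σ₁-split k T′ f ⟨
        Σ₁ T f ∎
        where
        open ≤-Reasoning
        f : ℕ → ℚ
        f t = M t * inv (r ℕ.∸ t)
        eq : ∀ u x → 0ℚ ≡ u * (x - x) + 0ℚ
        eq = solve-∀ ℚ-ring
        tail : 0ℚ ≤ Σ₁ T′ (λ d → f (k ℕ.+ d))
        tail = subst (_≤ Σ₁ T′ (λ d → f (k ℕ.+ d)))
          (trans (Σ₁-const T′ 0ℚ) (*-zeroʳ (ι T′)))
          (Σ₁-mono T′ λ d _ d≤T′ → 0≤q-p (c≤L d (ℕ.+-monoʳ-≤ k
              (ℕ.≤-trans d≤T′ (ℕ.≤-trans (ℕ.m≤n+m T′ k) (ℕ.n≤1+n T)))))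
            ⊗ inv-nonneg (r ℕ.∸ (k ℕ.+ d)))

      h S : ℚ
      h = Σ₁ T (λ d → inv (k ℕ.+ d))
      S = Σ₁ T (λ t → L t * inv (r ℕ.∸ t))

      reflected : ∀ d → d ℕ.≤ T → r ℕ.∸ (suc T ℕ.∸ d) ≡ k ℕ.+ d
      reflected d d≤T = begin
        k ℕ.+ suc T ℕ.∸ (suc T ℕ.∸ d)      ≡⟨ ℕ.+-∸-assoc k (ℕ.m∸n≤m (suc T) d) ⟩
        k ℕ.+ (suc T ℕ.∸ (suc T ℕ.∸ d))    ≡⟨ cong (k ℕ.+_) (ℕ.m∸[m∸n]≡n (ℕ.m≤n⇒m≤1+n d≤T)) ⟩
        k ℕ.+ d                            ∎
        where open ≡-Reasoning

      Σ-reflected : ∀ (f : ℕ → ℚ) →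
        Σ₁ T (λ d → f (suc T ℕ.∸ d) * inv (k ℕ.+ d)) ≡ Σ₁ T (λ t → f t * inv (r ℕ.∸ t))
      Σ-reflected f = trans
        (Σ₁-cong T λ d _ d≤T → cong (λ m → f (suc T ℕ.∸ d) * inv m) (sym (reflected d d≤T)))
        (Σ₁-reflect T (λ t → f t * inv (r ℕ.∸ t)))

      r≡suc : r ≡ suc (k ℕ.+ T)
      r≡suc = ℕ.+-suc k T

      ιr*inv : ι r * inv r ≡ 1ℚ
      ιr*inv = ι*inv (k′ ℕ.+ suc T)

      -- Termwise t / (r - t) = r / (r - t) - 1, and reflection turns the denominators r - t into k
      -- + d.
      Σι : Σ₁ T (λ t → ι t * inv (r ℕ.∸ t)) ≡ ι r * h - ι T
      Σι = begin
        Σ₁ T (λ t → ι t * inv (r ℕ.∸ t))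
          ≡⟨ Σ₁-cong T (λ t _ t≤T → term t t≤T) ⟩
        Σ₁ T (λ t → ι r * (1ℚ * inv (r ℕ.∸ t)) + - 1ℚ)
          ≡⟨ Σ₁-+ T _ _ ⟩
        Σ₁ T (λ t → ι r * (1ℚ * inv (r ℕ.∸ t))) + Σ₁ T (λ _ → - 1ℚ)
          ≡⟨ cong₂ _+_ (Σ₁-*ˡ T (ι r) _) (Σ₁-const T (- 1ℚ)) ⟩
        ι r * Σ₁ T (λ t → 1ℚ * inv (r ℕ.∸ t)) + ι T * - 1ℚ
          ≡⟨ cong (λ y → ι r * y + ι T * - 1ℚ) (Σ-reflected (λ _ → 1ℚ)) ⟨
        ι r * Σ₁ T (λ d → 1ℚ * inv (k ℕ.+ d)) + ι T * - 1ℚ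
          ≡⟨ cong (λ y → ι r * y + ι T * - 1ℚ) (Σ₁-cong T (λ d _ _ → *-identityˡ (inv (k ℕ.+ d)))) ⟩
        ι r * h + ι T * - 1ℚ
          ≡⟨ eq (ι r * h) (ι T) ⟩
        ι r * h - ι T ∎
        where
        open ≡-Reasoning
        eq : ∀ x y → x + y * - 1ℚ ≡ x - y
        eq = solve-∀ ℚ-ring
        eq₁ : ∀ x y v → x * v ≡ (x + y) * (1ℚ * v) + - 1ℚ + (1ℚ - y * v)
        eq₁ = solve-∀ ℚ-ring
        eq₂ : ∀ x → x + (1ℚ - 1ℚ) ≡ x
        eq₂ = solve-∀ ℚ-ring
        term : ∀ t → t ℕ.≤ T → ι t * inv (r ℕ.∸ t) ≡ ι r * (1ℚ * inv (r ℕ.∸ t)) + - 1ℚ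
        term t t≤T = subst
            (λ z → ι t * inv z ≡ ι r * (1ℚ * inv z) + - 1ℚ) (sym e) (begin
            ι t * v
              ≡⟨ eq₁ (ι t) (ι (suc m)) v ⟩
            (ι t + ι (suc m)) * (1ℚ * v) + - 1ℚ + (1ℚ - ι (suc m) * v)
              ≡⟨ cong₂ (λ y z → y * (1ℚ * v) + - 1ℚ + (1ℚ - z)) (sym (trans (cong ι e₂) (ι-+ t (suc m)))) (ι*inv m) ⟩
            ι r * (1ℚ * v) + - 1ℚ + (1ℚ - 1ℚ)
              ≡⟨ eq₂ _ ⟩
            ι r * (1ℚ * v) + - 1ℚ ∎)
          where
          m = k ℕ.+ T ℕ.∸ t
          v = inv (suc m)
          t≤ : t ℕ.≤ k ℕ.+ T
          t≤ = ℕ.≤-trans t≤T (ℕ.m≤n+m T k)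
          e : r ℕ.∸ t ≡ suc m
          e = trans (cong (ℕ._∸ t) r≡suc) (ℕ.+-∸-assoc 1 t≤)
          e₂ : r ≡ t ℕ.+ suc m
          e₂ = trans (sym (ℕ.m+[n∸m]≡n (ℕ.≤-trans t≤T (ℕ.≤-trans (ℕ.n≤1+n T) (ℕ.m≤n+m (suc T) k)))))
                     (cong (t ℕ.+_) e)

      cΣ≤S : c * (ι r * h - ι T) ≤ S
      cΣ≤S = ≤-by _ 0≤ΣM (begin
        S
          ≡⟨ Σ₁-cong T (λ t _ _ → eq c (ι t) (L t) (inv (r ℕ.∸ t))) ⟩
        Σ₁ T (λ t → c * (ι t * inv (r ℕ.∸ t)) + M t * inv (r ℕ.∸ t))
          ≡⟨ Σ₁-+ T _ _ ⟩
        Σ₁ T (λ t → c * (ι t * inv (r ℕ.∸ t))) + Σ₁ T (λ t → M t * inv (r ℕ.∸ t))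
          ≡⟨ cong (λ y → y + Σ₁ T (λ t → M t * inv (r ℕ.∸ t))) (trans (Σ₁-*ˡ T c _) (cong (λ y → c * y) Σι)) ⟩
        c * (ι r * h - ι T) + Σ₁ T (λ t → M t * inv (r ℕ.∸ t)) ∎)
        where
        open ≡-Reasoning
        eq : ∀ c t l v → l * v ≡ c * (t * v) + (l - c * t) * v
        eq = solve-∀ ℚ-ring

      -- The window from k + d to r has length T + 1 - d, so `L` at that length is at most X r - X
      -- (k + d).
      long-part : Σ₁ T (λ d → X (k ℕ.+ d) * inv (k ℕ.+ d)) ≤ X r * h - S
      long-part = begin
        Σ₁ T (λ d → X (k ℕ.+ d) * inv (k ℕ.+ d))
          ≤⟨ Σ₁-mono T term ⟩
        Σ₁ T (λ d → X r * inv (k ℕ.+ d) + - 1ℚ * (L (suc T ℕ.∸ d) * inv (k ℕ.+ d)))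
          ≡⟨ Σ₁-+ T _ _ ⟩
        Σ₁ T (λ d → X r * inv (k ℕ.+ d)) + Σ₁ T (λ d → - 1ℚ * (L (suc T ℕ.∸ d) * inv (k ℕ.+ d)))
          ≡⟨ cong₂ _+_ (Σ₁-*ˡ T (X r) _) (trans (Σ₁-*ˡ T (- 1ℚ) _) (cong (λ y → - 1ℚ * y) (Σ-reflected L))) ⟩
        X r * h + - 1ℚ * S
          ≡⟨ eq (X r * h) S ⟩
        X r * h - S ∎
        where
        open ≤-Reasoning
        eq : ∀ x y → x + - 1ℚ * y ≡ x - y
        eq = solve-∀ ℚ-ring
        eq₁ : ∀ x y l v → x * v + - 1ℚ * (l * v) ≡ y * v + (x - y - l) * v
        eq₁ = solve-∀ ℚ-ring
        term : ∀ d → 1 ℕ.≤ d → d ℕ.≤ T → X (k ℕ.+ d) * inv (k ℕ.+ d)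
             ≤ X r * inv (k ℕ.+ d) + - 1ℚ * (L (suc T ℕ.∸ d) * inv (k ℕ.+ d))
        term d _ d≤T = ≤-by _
            (0≤q-p (subst (λ m → l ≤ X m - X j) e (L≤increment j (suc T ℕ.∸ d) (ℕ.≤-reflexive e)))
              ⊗ inv-nonneg j)
            (eq₁ (X r) (X j) l (inv j))
          where
          j = k ℕ.+ d
          l = L (suc T ℕ.∸ d)
          e : j ℕ.+ (suc T ℕ.∸ d) ≡ r
          e = trans (ℕ.+-assoc k d _) (cong (k ℕ.+_) (ℕ.m+[n∸m]≡n (ℕ.m≤n⇒m≤1+n d≤T)))

      long-range : β X r ≤ X r
      long-range = begin
        β X r
          ≡⟨ Σ₁-split k (suc T) _ ⟩
        β X k + (Σ₁ T (λ d → X (k ℕ.+ d) * inv (k ℕ.+ d)) + X r * inv r)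
          ≤⟨ +-mono-≤ short (+-monoˡ-≤ (X r * inv r) long-part) ⟩
        c * ι k + (X r * h - S + X r * inv r)
          -- Put H = h + 1 / r. As k + T = r - 1, replacing S by its lower bound turns the left side
          -- into c r (1 - H) + X r H. The slack is (X r - c r) (1 - H) plus that of `cΣ≤S`.
          ≤⟨ ≤-by _ ((0≤q-p cιr≤Xr ⊗ 0≤q-p H≤1) ⊕ 0≤q-p cΣ≤S) final ⟩
        X r ∎
        where
        open ≤-Reasoning
        short : β X k ≤ c * ι k
        short = ≤-trans
          (Σ₁-mono k λ j 1≤j j≤k → *-monoʳ-≤-nonNeg (inv j) {{nonNegative (inv-nonneg j)}} (X≤L j 1≤j j≤k))
          (b≤c k ℕ.≤-refl)
        cιr≤Xr : c * ι r ≤ X r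
        cιr≤Xr = ≤-trans (c≤L (suc T) ℕ.≤-refl) L≤Xr
        eq : ∀ x s h v c i t κ → κ + (1ℚ + t) ≡ i →
          x + c * (i * v - 1ℚ) ≡ c * κ + (x * h - s + x * v) + ((x - c * i) * (1ℚ - (h + v)) + (s - c * (i * h - t)))
        eq x s h v c i t κ refl = eq₁ x s h v c t κ
          where
          eq₁ : ∀ x s h v c t κ → x + c * ((κ + (1ℚ + t)) * v - 1ℚ) ≡ c * κ + (x * h - s + x * v) + ((x - c * (κ + (1ℚ + t))) * (1ℚ - (h + v)) + (s - c * ((κ + (1ℚ + t)) * h - t)))
          eq₁ = solve-∀ ℚ-ring
        eq₂ : ∀ x c → x ≡ x + c * (1ℚ - 1ℚ)
        eq₂ = solve-∀ ℚ-ring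
        final : X r ≡ c * ι k + (X r * h - S + X r * inv r)
          + ((X r - c * ι r) * (1ℚ - (h + inv r)) + (S - c * (ι r * h - ι T)))
        final = trans (eq₂ (X r) c) (trans (cong (λ y → X r + c * (y - 1ℚ)) (sym ιr*inv))
          (eq (X r) S h (inv r) c (ι r) (ι T) (ι k) (sym (ι-+ k (suc T)))))

  β≤-from-short-superadditivity : ∀ k r (X : ℕ → ℚ) → 1 ℕ.≤ k → k ℕ.≤ r → X 0 ≡ 0ℚ →
    SuperadditiveUpTo k r X → Σ₁ (r ℕ.∸ k) (λ d → inv (k ℕ.+ d)) ≤ 1ℚ → β X r ≤ X r
  β≤-from-short-superadditivity (suc k′) r X 1≤k k≤r X0 sup H≤1 with r ℕ.≤? suc (k ℕ.+ k)
    where k = suc k′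
  -- Of two summands with i + j ≤ 2 k + 1 one is at most k, so here X is superadditive without
  -- restriction.
  ... | yes r≤2k+1 = β≤ r X full r (ℕ.≤-trans 1≤k k≤r) ℕ.≤-refl
    where
    k = suc k′
    full : Superadditive r X
    full i j 1≤i 1≤j i+j≤r with i ℕ.≤? k
    ... | yes i≤k = sup i j 1≤i i≤k 1≤j i+j≤r
    ... | no  i≰k = subst₂ _≤_ (+-comm (X j) (X i)) (cong X (ℕ.+-comm j i))
      (sup j i 1≤j (ℕ.+-cancelˡ-≤ (suc k) j k
          (ℕ.≤-trans (ℕ.+-monoˡ-≤ j (ℕ.≰⇒> i≰k)) (ℕ.≤-trans i+j≤r r≤2k+1)))
        1≤i (subst (ℕ._≤ r) (ℕ.+-comm i j) i+j≤r))
  ... | no r≰2k+1 = subst (λ m → β X m ≤ X m) (sym e)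
      (LongRange.long-range k′ T′ X X0
        (subst (λ m → SuperadditiveUpTo k m X) e sup)
        (subst (λ m → Σ₁ m (λ d → inv (k ℕ.+ d)) ≤ 1ℚ) e₂ H≤1))
    where
    k = suc k′
    T′ = r ℕ.∸ suc (k ℕ.+ k)
    e : r ≡ k ℕ.+ suc (k ℕ.+ T′)
    e = trans (sym (ℕ.m+[n∸m]≡n (ℕ.<⇒≤ (ℕ.≰⇒> r≰2k+1))))
      (trans (cong suc (ℕ.+-assoc k k T′)) (sym (ℕ.+-suc k (k ℕ.+ T′))))
    e₂ : r ℕ.∸ k ≡ suc (k ℕ.+ T′)
    e₂ = trans (cong (ℕ._∸ k) e) (ℕ.m+n∸m≡n k (suc (k ℕ.+ T′)))

  -- Partial sums of the exponential series

  expTerm : ℕ → ℚ → ℚ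
  expTerm zero    x = 1ℚ
  expTerm (suc i) x = expTerm i x * (x * inv (suc i))

  expSum : ℕ → ℚ → ℚ
  expSum zero    x = 1ℚ
  expSum (suc N) x = expSum N x + expTerm (suc N) x

  expTerm-nonneg : ∀ i {x} → 0ℚ ≤ x → 0ℚ ≤ expTerm i x
  expTerm-nonneg zero    _   = 0≤1ℚ
  expTerm-nonneg (suc i) 0≤x = expTerm-nonneg i 0≤x ⊗ (0≤x ⊗ inv-nonneg (suc i))

  expTerm-mono : ∀ i {x y} → 0ℚ ≤ x → x ≤ y → expTerm i x ≤ expTerm i y
  expTerm-mono zero    _   _   = ≤-refl
  expTerm-mono (suc i) {x} {y} 0≤x x≤y = ≤-by _
    (((expTerm-nonneg i 0≤x ⊗ 0≤q-p x≤y) ⊕ (≤-trans 0≤x x≤y ⊗ 0≤q-p (expTerm-mono i 0≤x x≤y))) ⊗ inv-nonneg (suc i))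
    (eq (expTerm i x) (expTerm i y) x y (inv (suc i)))
    where
    eq : ∀ s t x y v → t * (y * v) ≡ s * (x * v) + (s * (y - x) + y * (t - s)) * v
    eq = solve-∀ ℚ-ring

  expSum-mono : ∀ N {x y} → 0ℚ ≤ x → x ≤ y → expSum N x ≤ expSum N y
  expSum-mono zero    _   _   = ≤-refl
  expSum-mono (suc N) 0≤x x≤y = +-mono-≤ (expSum-mono N 0≤x x≤y) (expTerm-mono (suc N) 0≤x x≤y)

  expTerm-suc : ∀ i x → ι (suc i) * expTerm (suc i) x ≡ x * expTerm i x
  expTerm-suc i x = trans (eq (ι (suc i)) (expTerm i x) x (inv (suc i)))
    (trans (cong (λ y → x * expTerm i x * y) (ι*inv i)) (*-identityʳ _))
    where
    eq : ∀ s t x v → s * (t * (x * v)) ≡ x * t * (s * v)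
    eq = solve-∀ ℚ-ring

  -- The mean value theorem for x ^ (i + 1) / (i + 1) !, whose derivative x ^ i / i ! is largest at
  -- the right end.
  expTerm-shift : ∀ i {h d} → 0ℚ ≤ h → 0ℚ ≤ d →
    expTerm (suc i) (h + d) ≤ expTerm (suc i) h + d * expTerm i (h + d)
  expTerm-shift zero {h} {d} _ _ = ≤-reflexive (eq h d)
    where
    eq : ∀ h d → 1ℚ * ((h + d) * 1ℚ) ≡ 1ℚ * (h * 1ℚ) + d * 1ℚ
    eq = solve-∀ ℚ-ring
  expTerm-shift (suc i) {h} {d} 0≤h 0≤d = cancel-ι (suc i) (≤-by
      (h * (t h + d * expTerm i y - t y) + d * (d * expTerm i y))
      ((0≤h ⊗ 0≤q-p (expTerm-shift i 0≤h 0≤d)) ⊕ (0≤d ⊗ (0≤d ⊗ expTerm-nonneg i (0≤h ⊕ 0≤d))))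
      (begin
        (1ℚ + ι (suc i)) * (expTerm (suc (suc i)) h + d * t y)
          ≡⟨ eq₁ (ι (suc i)) (expTerm (suc (suc i)) h) d (t y) ⟩
        (1ℚ + ι (suc i)) * expTerm (suc (suc i)) h + d * t y + d * (ι (suc i) * t y)
          ≡⟨ cong₂ (λ p q → p + d * t y + d * q) (expTerm-suc (suc i) h) (expTerm-suc i y) ⟩
        h * t h + d * t y + d * (y * expTerm i y)
          ≡⟨ eq₂ h d (t h) (t y) (expTerm i y) ⟩
        y * t y + (h * (t h + d * expTerm i y - t y) + d * (d * expTerm i y))
          ≡⟨ cong (λ p → p + (h * (t h + d * expTerm i y - t y) + d * (d * expTerm i y))) (expTerm-suc (suc i) y) ⟨
        (1ℚ + ι (suc i)) * expTerm (suc (suc i)) y + (h * (t h + d * expTerm i y - t y) + d * (d * expTerm i y)) ∎))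
    where
    open ≡-Reasoning
    y = h + d
    t = expTerm (suc i)
    eq₁ : ∀ s a d b → (1ℚ + s) * (a + d * b) ≡ (1ℚ + s) * a + d * b + d * (s * b)
    eq₁ = solve-∀ ℚ-ring
    eq₂ : ∀ h d a b e → h * a + d * b + d * ((h + d) * e) ≡ (h + d) * b + (h * (a + d * e - b) + d * (d * e))
    eq₂ = solve-∀ ℚ-ring

  -- The extra term makes the induction on N go through.
  expSum-shift : ∀ N {h d} → 0ℚ ≤ h → 0ℚ ≤ d →
    expSum N (h + d) + d * expTerm N (h + d) ≤ expSum N h + d * expSum N (h + d)
  expSum-shift zero    _ _ = ≤-refl
  expSum-shift (suc N) {h} {d} 0≤h 0≤d = ≤-by _
      (0≤q-p (expSum-shift N 0≤h 0≤d) ⊕ 0≤q-p (expTerm-shift N 0≤h 0≤d))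
      (eq (expSum N (h + d)) (expSum N h) (expTerm N (h + d))
          (expTerm (suc N) (h + d)) (expTerm (suc N) h) d)
    where
    eq : ∀ s s′ t u u′ d → s′ + u′ + d * (s + u)
       ≡ s + u + d * u + ((s′ + d * s - (s + d * t)) + (u′ + d * t - u))
    eq = solve-∀ ℚ-ring

  -- A truncated form of exp (- d) ≥ 1 - d.
  expSum-step : ∀ N {h d} → 0ℚ ≤ h → 0ℚ ≤ d → expSum N (h + d) ≤ expSum N h + d * expSum N (h + d)
  expSum-step N {h} {d} 0≤h 0≤d = ≤-trans
    (≤-by (d * expTerm N (h + d)) (0≤d ⊗ expTerm-nonneg N (0≤h ⊕ 0≤d)) refl)
    (expSum-shift N 0≤h 0≤d)

  -- Harmonic sums compared with the exponential

  harmonicFrom : ℕ → ℕ → ℚ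
  harmonicFrom k D = Σ₁ D (λ d → inv (k ℕ.+ d))

  harmonicFrom-nonneg : ∀ k D → 0ℚ ≤ harmonicFrom k D
  harmonicFrom-nonneg k zero    = ≤-refl
  harmonicFrom-nonneg k (suc D) = harmonicFrom-nonneg k D ⊕ inv-nonneg (k ℕ.+ suc D)

  -- Raising the argument by d = 1 / (s + 1) multiplies the truncated exponential by at most 1 / (1
  -- - d) = (s + 1) / s, and these factors telescope. This replaces the comparison of the harmonic
  -- sum with a logarithm.
  expSum-harmonic : ∀ N k D → ι (suc k) * expSum N (harmonicFrom (suc k) D) ≤ ι (suc k ℕ.+ D)
  expSum-harmonic N k zero rewrite ℕ.+-identityʳ k =
    ≤-reflexive (trans (cong (λ x → ι (suc k) * x) (expSum-0 N)) (*-identityʳ (ι (suc k))))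
    where
    expSum-0 : ∀ N → expSum N 0ℚ ≡ 1ℚ
    expSum-0 zero    = refl
    expSum-0 (suc N) = trans (cong (λ x → x + expTerm (suc N) 0ℚ) (expSum-0 N)) (eq (expTerm N 0ℚ) (inv (suc N)))
      where
      eq : ∀ t v → 1ℚ + t * (0ℚ * v) ≡ 1ℚ
      eq = solve-∀ ℚ-ring
  expSum-harmonic N k (suc D) rewrite ℕ.+-suc k D =
    cancel-ι n (≤-by _
      ((ι-nonneg (suc (suc n)) ⊗ 0≤q-p (expSum-harmonic N k D))
        ⊕ (ι-nonneg (suc k) ⊗ (ι-nonneg (suc (suc n)) ⊗ 0≤q-p (expSum-step N (harmonicFrom-nonneg (suc k) D) (inv-nonneg (suc (suc n)))))))
      (begin
        s * (1ℚ + s)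
          ≡⟨ eq₁ s κ e e′ v ⟩
        s * (κ * e′) + (p * (s - κ * e) + κ * (p * (e + v * e′ - e′))) + κ * e′ * (1ℚ - p * v)
          ≡⟨ cong (λ x → s * (κ * e′) + (p * (s - κ * e) + κ * (p * (e + v * e′ - e′))) + κ * e′ * (1ℚ - x)) (ι*inv (suc n)) ⟩
        s * (κ * e′) + (p * (s - κ * e) + κ * (p * (e + v * e′ - e′))) + κ * e′ * (1ℚ - 1ℚ)
          ≡⟨ eq₂ (s * (κ * e′)) (p * (s - κ * e) + κ * (p * (e + v * e′ - e′))) (κ * e′) ⟩
        s * (κ * e′) + (p * (s - κ * e) + κ * (p * (e + v * e′ - e′))) ∎))
    where
    open ≡-Reasoning
    n = k ℕ.+ D
    s = ι (suc n)
    p = 1ℚ + s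
    κ = ι (suc k)
    v = inv (suc (suc n))
    e = expSum N (harmonicFrom (suc k) D)
    e′ = expSum N (harmonicFrom (suc k) D + v)
    eq₁ : ∀ s κ e e′ v → s * (1ℚ + s) ≡ s * (κ * e′)
      + ((1ℚ + s) * (s - κ * e) + κ * ((1ℚ + s) * (e + v * e′ - e′))) + κ * e′ * (1ℚ - (1ℚ + s) * v)
    eq₁ = solve-∀ ℚ-ring
    eq₂ : ∀ a b c → a + b + c * (1ℚ - 1ℚ) ≡ a + b
    eq₂ = solve-∀ ℚ-ring

  !*expTerm : ∀ N → ι (N !) * expTerm N 1ℚ ≡ 1ℚ
  !*expTerm zero    = refl
  !*expTerm (suc N) = begin
    ι (suc N ℕ.* N !) * expTerm (suc N) 1ℚ            ≡⟨ cong (λ x → x * expTerm (suc N) 1ℚ) (ι-* (suc N) (N !)) ⟩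
    ι (suc N) * ι (N !) * expTerm (suc N) 1ℚ          ≡⟨ eq (ι (suc N)) (ι (N !)) (expTerm (suc N) 1ℚ) ⟩
    ι (N !) * (ι (suc N) * expTerm (suc N) 1ℚ)        ≡⟨ cong (λ x → ι (N !) * x) (expTerm-suc N 1ℚ) ⟩
    ι (N !) * (1ℚ * expTerm N 1ℚ)                     ≡⟨ cong (λ x → ι (N !) * x) (*-identityˡ _) ⟩
    ι (N !) * expTerm N 1ℚ                            ≡⟨ !*expTerm N ⟩
    1ℚ                                                ∎
    where
    open ≡-Reasoning
    eq : ∀ a b c → a * b * c ≡ b * (a * c)
    eq = solve-∀ ℚ-ring

  !*expSum : ∀ N → ι (N !) * expSum N 1ℚ ≡ ι (eNum N)
  !*expSum zero    = refl
  !*expSum (suc N) = begin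
    ι (suc N ℕ.* N !) * (expSum N 1ℚ + expTerm (suc N) 1ℚ)
      ≡⟨ *-distribˡ-+ (ι (suc N ℕ.* N !)) (expSum N 1ℚ) (expTerm (suc N) 1ℚ) ⟩
    ι (suc N ℕ.* N !) * expSum N 1ℚ + ι (suc N ℕ.* N !) * expTerm (suc N) 1ℚ
      ≡⟨ cong₂ (λ x y → x * expSum N 1ℚ + y) (ι-* (suc N) (N !)) (!*expTerm (suc N)) ⟩
    ι (suc N) * ι (N !) * expSum N 1ℚ + 1ℚ
      ≡⟨ cong (λ x → x + 1ℚ) (trans (*-assoc (ι (suc N)) (ι (N !)) (expSum N 1ℚ)) (cong (λ x → ι (suc N) * x) (!*expSum N))) ⟩
    ι (suc N) * ι (eNum N) + 1ℚ
      ≡⟨ cong (λ x → x + 1ℚ) (ι-* (suc N) (eNum N)) ⟨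
    ι (suc N ℕ.* eNum N) + 1ℚ
      ≡⟨ ι-+ (suc N ℕ.* eNum N) 1 ⟨
    ι (suc N ℕ.* eNum N ℕ.+ 1) ∎
    where open ≡-Reasoning

  -- If the sum h exceeded 1, then k s_N ≤ k exp_N(h) ≤ r for every N, where exp_N is `expSum N` and
  -- s_N its value at 1; the witness N of r < k e says otherwise.
  harmonicFrom≤1 : ∀ k r → 1 ℕ.≤ k → k ℕ.≤ r → r < k ·e → harmonicFrom k (r ℕ.∸ k) ≤ 1ℚ
  harmonicFrom≤1 (suc k′) r _ k≤r (N , r<ke) with harmonicFrom (suc k′) (r ℕ.∸ suc k′) ≤? 1ℚ
  ... | yes h≤1 = h≤1
  ... | no  h≰1 = ⊥-elim (ℕ.<⇒≱ r<ke (ι-≤⁻¹ (begin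
    ι (k ℕ.* eNum N)                  ≡⟨ ι-* k (eNum N) ⟩
    ι k * ι (eNum N)                  ≡⟨ cong (λ x → ι k * x) (!*expSum N) ⟨
    ι k * (ι (N !) * expSum N 1ℚ)     ≡⟨ eq (ι k) (ι (N !)) (expSum N 1ℚ) ⟩
    ι k * expSum N 1ℚ * ι (N !)       ≤⟨ *-monoʳ-≤-nonNeg (ι (N !)) {{nonNegative (ι-nonneg (N !))}} main ⟩
    ι r * ι (N !)                     ≡⟨ ι-* r (N !) ⟨
    ι (r ℕ.* N !)                     ∎)))
    where
    open ≤-Reasoning
    k = suc k′
    h = harmonicFrom k (r ℕ.∸ k)
    eq : ∀ a b c → a * (b * c) ≡ a * c * b
    eq = solve-∀ ℚ-ring
    main : ι k * expSum N 1ℚ ≤ ι r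
    main = begin
      ι k * expSum N 1ℚ     ≤⟨ *-monoˡ-≤-nonNeg (ι k) {{nonNegative (ι-nonneg k)}} (expSum-mono N 0≤1ℚ (<⇒≤ (≰⇒> h≰1))) ⟩
      ι k * expSum N h      ≤⟨ expSum-harmonic N k′ (r ℕ.∸ k) ⟩
      ι (k ℕ.+ (r ℕ.∸ k))   ≡⟨ cong ι (ℕ.m+[n∸m]≡n k≤r) ⟩
      ι r                   ∎

open import Defs
open import Data.Nat hiding (∣_-_∣)
open import Data.Nat.Properties
open import Data.Nat.DivMod using (_/_; _%_; m/n*n≤m; m/n*n≡m; m≡m%n+[m/n]*n; m%n<n)
open import Data.Nat.Divisibility using (m≤n⇒m!∣n!; ∣-trans; m∣m*n)
open import Data.Nat.ListAction using (product) renaming (sum to sumₗ)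
open import Data.Nat.Tactic.RingSolver using (solve-∀)
import Data.Integer as ℤ
open import Data.Integer.Properties using (m-n≡m⊖n; ∣⊖∣-≤; ∣m⊖n∣≡∣n⊖m∣)
import Data.Rational as ℚ
import Data.Rational.Properties as ℚ
open import Data.Bool using (Bool; T; _∧_; _∨_; if_then_else_)
import Data.Bool.Properties as Bool
open import Data.Bool.Properties using (T-∧; T-∨; T-≡)
open import Data.Fin using (Fin; zero; suc; toℕ; fromℕ<; cast; combine; inject≤)
import Data.Fin.Properties as Fin
open import Data.Fin.Properties using (toℕ-cast; toℕ-fromℕ<; toℕ<n; toℕ-injective; combine-injective; inject≤-injective)
open import Data.Fin.Subset using (Subset; inside; outside; _∈_; _∉_; _∪_; _-_; ⁅_⁆; ∣_∣) renaming (⊥ to ∅)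
open import Data.Fin.Subset.Properties using (_∈?_; ⊆-antisym; ∪-identityˡ; x∈p∪q⁻; x∈p∪q⁺; x∈⁅x⁆; x∈⁅y⁆⇒x≡y; x∈p∧x≢y⇒x∈p-y; x∉⁅y⁆⇒x≢y; p─q⊆p; ∉⊥; ∣⊥∣≡0)
open import Data.Vec as Vec using (Vec; []; _∷_; here; there)
open import Data.Vec.Properties using (≡-dec; lookup∘tabulate; []=⇒lookup; lookup⇒[]=; ∷-injective)
open import Data.Vec.Relation.Binary.Pointwise.Extensional using (ext; Pointwise-≡⇒≡)
open import Data.List using (List; []; _∷_; [_]; length; _++_; map; filter; lookup; reverse; _ʳ++_; tabulate; allFin; cartesianProductWith)
open import Data.List.Properties using (++-assoc; ++-identityʳ; length-++; length-map; length-tabulate; filter-accept; filter-reject; reverse-involutive)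
import Data.List.Membership.Propositional as LM
open import Data.List.Membership.Propositional.Properties using (∈-++⁺ˡ; ∈-++⁺ʳ; ∈-++⁻; ∈-filter⁻; ∈-map⁻; ∈-tabulate⁺; ∈-tabulate⁻)
open import Data.List.Relation.Unary.Any using (here; there)
open import Data.List.Relation.Unary.All as All using ([]; _∷_)
import Data.List.Relation.Unary.All.Properties as All
open import Data.List.Relation.Unary.AllPairs using ([]; _∷_)
open import Data.List.Relation.Unary.Unique.Propositional using (Unique)
import Data.List.Relation.Unary.Unique.Propositional.Properties as Unique
open import Data.List.Relation.Binary.Disjoint.Propositional using (Disjoint)
open import Data.List.Relation.Binary.Permutation.Propositional using (_↭_; ↭-sym; ↭-trans; ↭-reflexive; prep)
open import Data.List.Relation.Binary.Permutation.Propositional.Properties using (∈-resp-↭; shift; ++⁺ˡ; ++⁺ʳ; ++-comm; ↭-length; ↭-reverse)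
open import Data.Product using (_×_; _,_; ∃; proj₁; proj₂)
open import Data.Sum using (_⊎_; inj₁; inj₂)
open import Data.Empty using (⊥; ⊥-elim)
open import Function using (_∘_)
open import Function.Bundles using (_⇔_; mk⇔; Equivalence)
open import Relation.Nullary using (yes; no; ¬_; Dec; does)
open import Relation.Nullary.Decidable using (_×-dec_; ¬?)
open import Relation.Binary.PropositionalEquality hiding ([_])
open import Algebra.Properties.Semiring.Sum +-*-semiring using (sum; ∑-comm; ∑-distrib-+; sum-cong-≗; *-distribˡ-sum; *-distribʳ-sum)
open Rationals using (ι; ι-+; ι-*; ι-mono; ι-≤⁻¹; ι-nonneg; inv; ι*inv; Σ₁; Σ₁-*ˡ; β; β≤-from-short-superadditivity; harmonicFrom≤1)

-- Sums over tuples and the inequality of arithmetic and geometric means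

sgn : ℕ → ℕ
sgn zero    = 0
sgn (suc _) = 1

sgn≤1 : ∀ n → sgn n ≤ 1
sgn≤1 zero    = z≤n
sgn≤1 (suc _) = ≤-refl

sgn-pos : ∀ {n} → 0 < n → sgn n ≡ 1
sgn-pos {suc n} _ = refl

pos⊎0 : ∀ n → n ≡ 0 ⊎ 0 < n
pos⊎0 zero    = inj₁ refl
pos⊎0 (suc n) = inj₂ (s≤s z≤n)

sum-mono : ∀ {n} {f g : Fin n → ℕ} → (∀ x → f x ≤ g x) → sum f ≤ sum g
sum-mono {zero}  h = z≤n
sum-mono {suc n} h = +-mono-≤ (h zero) (sum-mono (λ x → h (suc x)))

sum-const : ∀ n c → sum {n} (λ _ → c) ≡ n * c
sum-const zero    c = refl
sum-const (suc n) c = cong (c +_) (sum-const n c)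

f≤sum : ∀ {n} (f : Fin n → ℕ) x → f x ≤ sum f
f≤sum f zero    = m≤m+n (f zero) _
f≤sum f (suc x) = ≤-trans (f≤sum (λ y → f (suc y)) x) (m≤n+m _ (f zero))

sum-pos : ∀ {n} (f : Fin n → ℕ) → 0 < sum f → ∃ λ x → 0 < f x
sum-pos {suc n} f 0<s with pos⊎0 (f zero)
... | inj₂ 0<f₀ = zero , 0<f₀
... | inj₁ f₀≡0 with sum-pos (λ x → f (suc x)) (subst (λ m → 0 < m + sum (λ x → f (suc x))) f₀≡0 0<s)
...   | x , 0<fx = suc x , 0<fx

module _ {n : ℕ} where

  -- Opaque, so that the summand can be recovered from a sum by unification.
  opaque
    Σt : ℕ → (List (Fin n) → ℕ) → ℕ
    Σt zero    f = f []
    Σt (suc m) f = sum λ x → Σt m (λ w → f (x ∷ w))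

    Σt-zero : ∀ f → Σt 0 f ≡ f []
    Σt-zero f = refl

    Σt-suc : ∀ m f → Σt (suc m) f ≡ sum λ x → Σt m (λ w → f (x ∷ w))
    Σt-suc m f = refl

    Σt-mono : ∀ m {f g} → (∀ w → length w ≡ m → f w ≤ g w) → Σt m f ≤ Σt m g
    Σt-mono zero    h = h [] refl
    Σt-mono (suc m) h = sum-mono λ x → Σt-mono m λ w e → h (x ∷ w) (cong suc e)

    Σt-cong : ∀ m {f g} → (∀ w → length w ≡ m → f w ≡ g w) → Σt m f ≡ Σt m g
    Σt-cong m h = ≤-antisym (Σt-mono m λ w e → ≤-reflexive (h w e))
                            (Σt-mono m λ w e → ≤-reflexive (sym (h w e)))

    Σt-+ : ∀ m f g → Σt m (λ w → f w + g w) ≡ Σt m f + Σt m g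
    Σt-+ zero    f g = refl
    Σt-+ (suc m) f g = trans (sum-cong-≗ λ x → Σt-+ m (λ w → f (x ∷ w)) (λ w → g (x ∷ w)))
                             (∑-distrib-+ {n} (λ x → Σt m (λ w → f (x ∷ w))) (λ x → Σt m (λ w → g (x ∷ w))))

    Σt-*ˡ : ∀ m c f → Σt m (λ w → c * f w) ≡ c * Σt m f
    Σt-*ˡ zero    c f = refl
    Σt-*ˡ (suc m) c f = trans (sum-cong-≗ λ x → Σt-*ˡ m c (λ w → f (x ∷ w)))
                              (sym (*-distribˡ-sum c λ x → Σt m (λ w → f (x ∷ w))))

    Σt-const : ∀ m c → Σt m (λ _ → c) ≡ n ^ m * c
    Σt-const zero    c = sym (+-identityʳ c)
    Σt-const (suc m) c = trans (sum-cong-≗ {n} λ _ → Σt-const m c)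
                               (trans (sum-const n _) (sym (*-assoc n (n ^ m) c)))

    Σt-++ : ∀ a b f → Σt (a + b) f ≡ Σt a (λ u → Σt b (λ w → f (u ++ w)))
    Σt-++ zero    b f = refl
    Σt-++ (suc a) b f = sum-cong-≗ λ x → Σt-++ a b (λ w → f (x ∷ w))

    Σt-sum : ∀ {k} m (f : Fin k → List (Fin n) → ℕ) →
      Σt m (λ w → sum (λ x → f x w)) ≡ sum (λ x → Σt m (f x))
    Σt-sum zero    f = refl
    Σt-sum (suc m) f = trans (sum-cong-≗ λ y → Σt-sum m (λ x w → f x (y ∷ w)))
                             (∑-comm λ y x → Σt m (λ w → f x (y ∷ w)))

    Σt-comm : ∀ a b (f : List (Fin n) → List (Fin n) → ℕ) → Σt a (λ u → Σt b (f u)) ≡ Σt b (λ w → Σt a (λ u → f u w))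
    Σt-comm zero    b f = refl
    Σt-comm (suc a) b f = trans (sum-cong-≗ λ x → Σt-comm a b (λ u → f (x ∷ u)))
                                (sym (Σt-sum b (λ x w → Σt a (λ u → f (x ∷ u) w))))

    f≤Σt : ∀ f w → f w ≤ Σt (length w) f
    f≤Σt f []      = ≤-refl
    f≤Σt f (x ∷ w) = ≤-trans (f≤Σt (λ w → f (x ∷ w)) w) (f≤sum (λ x → Σt (length w) (λ w → f (x ∷ w))) x)

    Σt-pos : ∀ m f → 0 < Σt m f → ∃ λ w → length w ≡ m × 0 < f w
    Σt-pos zero    f 0<s = [] , refl , 0<s
    Σt-pos (suc m) f 0<s with sum-pos (λ x → Σt m (λ w → f (x ∷ w))) 0<s
    ... | x , 0<s′ with Σt-pos m (λ w → f (x ∷ w)) 0<s′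
    ...   | w , e , 0<fw = x ∷ w , cong suc e , 0<fw

2xy≤x²+y² : ∀ x y → 2 * (x * y) ≤ x * x + y * y
2xy≤x²+y² x y with ≤-total x y
... | inj₁ x≤y = subst (λ z → 2 * (x * z) ≤ x * x + z * z) (m+[n∸m]≡n x≤y)
                   (subst (2 * (x * (x + (y ∸ x))) ≤_) (eq x (y ∸ x)) (m≤m+n _ ((y ∸ x) * (y ∸ x))))
  where
  eq : ∀ x d → 2 * (x * (x + d)) + d * d ≡ x * x + (x + d) * (x + d)
  eq = solve-∀
... | inj₂ y≤x = subst (λ z → 2 * (z * y) ≤ z * z + y * y) (m+[n∸m]≡n y≤x)
                   (subst (2 * ((y + (x ∸ y)) * y) ≤_) (eq y (x ∸ y)) (m≤m+n _ ((x ∸ y) * (x ∸ y))))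
  where
  eq : ∀ y d → 2 * ((y + d) * y) + d * d ≡ (y + d) * (y + d) + y * y
  eq = solve-∀

-- In the inductive step 2 u v ≤ u² + v² is multiplied by (m + 1) v ^ m and the hypothesis by u; the
-- surplus m u v ^ (m + 1) appears on both sides and cancels.
weighted-am-gm : ∀ m u v → suc m * (u * v ^ m) ≤ u ^ suc m + m * v ^ suc m
weighted-am-gm zero    u v = ≤-reflexive (eq u)
  where
  eq : ∀ u → 1 * (u * 1) ≡ u * 1 + 0
  eq = solve-∀
weighted-am-gm (suc m) u v = +-cancelʳ-≤ (m * (u * (v * p))) _ _ (begin
  suc (suc m) * (u * (v * p)) + m * (u * (v * p))
    ≡⟨ eq₁ m u v p ⟩
  suc m * (2 * (u * v)) * p
    ≤⟨ *-monoˡ-≤ p (*-monoʳ-≤ (suc m) (2xy≤x²+y² u v)) ⟩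
  suc m * (u * u + v * v) * p
    ≡⟨ eq₂ m u v p ⟩
  u * (suc m * (u * p)) + suc m * (v * (v * p))
    ≤⟨ +-monoˡ-≤ _ (*-monoʳ-≤ u (weighted-am-gm m u v)) ⟩
  u * (u ^ suc m + m * (v * p)) + suc m * (v * (v * p))
    ≡⟨ eq₃ m u v p (u ^ suc m) ⟩
  u * u ^ suc m + suc m * (v * (v * p)) + m * (u * (v * p)) ∎)
  where
  open ≤-Reasoning
  p = v ^ m
  eq₁ : ∀ m u v p → suc (suc m) * (u * (v * p)) + m * (u * (v * p)) ≡ suc m * (2 * (u * v)) * p
  eq₁ = solve-∀
  eq₂ : ∀ m u v p → suc m * (u * u + v * v) * p ≡ u * (suc m * (u * p)) + suc m * (v * (v * p))
  eq₂ = solve-∀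
  eq₃ : ∀ m u v p q → u * (q + m * (v * p)) + suc m * (v * (v * p)) ≡ u * q + suc m * (v * (v * p)) + m * (u * (v * p))
  eq₃ = solve-∀

^-distribʳ-* : ∀ o m n → (m * n) ^ o ≡ m ^ o * n ^ o
^-distribʳ-* zero    m n = refl
^-distribʳ-* (suc o) m n = trans (cong (m * n *_) (^-distribʳ-* o m n)) (eq m n (m ^ o) (n ^ o))
  where
  eq : ∀ m n p q → m * n * (p * q) ≡ m * p * (n * q)
  eq = solve-∀

-- AM-GM for a and m copies of S / m. It is `weighted-am-gm` for the means (a + S) / (m + 1) and S /
-- m, both multiplied by m (m + 1); the part of the left side with S in place of a cancels.
am-gm-step : ∀ m a S → suc m ^ suc m * (a * S ^ m) ≤ m ^ m * (a + S) ^ suc m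
am-gm-step zero a S = begin
  1 * (a * 1)          ≤⟨ m≤m+n _ S ⟩
  1 * (a * 1) + S      ≡⟨ eq a S ⟩
  1 * ((a + S) * 1)    ∎
  where
  open ≤-Reasoning
  eq : ∀ a S → 1 * (a * 1) + S ≡ 1 * ((a + S) * 1)
  eq = solve-∀
am-gm-step m@(suc m′) a S = *-cancelˡ-≤ m (+-cancelʳ-≤ (m * (q * (S * S ^ m))) _ _ (begin
  m * (q * (a * S ^ m)) + m * (q * (S * S ^ m))
    ≡⟨ eq₁ m q′ a S (S ^ m) ⟩
  suc m * (m * (a + S) * (q′ * S ^ m))
    ≡⟨ cong (λ z → suc m * (m * (a + S) * z)) (^-distribʳ-* m (suc m) S) ⟨
  suc m * (m * (a + S) * (suc m * S) ^ m)
    ≤⟨ weighted-am-gm m (m * (a + S)) (suc m * S) ⟩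
  (m * (a + S)) ^ suc m + m * (suc m * S) ^ suc m
    ≡⟨ cong₂ (λ y z → y + m * z) (^-distribʳ-* (suc m) m (a + S)) (^-distribʳ-* (suc m) (suc m) S) ⟩
  m ^ suc m * (a + S) ^ suc m + m * (q * S ^ suc m)
    ≡⟨ cong (_+ m * (q * S ^ suc m)) (*-assoc m (m ^ m) ((a + S) ^ suc m)) ⟩
  m * (m ^ m * (a + S) ^ suc m) + m * (q * (S * S ^ m)) ∎))
  where
  open ≤-Reasoning
  q′ = suc m ^ m
  q = suc m ^ suc m
  eq₁ : ∀ m q′ a S s → m * (suc m * q′ * (a * s)) + m * (suc m * q′ * (S * s)) ≡ suc m * (m * (a + S) * (q′ * s))
  eq₁ = solve-∀

am-gm : ∀ xs → length xs ^ length xs * product xs ≤ sumₗ xs ^ length xs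
am-gm []       = ≤-refl
am-gm (a ∷ xs) = *-cancelˡ-≤ (m ^ m) {{m^m≢0 m}} (begin
  m ^ m * (suc m ^ suc m * (a * product xs))    ≡⟨ eq (m ^ m) (suc m ^ suc m) a (product xs) ⟩
  suc m ^ suc m * (a * (m ^ m * product xs))    ≤⟨ *-monoʳ-≤ (suc m ^ suc m) (*-monoʳ-≤ a (am-gm xs)) ⟩
  suc m ^ suc m * (a * sumₗ xs ^ m)             ≤⟨ am-gm-step m a (sumₗ xs) ⟩
  m ^ m * (a + sumₗ xs) ^ suc m                 ∎)
  where
  open ≤-Reasoning
  m = length xs
  m^m≢0 : ∀ m → NonZero (m ^ m)
  m^m≢0 zero    = _
  m^m≢0 (suc m) = m^n≢0 (suc m) (suc m)
  eq : ∀ p q a x → p * (q * (a * x)) ≡ q * (a * (p * x))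
  eq = solve-∀

infixl 7 _!/_
-- An integer substitute for a multiple of 1 / j, exact for 1 ≤ j ≤ N. The default 0 keeps `!/-≤`
-- valid for every j.
_!/_ : ℕ → ℕ → ℕ
N !/ zero  = 0
N !/ suc j = N ! / suc j

!/-exact : ∀ N j → 1 ≤ j → j ≤ N → (N !/ j) * j ≡ N !
!/-exact N (suc j) _ j<N = m/n*n≡m (∣-trans (m∣m*n (j !)) (m≤n⇒m!∣n! j<N))

!/-≤ : ∀ N j → (N !/ j) * j ≤ N !
!/-≤ N zero    = z≤n
!/-≤ N (suc j) = m/n*n≤m (N !) (suc j)

-- Counting ordered edges

ΣN : ℕ → (ℕ → ℕ) → ℕ
ΣN zero    f = 0
ΣN (suc m) f = ΣN m f + f (suc m)

ι-ΣN : ∀ m (f : ℕ → ℕ) (g : ℕ → ℚ.ℚ) → (∀ j → 1 ≤ j → j ≤ m → ι (f j) ≡ g j) → ι (ΣN m f) ≡ Σ₁ m g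
ι-ΣN zero    f g h = refl
ι-ΣN (suc m) f g h = trans (ι-+ (ΣN m f) (f (suc m)))
  (cong₂ ℚ._+_ (ι-ΣN m f g λ j 1≤j j≤m → h j 1≤j (m≤n⇒m≤1+n j≤m)) (h (suc m) (s≤s z≤n) ≤-refl))

module OrderedEdges {n : ℕ} (k r′ : ℕ) (G : List (Fin n) → ℕ)
  (G-↭ : ∀ {u w} → u ↭ w → G u ≡ G w) where

  r : ℕ
  r = suc r′

  extensions : List (Fin n) → ℕ → ℕ
  extensions p m = Σt m (λ w → G (p ++ w))

  -- The second argument counts the vertices still missing after x. Putting x in front of p is
  -- harmless because G is invariant under permutations.
  y : List (Fin n) → ℕ → ℕ
  y p m = sum λ x → sgn (extensions (x ∷ p) m)

  y≤n : ∀ p m → y p m ≤ n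
  y≤n p m = ≤-trans (sum-mono λ x → sgn≤1 (extensions (x ∷ p) m))
                    (≤-reflexive (trans (sum-const n 1) (*-identityʳ n)))

  -- The convention X 0 = 0 makes X t itself the increment over the window from 0 to t.
  X : ℕ → ℕ
  X zero    = 0
  X (suc m) = Σt (r ∸ suc m) (λ p → Σt (suc m) (λ w → G (p ++ w) * y p m))

  X-suc : ∀ s m → s + suc m ≡ r → X (suc m) ≡ Σt s (λ p → Σt (suc m) (λ w → G (p ++ w) * y p m))
  X-suc s m e = cong (λ z → Σt z (λ p → Σt (suc m) (λ w → G (p ++ w) * y p m)))
                     (trans (cong (_∸ suc m) (sym e)) (m+n∸n≡m s (suc m)))

  extensions-pos : ∀ x C J i {m} → length J + i ≡ m →
    0 < extensions (x ∷ C ++ J) i → 0 < extensions (x ∷ C) m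
  extensions-pos x C J i e 0<N with Σt-pos i (λ w → G ((x ∷ C ++ J) ++ w)) 0<N
  ... | w , refl , 0<G = subst (λ m → 0 < extensions (x ∷ C) m) (trans (length-++ J) e)
    (<-≤-trans (subst (0 <_) (cong (λ z → G (x ∷ z)) (++-assoc C J w)) 0<G)
               (f≤Σt (λ w → G (x ∷ C ++ w)) (J ++ w)))

  -- A violation is a possibly degenerate tent with apex x: its edges C I J and the completion of x
  -- C I share C in addition to I, whereas in a genuine tent they would share only I.
  DisjointExtensions : Set
  DisjointExtensions = ∀ C I J x i j → length I ≡ suc i → length J ≡ suc j → suc i ≤ k →
    length C + (suc i + suc j) ≡ r → 0 < G ((C ++ I) ++ J) →
    0 < extensions (x ∷ C ++ J) i → 0 < extensions (x ∷ C ++ I) j → ⊥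

  module _ (disjoint : DisjointExtensions) where

    y-superadditive : ∀ C I J i j → length I ≡ suc i → length J ≡ suc j → suc i ≤ k →
      length C + (suc i + suc j) ≡ r → 0 < G ((C ++ I) ++ J) →
      y (C ++ J) i + y (C ++ I) j ≤ y C (i + suc j)
    y-superadditive C I J i j eI eJ i<k e 0<G =
      ≤-trans (≤-reflexive (sym (∑-distrib-+ {n} _ _))) (sum-mono pointwise)
      where
      pointwise : ∀ x → sgn (extensions (x ∷ C ++ J) i) + sgn (extensions (x ∷ C ++ I) j)
                      ≤ sgn (extensions (x ∷ C) (i + suc j))
      pointwise x with pos⊎0 (extensions (x ∷ C ++ J) i) | pos⊎0 (extensions (x ∷ C ++ I) j)
      ... | inj₁ a | inj₁ b rewrite a | b = z≤n
      ... | inj₁ a | inj₂ b rewrite a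
        | sgn-pos (extensions-pos x C I j {i + suc j} (trans (cong (_+ j) eI) (sym (+-suc i j))) b) = sgn≤1 _
      ... | inj₂ a | inj₁ b rewrite b
        | sgn-pos (extensions-pos x C J i {i + suc j} (trans (cong (_+ i) eJ) (+-comm (suc j) i)) a) =
          ≤-trans (≤-reflexive (+-identityʳ _)) (sgn≤1 _)
      ... | inj₂ a | inj₂ b = ⊥-elim (disjoint C I J x i j eI eJ i<k e 0<G a b)

    -- All three sums are rearranged to run over the same triples C, I, J, with G unchanged by
    -- swapping I and J, so that the inequality holds term by term.
    X-superadditive-canonical : ∀ c i j → suc i ≤ k → c + (suc i + suc j) ≡ r →
      X (suc i) + X (suc j) ≤ X (suc i + suc j)
    X-superadditive-canonical c i j i<k e = begin
      X (suc i) + X (suc j)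
        ≡⟨ cong₂ _+_ Xi Xj ⟩
      Σt c (λ C → Σt (suc i) (λ I → Σt (suc j) (λ J → G ((C ++ J) ++ I) * y (C ++ J) i)))
        + Σt c (λ C → Σt (suc i) (λ I → Σt (suc j) (λ J → G ((C ++ I) ++ J) * y (C ++ I) j)))
        ≡⟨ Σt-+ c _ _ ⟨
      Σt c (λ C → Σt (suc i) (λ I → Σt (suc j) (λ J → G ((C ++ J) ++ I) * y (C ++ J) i))
                + Σt (suc i) (λ I → Σt (suc j) (λ J → G ((C ++ I) ++ J) * y (C ++ I) j)))
        ≤⟨ (Σt-mono c λ C eC → ≤-trans (≤-reflexive (sym (Σt-+ (suc i) _ _)))
             (Σt-mono (suc i) λ I eI → ≤-trans (≤-reflexive (sym (Σt-+ (suc j) _ _)))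
               (Σt-mono (suc j) λ J eJ → term C I J eC eI eJ))) ⟩
      Σt c (λ C → Σt (suc i) (λ I → Σt (suc j) (λ J → G (C ++ (I ++ J)) * y C (i + suc j))))
        ≡⟨ Xij ⟨
      X (suc i + suc j) ∎
      where
      open ≤-Reasoning
      Xi : X (suc i) ≡ Σt c (λ C → Σt (suc i) (λ I → Σt (suc j) (λ J → G ((C ++ J) ++ I) * y (C ++ J) i)))
      Xi = trans (X-suc (c + suc j) i (trans (+-assoc c (suc j) (suc i)) (trans (cong (c +_) (+-comm (suc j) (suc i))) e)))
        (trans (Σt-++ c (suc j) _)
          (Σt-cong c λ C _ → Σt-comm (suc j) (suc i) (λ J I → G ((C ++ J) ++ I) * y (C ++ J) i)))
      Xj : X (suc j) ≡ Σt c (λ C → Σt (suc i) (λ I → Σt (suc j) (λ J → G ((C ++ I) ++ J) * y (C ++ I) j)))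
      Xj = trans (X-suc (c + suc i) j (trans (+-assoc c (suc i) (suc j)) e)) (Σt-++ c (suc i) _)
      Xij : X (suc i + suc j) ≡ Σt c (λ C → Σt (suc i) (λ I → Σt (suc j) (λ J → G (C ++ (I ++ J)) * y C (i + suc j))))
      Xij = trans (X-suc c (i + suc j) e) (Σt-cong c λ C _ → Σt-++ (suc i) (suc j) _)
      term : ∀ C I J → length C ≡ c → length I ≡ suc i → length J ≡ suc j →
        G ((C ++ J) ++ I) * y (C ++ J) i + G ((C ++ I) ++ J) * y (C ++ I) j ≤ G (C ++ (I ++ J)) * y C (i + suc j)
      term C I J eC eI eJ rewrite G-↭ (↭-trans (↭-reflexive (++-assoc C J I))
                                     (↭-trans (++⁺ˡ C (++-comm J I)) (↭-reflexive (sym (++-assoc C I J)))))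
        | sym (++-assoc C I J) with pos⊎0 (G ((C ++ I) ++ J))
      ... | inj₁ G≡0 rewrite G≡0 = z≤n
      ... | inj₂ 0<G = ≤-trans (≤-reflexive (sym (*-distribˡ-+ (G ((C ++ I) ++ J)) _ _)))
        (*-monoʳ-≤ (G ((C ++ I) ++ J)) (y-superadditive C I J i j eI eJ i<k
          (trans (cong (_+ (suc i + suc j)) eC) e) 0<G))

    X-superadditive : ∀ i j → 1 ≤ i → i ≤ k → 1 ≤ j → i + j ≤ r → X i + X j ≤ X (i + j)
    X-superadditive (suc i) (suc j) _ i<k _ i+j≤r =
      X-superadditive-canonical (r ∸ (suc i + suc j)) i j i<k (m∸n+n≡m i+j≤r)

    edges# : ℕ
    edges# = Σt r G

    Xr≤ : X r ≤ n * edges#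
    Xr≤ = begin
      X r                                 ≡⟨ trans (X-suc 0 r′ refl) (Σt-zero _) ⟩
      Σt r (λ w → G w * y [] r′)          ≤⟨ Σt-mono r (λ w _ → ≤-trans (*-monoʳ-≤ (G w) (y≤n [] r′)) (≤-reflexive (*-comm (G w) n))) ⟩
      Σt r (λ w → n * G w)                ≡⟨ Σt-*ˡ r n G ⟩
      n * edges#                          ∎
      where open ≤-Reasoning

    -- Multiplying by r ! makes the coefficients 1 / j integral, and the result descends from the
    -- rationals to the naturals.
    ΣX≤ : 1 ≤ k → k ≤ r → Σ₁ (r ∸ k) (λ d → inv (k + d)) ℚ.≤ ℚ.1ℚ → ΣN r (λ j → (r !/ j) * X j) ≤ r ! * X r
    ΣX≤ 1≤k k≤r H≤1 = ι-≤⁻¹ (begin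
      ι (ΣN r (λ j → (r !/ j) * X j))
        ≡⟨ ι-ΣN r _ _ term ⟩
      Σ₁ r (λ j → ι (r !) ℚ.* (ι (X j) ℚ.* inv j))
        ≡⟨ Σ₁-*ˡ r (ι (r !)) _ ⟩
      ι (r !) ℚ.* β (λ j → ι (X j)) r
        ≤⟨ ℚ.*-monoˡ-≤-nonNeg (ι (r !)) {{ℚ.nonNegative (ι-nonneg (r !))}}
             (β≤-from-short-superadditivity k r (λ j → ι (X j)) 1≤k k≤r refl
               (λ i j 1≤i i≤k 1≤j i+j≤r → subst (ℚ._≤ ι (X (i + j))) (ι-+ (X i) (X j))
                 (ι-mono (X-superadditive i j 1≤i i≤k 1≤j i+j≤r))) H≤1) ⟩
      ι (r !) ℚ.* ι (X r)
        ≡⟨ ι-* (r !) (X r) ⟨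
      ι (r ! * X r) ∎)
      where
      open ℚ.≤-Reasoning
      term : ∀ j → 1 ≤ j → j ≤ r → ι ((r !/ j) * X j) ≡ ι (r !) ℚ.* (ι (X j) ℚ.* inv j)
      term (suc j) 1≤j j≤r = begin-equality
        ι ((r !/ suc j) * X (suc j))
          ≡⟨ ι-* (r !/ suc j) (X (suc j)) ⟩
        ι (r !/ suc j) ℚ.* ι (X (suc j))
          ≡⟨ cong (λ z → z ℚ.* ι (X (suc j))) a≡ ⟩
        ι (r !) ℚ.* inv (suc j) ℚ.* ι (X (suc j))
          ≡⟨ ℚ.*-assoc (ι (r !)) (inv (suc j)) (ι (X (suc j))) ⟩
        ι (r !) ℚ.* (inv (suc j) ℚ.* ι (X (suc j)))
          ≡⟨ cong (λ z → ι (r !) ℚ.* z) (ℚ.*-comm (inv (suc j)) (ι (X (suc j)))) ⟩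
        ι (r !) ℚ.* (ι (X (suc j)) ℚ.* inv (suc j)) ∎
        where
        a≡ : ι (r !/ suc j) ≡ ι (r !) ℚ.* inv (suc j)
        a≡ = begin-equality
          ι (r !/ suc j)
            ≡⟨ ℚ.*-identityʳ _ ⟨
          ι (r !/ suc j) ℚ.* ℚ.1ℚ
            ≡⟨ cong (λ z → ι (r !/ suc j) ℚ.* z) (ι*inv j) ⟨
          ι (r !/ suc j) ℚ.* (ι (suc j) ℚ.* inv (suc j))
            ≡⟨ ℚ.*-assoc (ι (r !/ suc j)) (ι (suc j)) (inv (suc j)) ⟨
          ι (r !/ suc j) ℚ.* ι (suc j) ℚ.* inv (suc j)
            ≡⟨ cong (λ z → z ℚ.* inv (suc j)) (trans (sym (ι-* (r !/ suc j) (suc j))) (cong ι (!/-exact r (suc j) 1≤j j≤r))) ⟩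
          ι (r !) ℚ.* inv (suc j) ∎

  -- The entries are r ! y / j, with j the number of vertices not yet revealed; in the r-partite
  -- extremal case all of them equal r ! n / r.
  values : List (Fin n) → List (Fin n) → List ℕ
  values p []      = []
  values p (x ∷ w) = (r !/ suc (length w)) * y p (length w) ∷ values (x ∷ p) w

  -- Up to rounding and a factor (n !) ^ length w, the probability that p is completed by w when
  -- each vertex is chosen uniformly among those that keep the tuple extendable.
  weight : List (Fin n) → List (Fin n) → ℕ
  weight p []      = 1
  weight p (x ∷ w) = (n !/ y p (length w)) * weight (x ∷ p) w

  length-values : ∀ p w → length (values p w) ≡ length w
  length-values p []      = refl
  length-values p (x ∷ w) = cong suc (length-values (x ∷ p) w)

  G-shift : ∀ p x w → G (p ++ x ∷ w) ≡ G ((x ∷ p) ++ w)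
  G-shift p x w = G-↭ (shift x p w)

  y-pos : ∀ p x w → 0 < G (p ++ x ∷ w) → 0 < y p (length w)
  y-pos p x w 0<G = <-≤-trans (subst (0 <_) (sym (sgn-pos 0<ext)) (s≤s z≤n))
                              (f≤sum (λ z → sgn (extensions (z ∷ p) (length w))) x)
    where
    0<ext : 0 < extensions (x ∷ p) (length w)
    0<ext = <-≤-trans (subst (0 <_) (G-shift p x w) 0<G) (f≤Σt (λ w → G ((x ∷ p) ++ w)) w)

  -- At each step y cancels against n ! / y, and the divisors j multiply to the factorial of the
  -- length. As p and w form an ordered edge, every y is positive, which makes `!/` exact.
  product-values : ∀ p w → length w ≤ r → 0 < G (p ++ w) →
    product (values p w) * weight p w * (length w) ! ≡ (r !) ^ length w * (n !) ^ length w
  product-values p []      _   _   = refl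
  product-values p (x ∷ w) m≤r 0<G = begin
    a * yy * P * (q * W) * (suc m * m !)
      ≡⟨ eq₁ a yy P q W (suc m) (m !) ⟩
    (a * suc m) * (q * yy) * (P * W * m !)
      ≡⟨ cong₂ _*_ (cong₂ _*_ (!/-exact r (suc m) (s≤s z≤n) m≤r) (!/-exact n yy (y-pos p x w 0<G) (y≤n p m)))
           (product-values (x ∷ p) w (<⇒≤ m≤r) (subst (0 <_) (G-shift p x w) 0<G)) ⟩
    r ! * n ! * ((r !) ^ m * (n !) ^ m)
      ≡⟨ eq₂ (r !) (n !) ((r !) ^ m) ((n !) ^ m) ⟩
    (r !) ^ suc m * (n !) ^ suc m ∎
    where
    open ≡-Reasoning
    m = length w
    a = r !/ suc m
    yy = y p m
    q = n !/ yy
    P = product (values (x ∷ p) w)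
    W = weight (x ∷ p) w
    eq₁ : ∀ a y P q W s f → a * y * P * (q * W) * (s * f) ≡ (a * s) * (q * y) * (P * W * f)
    eq₁ = solve-∀
    eq₂ : ∀ a b c d → a * b * (c * d) ≡ a * c * (b * d)
    eq₂ = solve-∀

  -- The head of the values contributes the top term of the right side. Moving the first vertex of w
  -- into the prefix leaves the same sum with s larger and m smaller by one.
  Σ-values : ∀ m s → s + m ≡ r →
    Σt s (λ p → Σt m (λ w → G (p ++ w) * sumₗ (values p w))) ≡ ΣN m (λ j → (r !/ j) * X j)
  Σ-values zero s e = trans (Σt-cong s λ p _ → trans (Σt-zero _) (*-zeroʳ (G (p ++ []))))
                            (trans (Σt-const s 0) (*-zeroʳ (n ^ s)))
  Σ-values (suc m) s e = begin
    Σt s (λ p → Σt (suc m) (λ w → G (p ++ w) * sumₗ (values p w)))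
      ≡⟨ (Σt-cong s λ p _ → trans (Σt-cong (suc m) (split p)) (Σt-+ (suc m) _ _)) ⟩
    Σt s (λ p → Σt (suc m) (λ w → a * (G (p ++ w) * y p m)) + Σt (suc m) (λ w → rest p w))
      ≡⟨ Σt-+ s _ _ ⟩
    Σt s (λ p → Σt (suc m) (λ w → a * (G (p ++ w) * y p m))) + Σt s (λ p → Σt (suc m) (λ w → rest p w))
      ≡⟨ cong₂ _+_
           (trans (Σt-cong s λ p _ → Σt-*ˡ (suc m) a _)
             (trans (Σt-*ˡ s a _) (cong (a *_) (sym (X-suc s m e)))))
           shifted ⟩
    a * X (suc m) + ΣN m (λ j → (r !/ j) * X j)
      ≡⟨ +-comm (a * X (suc m)) _ ⟩
    ΣN m (λ j → (r !/ j) * X j) + a * X (suc m) ∎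
    where
    open ≡-Reasoning
    a = r !/ suc m
    rest : List (Fin n) → List (Fin n) → ℕ
    rest p []      = 0
    rest p (x ∷ w) = G ((x ∷ p) ++ w) * sumₗ (values (x ∷ p) w)
    split : ∀ p w → length w ≡ suc m → G (p ++ w) * sumₗ (values p w) ≡ a * (G (p ++ w) * y p m) + rest p w
    split p (x ∷ w) refl = trans (eq (G (p ++ x ∷ w)) a (y p m) (sumₗ (values (x ∷ p) w)))
      (cong (λ z → a * (G (p ++ x ∷ w) * y p m) + z * sumₗ (values (x ∷ p) w)) (G-shift p x w))
      where
      eq : ∀ g a y t → g * (a * y + t) ≡ a * (g * y) + g * t
      eq = solve-∀
    shifted : Σt s (λ p → Σt (suc m) (λ w → rest p w)) ≡ ΣN m (λ j → (r !/ j) * X j)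
    shifted = begin
      Σt s (λ p → Σt (suc m) (λ w → rest p w))
        ≡⟨ (Σt-cong s λ p _ → Σt-suc m (rest p)) ⟩
      Σt s (λ p → sum λ x → Σt m (λ w → rest p (x ∷ w)))
        ≡⟨ Σt-sum s (λ x p → Σt m (λ w → rest p (x ∷ w))) ⟩
      sum (λ x → Σt s (λ p → Σt m (λ w → rest p (x ∷ w))))
        ≡⟨ Σt-suc s (λ p → Σt m (λ w → G (p ++ w) * sumₗ (values p w))) ⟨
      Σt (suc s) (λ p → Σt m (λ w → G (p ++ w) * sumₗ (values p w)))
        ≡⟨ Σ-values m (suc s) (trans (sym (+-suc s m)) e) ⟩
      ΣN m (λ j → (r !/ j) * X j) ∎

  module _ (G≤1 : ∀ w → G w ≤ 1) where

    -- Only the y p m vertices that extend p contribute, each at most (n !/ y p m) (n !) ^ m, and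
    -- rounding in `!/` goes in the favourable direction.
    Σ-weight : ∀ m p → Σt m (λ w → G (p ++ w) * weight p w) ≤ (n !) ^ m
    Σ-weight zero p = ≤-trans (≤-reflexive (Σt-zero _))
      (≤-trans (≤-reflexive (*-identityʳ (G (p ++ [])))) (G≤1 (p ++ [])))
    Σ-weight (suc m) p = begin
      Σt (suc m) (λ w → G (p ++ w) * weight p w)
        ≡⟨ Σt-suc m _ ⟩
      sum (λ x → Σt m (λ w → G (p ++ x ∷ w) * weight p (x ∷ w)))
        ≤⟨ sum-mono step ⟩
      sum (λ x → q * (n !) ^ m * sgn (extensions (x ∷ p) m))
        ≡⟨ *-distribˡ-sum {n} (q * (n !) ^ m) (λ x → sgn (extensions (x ∷ p) m)) ⟨
      q * (n !) ^ m * y p m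
        ≡⟨ eq q ((n !) ^ m) (y p m) ⟩
      q * y p m * (n !) ^ m
        ≤⟨ *-monoˡ-≤ ((n !) ^ m) (!/-≤ n (y p m)) ⟩
      n ! * (n !) ^ m ∎
      where
      open ≤-Reasoning
      q = n !/ y p m
      eq : ∀ a b c → a * b * c ≡ a * c * b
      eq = solve-∀
      step : ∀ x → Σt m (λ w → G (p ++ x ∷ w) * weight p (x ∷ w)) ≤ q * (n !) ^ m * sgn (extensions (x ∷ p) m)
      step x = begin
        Σt m (λ w → G (p ++ x ∷ w) * weight p (x ∷ w))
          ≡⟨ Σt-cong m (λ { w refl → trans (cong (_* (q * weight (x ∷ p) w)) (G-shift p x w)) (eq₁ (G ((x ∷ p) ++ w)) q (weight (x ∷ p) w)) }) ⟩
        Σt m (λ w → q * (G ((x ∷ p) ++ w) * weight (x ∷ p) w))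
          ≡⟨ Σt-*ˡ m q _ ⟩
        q * S
          ≤⟨ bound (pos⊎0 (extensions (x ∷ p) m)) ⟩
        q * (n !) ^ m * sgn (extensions (x ∷ p) m) ∎
        where
        S = Σt m (λ w → G ((x ∷ p) ++ w) * weight (x ∷ p) w)
        eq₁ : ∀ g q v → g * (q * v) ≡ q * (g * v)
        eq₁ = solve-∀
        bound : extensions (x ∷ p) m ≡ 0 ⊎ 0 < extensions (x ∷ p) m →
          q * S ≤ q * (n !) ^ m * sgn (extensions (x ∷ p) m)
        bound (inj₂ 0<N) rewrite sgn-pos 0<N =
          ≤-trans (*-monoʳ-≤ q (Σ-weight m (x ∷ p))) (≤-reflexive (sym (*-identityʳ _)))
        bound (inj₁ N≡0) = ≤-trans (≤-reflexive (trans (cong (q *_) S≡0) (*-zeroʳ q))) z≤n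
          where
          S≡0 : S ≡ 0
          S≡0 = trans (Σt-cong m {g = λ _ → 0} λ { w refl → cong (_* weight (x ∷ p) w)
                  (n≤0⇒n≡0 (subst (G ((x ∷ p) ++ w) ≤_) N≡0 (f≤Σt (λ w → G ((x ∷ p) ++ w)) w))) })
                (trans (Σt-const m 0) (*-zeroʳ (n ^ m)))

    -- With t the sum of the values, AM-GM bounds their product by (t / r) ^ r, so the weight is at
    -- least a multiple of t ^ (- r). The tangent line of this convex function at t = n r ! is
    -- proportional to (r + 1) n r ! - r t; being linear in t, the inequality can be summed over
    -- edges.
    tuple-inequality : ∀ v → length v ≡ r → 0 < G v →
      suc r * (n * r !) * (r ^ r * (n !) ^ r) ≤ r * (r ^ r * (n !) ^ r) * sumₗ (values [] v) + n ^ suc r * (r ! * r !) * weight [] v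
    tuple-inequality v ev 0<G = begin
      suc r * (n * F) * R
        ≤⟨ *-monoˡ-≤ R (m≤n+m∸n (suc r * (n * F)) (r * t)) ⟩
      (r * t + a₀) * R
        ≡⟨ eq₁ r t a₀ R ⟩
      r * R * t + a₀ * R
        ≤⟨ +-monoʳ-≤ (r * R * t) main ⟩
      r * R * t + n ^ suc r * (F * F) * W ∎
      where
      open ≤-Reasoning
      F = r !
      K = n !
      R = r ^ r * K ^ r
      t = sumₗ (values [] v)
      W = weight [] v
      PA = product (values [] v)
      -- AM-GM for r + 1 numbers yields the tangent line at once: `a₀` completes the r scaled values
      -- to a list of mean n r !. When the subtraction truncates to 0, the bound on `a₀` is trivial.
      a₀ = suc r * (n * F) ∸ r * t
      scaled = map (r *_) (values [] v)
      eq₁ : ∀ r t a R → (r * t + a) * R ≡ r * R * t + a * R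
      eq₁ = solve-∀
      sum-scaled : ∀ xs → sumₗ (map (r *_) xs) ≡ r * sumₗ xs
      sum-scaled []       = sym (*-zeroʳ r)
      sum-scaled (x ∷ xs) = trans (cong (r * x +_) (sum-scaled xs)) (sym (*-distribˡ-+ r x (sumₗ xs)))
      product-scaled : ∀ xs → product (map (r *_) xs) ≡ r ^ length xs * product xs
      product-scaled []       = refl
      product-scaled (x ∷ xs) = trans (cong (r * x *_) (product-scaled xs)) (eq r x (r ^ length xs) (product xs))
        where
        eq : ∀ r x a b → r * x * (a * b) ≡ r * a * (x * b)
        eq = solve-∀
      length-scaled : length scaled ≡ r
      length-scaled = trans (length-map (r *_) (values [] v)) (trans (length-values [] v) ev)
      mean : suc r ^ suc r * (a₀ * (r ^ r * PA)) ≤ suc r ^ suc r * (n * F) ^ suc r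
      mean with ≤-total (r * t) (suc r * (n * F))
      ... | inj₂ le rewrite m≤n⇒m∸n≡0 le | *-zeroʳ (suc r ^ suc r) = z≤n
      ... | inj₁ le = begin
        suc r ^ suc r * (a₀ * (r ^ r * PA))
          ≡⟨ cong₂ (λ m z → suc m ^ suc m * (a₀ * z)) (sym length-scaled)
               (trans (cong (λ m → r ^ m * PA) (sym (trans (length-values [] v) ev))) (sym (product-scaled (values [] v)))) ⟩
        length (a₀ ∷ scaled) ^ length (a₀ ∷ scaled) * product (a₀ ∷ scaled)
          ≤⟨ am-gm (a₀ ∷ scaled) ⟩
        sumₗ (a₀ ∷ scaled) ^ length (a₀ ∷ scaled)
          ≡⟨ cong₂ (λ z m → z ^ suc m) (trans (cong (a₀ +_) (sum-scaled (values [] v))) (m∸n+n≡m le)) length-scaled ⟩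
        (suc r * (n * F)) ^ suc r
          ≡⟨ ^-distribʳ-* (suc r) (suc r) (n * F) ⟩
        suc r ^ suc r * (n * F) ^ suc r ∎
      reduced : a₀ * (r ^ r * PA) ≤ n ^ suc r * F ^ suc r
      reduced = ≤-trans (*-cancelˡ-≤ (suc r ^ suc r) {{m^n≢0 (suc r) (suc r)}} mean)
                        (≤-reflexive (^-distribʳ-* (suc r) n F))
      main : a₀ * R ≤ n ^ suc r * (F * F) * W
      main = *-cancelˡ-≤ (F ^ r) {{m^n≢0 F r {{r !≢0}}}} (begin
        F ^ r * (a₀ * (r ^ r * K ^ r))
          ≡⟨ eq₂ (F ^ r) a₀ (r ^ r) (K ^ r) ⟩
        a₀ * r ^ r * (F ^ r * K ^ r)
          ≡⟨ cong (a₀ * r ^ r *_) (subst (λ m → PA * W * m ! ≡ F ^ m * K ^ m) ev (product-values [] v (≤-reflexive ev) 0<G)) ⟨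
        a₀ * r ^ r * (PA * W * F)
          ≡⟨ eq₃ a₀ (r ^ r) PA W F ⟩
        a₀ * (r ^ r * PA) * (W * F)
          ≤⟨ *-monoˡ-≤ (W * F) reduced ⟩
        n ^ suc r * (F * F ^ r) * (W * F)
          ≡⟨ eq₄ (n ^ suc r) F (F ^ r) W ⟩
        F ^ r * (n ^ suc r * (F * F) * W) ∎)
        where
        eq₂ : ∀ f a q k → f * (a * (q * k)) ≡ a * q * (f * k)
        eq₂ = solve-∀
        eq₃ : ∀ a q p w f → a * q * (p * w * f) ≡ a * (q * p) * (w * f)
        eq₃ = solve-∀
        eq₄ : ∀ m f g w → m * (f * g) * (w * f) ≡ g * (m * (f * f) * w)
        eq₄ = solve-∀

    edges#-bound : DisjointExtensions → 1 ≤ k → k ≤ r → Σ₁ (r ∸ k) (λ d → inv (k + d)) ℚ.≤ ℚ.1ℚ →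
      1 ≤ n → Σt r G * r ^ r ≤ r ! * n ^ r
    edges#-bound disjoint 1≤k k≤r H≤1 1≤n =
      *-cancelˡ-≤ (n * F * K ^ r) {{m*n≢0 (n * F) (K ^ r) {{m*n≢0 n F {{>-nonZero 1≤n}} {{r !≢0}}}} {{m^n≢0 K r {{n !≢0}}}}}}
        -- After summation over v, the bound F n g on the total of the values cancels r of the r + 1
        -- copies of n F R g.
        (+-cancelˡ-≤ (r * (n * F) * R * g) _ _ (begin
        r * (n * F) * R * g + n * F * K ^ r * (g * r ^ r)
          ≡⟨ eq₁ r n F (r ^ r) (K ^ r) g ⟩
        suc r * (n * F) * R * g
          ≡⟨ Σt-*ˡ r (suc r * (n * F) * R) G ⟨
        Σt r (λ v → suc r * (n * F) * R * G v)
          ≤⟨ Σt-mono r per-tuple ⟩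
        Σt r (λ v → r * R * (G v * sumₗ (values [] v)) + n ^ suc r * (F * F) * (G v * weight [] v))
          ≡⟨ Σt-+ r _ _ ⟩
        Σt r (λ v → r * R * (G v * sumₗ (values [] v))) + Σt r (λ v → n ^ suc r * (F * F) * (G v * weight [] v))
          ≡⟨ cong₂ _+_ (Σt-*ˡ r (r * R) _) (Σt-*ˡ r (n ^ suc r * (F * F)) _) ⟩
        r * R * Σt r (λ v → G v * sumₗ (values [] v)) + n ^ suc r * (F * F) * Σt r (λ v → G v * weight [] v)
          ≤⟨ +-mono-≤ (*-monoʳ-≤ (r * R) values-bound) (*-monoʳ-≤ (n ^ suc r * (F * F)) (Σ-weight r [])) ⟩
        r * R * (F * (n * g)) + n ^ suc r * (F * F) * K ^ r
          ≡⟨ eq₂ r n F (r ^ r) (K ^ r) g (n ^ r) ⟩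
        r * (n * F) * R * g + n * F * K ^ r * (F * n ^ r) ∎))
      where
      open ≤-Reasoning
      F = r !
      K = n !
      R = r ^ r * K ^ r
      g = Σt r G
      eq₁ : ∀ r n F q k g → r * (n * F) * (q * k) * g + n * F * k * (g * q) ≡ suc r * (n * F) * (q * k) * g
      eq₁ = solve-∀
      eq₂ : ∀ r n F q k g m → r * (q * k) * (F * (n * g)) + n * m * (F * F) * k ≡ r * (n * F) * (q * k) * g + n * F * k * (F * m)
      eq₂ = solve-∀
      values-bound : Σt r (λ v → G v * sumₗ (values [] v)) ≤ F * (n * g)
      values-bound = begin
        Σt r (λ v → G v * sumₗ (values [] v))
          ≡⟨ Σt-zero _ ⟨
        Σt 0 (λ p → Σt r (λ w → G (p ++ w) * sumₗ (values p w)))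
          ≡⟨ Σ-values r 0 refl ⟩
        ΣN r (λ j → (r !/ j) * X j)
          ≤⟨ ΣX≤ disjoint 1≤k k≤r H≤1 ⟩
        F * X r
          ≤⟨ *-monoʳ-≤ F (Xr≤ disjoint) ⟩
        F * (n * g) ∎
      per-tuple : ∀ v → length v ≡ r → suc r * (n * F) * R * G v ≤
        r * R * (G v * sumₗ (values [] v)) + n ^ suc r * (F * F) * (G v * weight [] v)
      per-tuple v ev with pos⊎0 (G v)
      ... | inj₁ G≡0 rewrite G≡0 | *-zeroʳ (suc r * (n * F) * R) = z≤n
      ... | inj₂ 0<G rewrite ≤-antisym (G≤1 v) 0<G = begin
        suc r * (n * F) * R * 1     ≡⟨ *-identityʳ _ ⟩
        suc r * (n * F) * R         ≤⟨ tuple-inequality v ev 0<G ⟩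
        r * R * sumₗ (values [] v) + n ^ suc r * (F * F) * weight [] v
          ≡⟨ cong₂ (λ a b → r * R * a + n ^ suc r * (F * F) * b) (sym (*-identityˡ _)) (sym (*-identityˡ _)) ⟩
        r * R * (1 * sumₗ (values [] v)) + n ^ suc r * (F * F) * (1 * weight [] v) ∎

-- Sets of vertices and their orderings

_≟ₛ_ : ∀ {n} (p q : Subset n) → Dec (p ≡ q)
_≟ₛ_ = ≡-dec Bool._≟_

toSet : ∀ {n} → List (Fin n) → Subset n
toSet []      = ∅
toSet (x ∷ l) = ⁅ x ⁆ ∪ toSet l

∈-toSet⁺ : ∀ {n} {y : Fin n} l → y LM.∈ l → y ∈ toSet l
∈-toSet⁺ (x ∷ l) (here refl) = x∈p∪q⁺ (inj₁ (x∈⁅x⁆ x))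
∈-toSet⁺ (x ∷ l) (there y∈l) = x∈p∪q⁺ (inj₂ (∈-toSet⁺ l y∈l))

∈-toSet⁻ : ∀ {n} {y : Fin n} l → y ∈ toSet l → y LM.∈ l
∈-toSet⁻ []      y∈ = ⊥-elim (∉⊥ y∈)
∈-toSet⁻ (x ∷ l) y∈ with x∈p∪q⁻ ⁅ x ⁆ (toSet l) y∈
... | inj₁ y∈x = here (x∈⁅y⁆⇒x≡y x y∈x)
... | inj₂ y∈l = there (∈-toSet⁻ l y∈l)

toSet-↭ : ∀ {n} {l l′ : List (Fin n)} → l ↭ l′ → toSet l ≡ toSet l′
toSet-↭ {l = l} {l′} p = ⊆-antisym
  (λ y∈ → ∈-toSet⁺ l′ (∈-resp-↭ p (∈-toSet⁻ l y∈)))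
  (λ y∈ → ∈-toSet⁺ l (∈-resp-↭ (↭-sym p) (∈-toSet⁻ l′ y∈)))

∣⁅x⁆∪p∣ : ∀ {n} (x : Fin n) p → x ∉ p → ∣ ⁅ x ⁆ ∪ p ∣ ≡ suc ∣ p ∣
∣⁅x⁆∪p∣ zero    (inside  ∷ p) x∉p = ⊥-elim (x∉p here)
∣⁅x⁆∪p∣ zero    (outside ∷ p) x∉p = cong (λ q → suc ∣ q ∣) (∪-identityˡ p)
∣⁅x⁆∪p∣ (suc x) (inside  ∷ p) x∉p = cong suc (∣⁅x⁆∪p∣ x p λ x∈p → x∉p (there x∈p))
∣⁅x⁆∪p∣ (suc x) (outside ∷ p) x∉p = ∣⁅x⁆∪p∣ x p λ x∈p → x∉p (there x∈p)

⁅x⁆∪p≡p : ∀ {n} (x : Fin n) p → x ∈ p → ⁅ x ⁆ ∪ p ≡ p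
⁅x⁆∪p≡p x p x∈p = ⊆-antisym to (λ y∈ → x∈p∪q⁺ (inj₂ y∈))
  where
  to : ∀ {y} → y ∈ ⁅ x ⁆ ∪ p → y ∈ p
  to y∈ with x∈p∪q⁻ ⁅ x ⁆ p y∈
  ... | inj₂ y∈p = y∈p
  ... | inj₁ y∈x rewrite x∈⁅y⁆⇒x≡y x y∈x = x∈p

∣toSet∣≤length : ∀ {n} (l : List (Fin n)) → ∣ toSet l ∣ ≤ length l
∣toSet∣≤length {n} [] = ≤-reflexive (∣⊥∣≡0 n)
∣toSet∣≤length (x ∷ l) with x ∈? toSet l
... | yes x∈l rewrite ⁅x⁆∪p≡p x (toSet l) x∈l = m≤n⇒m≤1+n (∣toSet∣≤length l)
... | no  x∉l rewrite ∣⁅x⁆∪p∣ x (toSet l) x∉l = s≤s (∣toSet∣≤length l)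

unique⇒∣toSet∣≡length : ∀ {n} {l : List (Fin n)} → Unique l → ∣ toSet l ∣ ≡ length l
unique⇒∣toSet∣≡length {n} [] = ∣⊥∣≡0 n
unique⇒∣toSet∣≡length {l = x ∷ l} (x≢l ∷ u) =
  trans (∣⁅x⁆∪p∣ x (toSet l) λ x∈ → All.lookup x≢l (∈-toSet⁻ l x∈) refl)
        (cong suc (unique⇒∣toSet∣≡length u))

∣toSet∣≡length⇒unique : ∀ {n} (l : List (Fin n)) → ∣ toSet l ∣ ≡ length l → Unique l
∣toSet∣≡length⇒unique []      _ = []
∣toSet∣≡length⇒unique (x ∷ l) e with x ∈? toSet l
... | yes x∈l rewrite ⁅x⁆∪p≡p x (toSet l) x∈l = ⊥-elim (<-irrefl refl (subst (_≤ length l) e (∣toSet∣≤length l)))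
... | no  x∉l = All.tabulate (λ { y∈l refl → x∉l (∈-toSet⁺ l y∈l) })
  ∷ ∣toSet∣≡length⇒unique l (suc-injective (trans (sym (∣⁅x⁆∪p∣ x (toSet l) x∉l)) e))

unique-++⁻ : ∀ {a} {A : Set a} (l : List A) {l′} → Unique (l ++ l′) → Unique l × Unique l′ × Disjoint l l′
unique-++⁻ []      u = [] , u , λ { (() , _) }
unique-++⁻ (x ∷ l) (x≢ ∷ u) with unique-++⁻ l u
... | ul , ul′ , dis = All.++⁻ˡ l x≢ ∷ ul , ul′ , λ
  { (here refl , y∈l′) → All.lookup (All.++⁻ʳ l x≢) y∈l′ refl
  ; (there y∈l , y∈l′) → dis (y∈l , y∈l′) }

𝟙 : ∀ {a} {A : Set a} → Dec A → ℕ
𝟙 d = if does d then 1 else 0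

𝟙≤1 : ∀ {a} {A : Set a} (d : Dec A) → 𝟙 d ≤ 1
𝟙≤1 (yes _) = ≤-refl
𝟙≤1 (no _)  = z≤n

𝟙-mono : ∀ {a b} {A : Set a} {B : Set b} (d : Dec A) (d′ : Dec B) → (A → B) → 𝟙 d ≤ 𝟙 d′
𝟙-mono (yes a) (yes _) h = ≤-refl
𝟙-mono (yes a) (no ¬b) h = ⊥-elim (¬b (h a))
𝟙-mono (no _)  _       h = z≤n

𝟙-yes : ∀ {a} {A : Set a} (d : Dec A) → A → 𝟙 d ≡ 1
𝟙-yes (yes _) _ = refl
𝟙-yes (no ¬a) a = ⊥-elim (¬a a)

𝟙-pos : ∀ {a} {A : Set a} (d : Dec A) → 0 < 𝟙 d → A
𝟙-pos (yes a) _ = a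

sum-𝟙∈ : ∀ {n} (p : Subset n) → sum (λ x → 𝟙 (x ∈? p)) ≡ ∣ p ∣
sum-𝟙∈ []            = refl
sum-𝟙∈ (inside  ∷ p) = cong suc (trans (sum-cong-≗ there-𝟙) (sum-𝟙∈ p))
  where
  there-𝟙 : ∀ x → 𝟙 (suc x ∈? (inside ∷ p)) ≡ 𝟙 (x ∈? p)
  there-𝟙 x = ≤-antisym (𝟙-mono (suc x ∈? (inside ∷ p)) (x ∈? p) λ { (there h) → h })
                        (𝟙-mono (x ∈? p) (suc x ∈? (inside ∷ p)) there)
sum-𝟙∈ (outside ∷ p) = trans (sum-cong-≗ there-𝟙) (sum-𝟙∈ p)
  where
  there-𝟙 : ∀ x → 𝟙 (suc x ∈? (outside ∷ p)) ≡ 𝟙 (x ∈? p)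
  there-𝟙 x = ≤-antisym (𝟙-mono (suc x ∈? (outside ∷ p)) (x ∈? p) λ { (there h) → h })
                        (𝟙-mono (x ∈? p) (suc x ∈? (outside ∷ p)) there)

x∉p-x : ∀ {n} (x : Fin n) p → x ∉ p - x
x∉p-x zero    (inside  ∷ p) ()
x∉p-x zero    (outside ∷ p) ()
x∉p-x (suc x) (s ∷ p) (there h) = x∉p-x x p h

⁅x⁆∪[p-x]≡p : ∀ {n} (x : Fin n) p → x ∈ p → ⁅ x ⁆ ∪ (p - x) ≡ p
⁅x⁆∪[p-x]≡p x p x∈p = ⊆-antisym to from
  where
  to : ∀ {y} → y ∈ ⁅ x ⁆ ∪ (p - x) → y ∈ p
  to y∈ with x∈p∪q⁻ ⁅ x ⁆ (p - x) y∈
  ... | inj₁ y∈x rewrite x∈⁅y⁆⇒x≡y x y∈x = x∈p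
  ... | inj₂ y∈p = p─q⊆p p ⁅ x ⁆ y∈p
  from : ∀ {y} → y ∈ p → y ∈ ⁅ x ⁆ ∪ (p - x)
  from {y} y∈p with y ∈? ⁅ x ⁆
  ... | yes y∈x = x∈p∪q⁺ (inj₁ y∈x)
  ... | no  y∉x = x∈p∪q⁺ (inj₂ (x∈p∧x≢y⇒x∈p-y y∈p (x∉⁅y⁆⇒x≢y y∉x)))

orderings : ∀ {n} m (e : Subset n) → ∣ e ∣ ≡ m → m ! ≤ Σt m (λ v → 𝟙 (toSet v ≟ₛ e))
orderings {n} zero e ∣e∣≡0 = ≤-reflexive (sym (trans (Σt-zero _) (𝟙-yes (∅ ≟ₛ e) (sym (∣p∣≡0⇒p≡∅ e ∣e∣≡0)))))
  where
  ∣p∣≡0⇒p≡∅ : ∀ {n} (p : Subset n) → ∣ p ∣ ≡ 0 → p ≡ ∅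
  ∣p∣≡0⇒p≡∅ []            _ = refl
  ∣p∣≡0⇒p≡∅ (outside ∷ p) e = cong (outside ∷_) (∣p∣≡0⇒p≡∅ p e)
orderings {n} (suc m) e ∣e∣≡ = begin
  suc m * m !
    ≡⟨ cong (_* m !) (trans (sum-𝟙∈ e) ∣e∣≡) ⟨
  sum (λ x → 𝟙 (x ∈? e)) * m !
    ≡⟨ *-distribʳ-sum {n} (m !) (λ x → 𝟙 (x ∈? e)) ⟩
  sum (λ x → 𝟙 (x ∈? e) * m !)
    ≤⟨ sum-mono step ⟩
  sum (λ x → Σt m (λ w → 𝟙 (toSet (x ∷ w) ≟ₛ e)))
    ≡⟨ Σt-suc m _ ⟨
  Σt (suc m) (λ v → 𝟙 (toSet v ≟ₛ e)) ∎
  where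
  open ≤-Reasoning
  step : ∀ x → 𝟙 (x ∈? e) * m ! ≤ Σt m (λ w → 𝟙 (toSet (x ∷ w) ≟ₛ e))
  step x with x ∈? e
  ... | no  _   = z≤n
  ... | yes x∈e = ≤-trans (≤-reflexive (+-identityʳ (m !)))
    (≤-trans (orderings m (e - x) (suc-injective (begin-equality
        suc ∣ e - x ∣              ≡⟨ ∣⁅x⁆∪p∣ x (e - x) (x∉p-x x e) ⟨
        ∣ ⁅ x ⁆ ∪ (e - x) ∣        ≡⟨ cong ∣_∣ (⁅x⁆∪[p-x]≡p x e x∈e) ⟩
        ∣ e ∣                      ≡⟨ ∣e∣≡ ⟩
        suc m                      ∎)))
      (Σt-mono m λ w _ → 𝟙-mono (toSet w ≟ₛ (e - x)) (toSet (x ∷ w) ≟ₛ e)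
        λ eq → trans (cong (⁅ x ⁆ ∪_) eq) (⁅x⁆∪[p-x]≡p x e x∈e)))

Σt-list : ∀ {n} m (L : List (Subset n)) (g : List (Fin n) → ℕ) →
  sumₗ (map (λ e → Σt m (λ v → 𝟙 (toSet v ≟ₛ e) * g v)) L)
    ≡ Σt m (λ v → sumₗ (map (λ e → 𝟙 (toSet v ≟ₛ e)) L) * g v)
Σt-list {n} m []      g = sym (trans (Σt-const m 0) (*-zeroʳ (n ^ m)))
Σt-list m (e ∷ L) g = trans
  (cong (Σt m (λ v → 𝟙 (toSet v ≟ₛ e) * g v) +_) (Σt-list m L g))
  (trans (sym (Σt-+ m _ _)) (Σt-cong m λ v _ → sym (*-distribʳ-+ (g v) (𝟙 (toSet v ≟ₛ e)) _)))

-- The decision is an arbitrary argument, so that the recursion can pass on one derived for the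
-- tail; after a match this is the refutation supplied by uniqueness.
sum-𝟙≟ : ∀ {n} (s : Subset n) {L} (d : Dec (s LM.∈ L)) → Unique L → sumₗ (map (λ e → 𝟙 (s ≟ₛ e)) L) ≤ 𝟙 d
sum-𝟙≟ s {[]}    d _ = z≤n
sum-𝟙≟ s {e ∷ L} d (e≢ ∷ u) with s ≟ₛ e
... | no  s≢e = ≤-trans (sum-𝟙≟ s (drop d) u) (𝟙-mono (drop d) d there)
  where
  drop : Dec (s LM.∈ e ∷ L) → Dec (s LM.∈ L)
  drop (yes (here s≡e))  = ⊥-elim (s≢e s≡e)
  drop (yes (there s∈L)) = yes s∈L
  drop (no  s∉)          = no λ s∈L → s∉ (there s∈L)
... | yes refl = ≤-trans (s≤s (sum-𝟙≟ s (no (λ s∈L → All.lookup e≢ s∈L refl)) u))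
  (≤-reflexive (sym (𝟙-yes d (here refl))))

-- Recognizing a tent

∈-tabulate : ∀ {n} (f : Fin n → Bool) x → x ∈ Vec.tabulate f ⇔ T (f x)
∈-tabulate f x = mk⇔
  (λ x∈ → Equivalence.from T-≡ (trans (sym (lookup∘tabulate f x)) ([]=⇒lookup x∈)))
  (λ t → lookup⇒[]= x (Vec.tabulate f) (trans (lookup∘tabulate f x) (Equivalence.to T-≡ t)))

module _ {r i : ℕ} (x : Fin (2 * r ∸ 1)) where

  private t = toℕ x

  ∈-tentEdge₁ : x ∈ tentEdge₁ r i ⇔ t < r
  ∈-tentEdge₁ = mk⇔
    (λ x∈ → ≤ᵇ⇒≤ (suc t) r (proj₂ (Equivalence.to (T-∧ {1 ≤ᵇ suc t}) (Equivalence.to (∈-tabulate _ x) x∈))))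
    (λ t<r → Equivalence.from (∈-tabulate _ x) (Equivalence.from (T-∧ {1 ≤ᵇ suc t}) (_ , ≤⇒≤ᵇ t<r)))

  ∈-tentEdge₂ : x ∈ tentEdge₂ r i ⇔ (t < i ⊎ (r ≤ t × t < 2 * r ∸ i ∸ 1) ⊎ suc t ≡ 2 * r ∸ 1)
  ∈-tentEdge₂ = mk⇔ (to ∘ Equivalence.to (∈-tabulate _ x)) (Equivalence.from (∈-tabulate _ x) ∘ from)
    where
    b₁ b₂ b₃ : Bool
    b₁ = (1 ≤ᵇ suc t) ∧ (suc t ≤ᵇ i)
    b₂ = (r + 1 ≤ᵇ suc t) ∧ (suc t ≤ᵇ 2 * r ∸ i ∸ 1)
    b₃ = suc t ≡ᵇ 2 * r ∸ 1
    to : T (b₁ ∨ b₂ ∨ b₃) → (t < i ⊎ (r ≤ t × t < 2 * r ∸ i ∸ 1) ⊎ suc t ≡ 2 * r ∸ 1)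
    to h with Equivalence.to (T-∨ {b₁} {b₂ ∨ b₃}) h
    ... | inj₁ h₁ = inj₁ (≤ᵇ⇒≤ (suc t) i (proj₂ (Equivalence.to (T-∧ {1 ≤ᵇ suc t}) h₁)))
    ... | inj₂ h₂ with Equivalence.to (T-∨ {b₂} {b₃}) h₂
    ...   | inj₂ h₃ = inj₂ (inj₂ (≡ᵇ⇒≡ (suc t) (2 * r ∸ 1) h₃))
    ...   | inj₁ h₃ with Equivalence.to (T-∧ {r + 1 ≤ᵇ suc t}) h₃
    ...     | a , b = inj₂ (inj₁ (s≤s⁻¹ (subst (_≤ suc t) (+-comm r 1) (≤ᵇ⇒≤ (r + 1) (suc t) a)) , ≤ᵇ⇒≤ (suc t) _ b))
    from : (t < i ⊎ (r ≤ t × t < 2 * r ∸ i ∸ 1) ⊎ suc t ≡ 2 * r ∸ 1) → T (b₁ ∨ b₂ ∨ b₃)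
    from (inj₁ t<i) = Equivalence.from (T-∨ {b₁} {b₂ ∨ b₃})
      (inj₁ (Equivalence.from (T-∧ {1 ≤ᵇ suc t}) (_ , ≤⇒≤ᵇ t<i)))
    from (inj₂ (inj₁ (a , b))) = Equivalence.from (T-∨ {b₁} {b₂ ∨ b₃}) (inj₂ (Equivalence.from (T-∨ {b₂} {b₃})
      (inj₁ (Equivalence.from (T-∧ {r + 1 ≤ᵇ suc t}) (≤⇒≤ᵇ (subst (_≤ suc t) (+-comm 1 r) (s≤s a)) , ≤⇒≤ᵇ b)))))
    from (inj₂ (inj₂ e)) = Equivalence.from (T-∨ {b₁} {b₂ ∨ b₃})
      (inj₂ (Equivalence.from (T-∨ {b₂} {b₃}) (inj₂ (≡⇒≡ᵇ (suc t) _ e))))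

  ∈-tentEdge₃ : x ∈ tentEdge₃ r i ⇔ ((i ≤ t × t < r) ⊎ 2 * r ∸ i ≤ suc t)
  ∈-tentEdge₃ = mk⇔ (to ∘ Equivalence.to (∈-tabulate _ x)) (Equivalence.from (∈-tabulate _ x) ∘ from)
    where
    b₁ b₂ : Bool
    b₁ = (i + 1 ≤ᵇ suc t) ∧ (suc t ≤ᵇ r)
    b₂ = (2 * r ∸ i ≤ᵇ suc t) ∧ (suc t ≤ᵇ 2 * r ∸ 1)
    to : T (b₁ ∨ b₂) → ((i ≤ t × t < r) ⊎ 2 * r ∸ i ≤ suc t)
    to h with Equivalence.to (T-∨ {b₁} {b₂}) h
    ... | inj₁ h₁ with Equivalence.to (T-∧ {i + 1 ≤ᵇ suc t}) h₁
    ...   | a , b = inj₁ (s≤s⁻¹ (subst (_≤ suc t) (+-comm i 1) (≤ᵇ⇒≤ (i + 1) (suc t) a)) , ≤ᵇ⇒≤ (suc t) r b)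
    to h | inj₂ h₁ = inj₂ (≤ᵇ⇒≤ (2 * r ∸ i) (suc t) (proj₁ (Equivalence.to (T-∧ {2 * r ∸ i ≤ᵇ suc t}) h₁)))
    from : ((i ≤ t × t < r) ⊎ 2 * r ∸ i ≤ suc t) → T (b₁ ∨ b₂)
    from (inj₁ (a , b)) = Equivalence.from (T-∨ {b₁} {b₂}) (inj₁ (Equivalence.from (T-∧ {i + 1 ≤ᵇ suc t})
      (≤⇒≤ᵇ (subst (_≤ suc t) (+-comm 1 i) (s≤s a)) , ≤⇒≤ᵇ b)))
    from (inj₂ a) = Equivalence.from (T-∨ {b₁} {b₂}) (inj₂ (Equivalence.from (T-∧ {2 * r ∸ i ≤ᵇ suc t})
      (≤⇒≤ᵇ a , ≤⇒≤ᵇ (toℕ<n x))))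

module _ {a} {A : Set a} where

  -- Positions are plain numbers, which lets them be compared directly with the labels of the tent,
  -- without transport along equations between lengths.
  data At : List A → ℕ → A → Set a where
    here  : ∀ {y l} → At (y ∷ l) zero y
    there : ∀ {x y l t} → At l t y → At (x ∷ l) (suc t) y

  At-functional : ∀ {l t y z} → At l t y → At l t z → y ≡ z
  At-functional here      here      = refl
  At-functional (there p) (there q) = At-functional p q

  At-< : ∀ {l t y} → At l t y → t < length l
  At-< here      = s≤s z≤n
  At-< (there p) = s≤s (At-< p)

  At⇒∈ : ∀ {l t y} → At l t y → y LM.∈ l
  At⇒∈ here      = here refl
  At⇒∈ (there p) = there (At⇒∈ p)

  ∈⇒At : ∀ {l y} → y LM.∈ l → ∃ λ t → At l t y
  ∈⇒At (here refl) = zero , here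
  ∈⇒At (there y∈l) with ∈⇒At y∈l
  ... | t , p = suc t , there p

  At-++ˡ : ∀ {l l′ t y} → At l t y → At (l ++ l′) t y
  At-++ˡ here      = here
  At-++ˡ (there p) = there (At-++ˡ p)

  At-++ʳ : ∀ l {l′ t y} → At l′ t y → At (l ++ l′) (length l + t) y
  At-++ʳ []      p = p
  At-++ʳ (x ∷ l) p = there (At-++ʳ l p)

  At-++⁻ : ∀ l {l′ t y} → At (l ++ l′) t y → At l t y ⊎ (∃ λ s → t ≡ length l + s × At l′ s y)
  At-++⁻ []      p         = inj₂ (_ , refl , p)
  At-++⁻ (x ∷ l) here      = inj₁ here
  At-++⁻ (x ∷ l) (there p) with At-++⁻ l p
  ... | inj₁ q            = inj₁ (there q)
  ... | inj₂ (s , e , q)  = inj₂ (s , cong suc e , q)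

  At-lookup : ∀ l x → At l (toℕ x) (lookup l x)
  At-lookup (y ∷ l) zero    = here
  At-lookup (y ∷ l) (suc x) = there (At-lookup l x)

  unique⇒At-injective : ∀ {l t s y} → Unique l → At l t y → At l s y → t ≡ s
  unique⇒At-injective u           here      here      = refl
  unique⇒At-injective (y≢ ∷ u)    here      (there q) = ⊥-elim (All.lookup y≢ (At⇒∈ q) refl)
  unique⇒At-injective (y≢ ∷ u)    (there p) here      = ⊥-elim (All.lookup y≢ (At⇒∈ p) refl)
  unique⇒At-injective (_ ∷ u)     (there p) (there q) = cong suc (unique⇒At-injective u p q)

  -- The tent edges are unions of intervals of labels; a block at a known offset translates such an
  -- interval into membership in a list.
  Segment : List A → ℕ → List A → Set a
  Segment l o s = ∃ λ p → ∃ λ q → l ≡ p ++ s ++ q × length p ≡ o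

  segment⁺ : ∀ {l o s y} → Segment l o s → y LM.∈ s → ∃ λ t → o ≤ t × t < o + length s × At l t y
  segment⁺ (p , q , refl , refl) y∈s with ∈⇒At y∈s
  ... | t , at = length p + t , m≤m+n (length p) t , +-monoʳ-< (length p) (At-< at) , At-++ʳ p (At-++ˡ at)

  segment⁻ : ∀ {l o s t y} → Segment l o s → o ≤ t → t < o + length s → At l t y → y LM.∈ s
  segment⁻ {s = s} (p , q , refl , refl) o≤t t<o+s at with At-++⁻ p at
  ... | inj₁ at′ = ⊥-elim (<⇒≱ (At-< at′) o≤t)
  ... | inj₂ (m , refl , at′) with At-++⁻ s at′
  ...   | inj₁ at″ = At⇒∈ at″
  ...   | inj₂ (m′ , refl , _) = ⊥-elim (<⇒≱ t<o+s (+-monoʳ-≤ (length p) (m≤m+n (length s) m′)))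

module Tent {n : ℕ} (i′ b : ℕ) (H : Hypergraph (suc i′ + suc b) n)
  (I B D₂ D₃ : List (Fin n)) (x : Fin n)
  (∣I∣ : length I ≡ suc i′) (∣B∣ : length B ≡ suc b) (∣D₂∣ : length D₂ ≡ b) (∣D₃∣ : length D₃ ≡ i′)
  (e₁∈ : toSet (I ++ B) LM.∈ edges H)
  (e₂∈ : toSet (D₂ ++ x ∷ I) LM.∈ edges H)
  (e₃∈ : toSet (D₃ ++ x ∷ B) LM.∈ edges H)
  (labels-unique : Unique (I ++ B ++ D₂ ++ D₃ ++ [ x ])) where

  private
    i r : ℕ
    i = suc i′
    r = i + suc b

  -- The blocks follow the labels 1, ..., 2 r - 1 of the tent. Their lengths are i, r - i, r - i -
  -- 1, i - 1 and 1, so the apex x gets the last label.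
  labels : List (Fin n)
  labels = I ++ B ++ D₂ ++ D₃ ++ [ x ]

  r+b r+b+i′ : ℕ
  r+b = r + b
  r+b+i′ = r + b + i′

  2r∸1≡ : 2 * r ∸ 1 ≡ suc r+b+i′
  2r∸1≡ = cong (_∸ 1) (eq i′ b)
    where
    eq : ∀ i′ b → 2 * (suc i′ + suc b) ≡ suc (suc (suc i′ + suc b + b + i′))
    eq = solve-∀

  2r∸i≡ : 2 * r ∸ i ≡ suc r+b
  2r∸i≡ = trans (cong (_∸ i) (eq i′ b)) (m+n∸m≡n i (suc r+b))
    where
    eq : ∀ i′ b → 2 * (suc i′ + suc b) ≡ suc i′ + suc (suc i′ + suc b + b)
    eq = solve-∀

  ∣IB∣ : length (I ++ B) ≡ r
  ∣IB∣ = trans (length-++ I) (cong₂ _+_ ∣I∣ ∣B∣)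

  ∣IBD₂∣ : length ((I ++ B) ++ D₂) ≡ r+b
  ∣IBD₂∣ = trans (length-++ (I ++ B)) (cong₂ _+_ ∣IB∣ ∣D₂∣)

  ∣IBD₂D₃∣ : length (((I ++ B) ++ D₂) ++ D₃) ≡ r+b+i′
  ∣IBD₂D₃∣ = trans (length-++ ((I ++ B) ++ D₂)) (cong₂ _+_ ∣IBD₂∣ ∣D₃∣)

  assoc₂ : labels ≡ ((I ++ B) ++ D₂) ++ D₃ ++ [ x ]
  assoc₂ = trans (sym (++-assoc I B _)) (sym (++-assoc (I ++ B) D₂ _))

  seg-IB : Segment labels 0 (I ++ B)
  seg-IB = [] , _ , sym (++-assoc I B _) , refl

  seg-I : Segment labels 0 I
  seg-I = [] , _ , refl , refl

  seg-B : Segment labels i B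
  seg-B = I , _ , refl , ∣I∣

  seg-D₂ : Segment labels r D₂
  seg-D₂ = I ++ B , _ , sym (++-assoc I B _) , ∣IB∣

  seg-D₃x : Segment labels r+b (D₃ ++ [ x ])
  seg-D₃x = (I ++ B) ++ D₂ , [] ,
    trans assoc₂ (cong (((I ++ B) ++ D₂) ++_) (sym (++-identityʳ (D₃ ++ [ x ])))) , ∣IBD₂∣

  seg-x : Segment labels r+b+i′ [ x ]
  seg-x = ((I ++ B) ++ D₂) ++ D₃ , [] , trans assoc₂ (sym (++-assoc ((I ++ B) ++ D₂) D₃ _)) , ∣IBD₂D₃∣

  ∣labels∣ : length labels ≡ 2 * r ∸ 1
  ∣labels∣ = trans (cong length (trans assoc₂ (sym (++-assoc ((I ++ B) ++ D₂) D₃ _))))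
    (trans (length-++ (((I ++ B) ++ D₂) ++ D₃)) (trans (cong (_+ 1) ∣IBD₂D₃∣) (trans (+-comm r+b+i′ 1) (sym 2r∸1≡))))

  ∣D₃x∣ : length (D₃ ++ [ x ]) ≡ suc i′
  ∣D₃x∣ = trans (length-++ D₃) (trans (cong (_+ 1) ∣D₃∣) (+-comm i′ 1))

  φ : Fin (2 * r ∸ 1) → Fin n
  φ u = lookup labels (cast (sym ∣labels∣) u)

  φ-at : ∀ u → At labels (toℕ u) (φ u)
  φ-at u = subst (λ t → At labels t (φ u)) (toℕ-cast (sym ∣labels∣) u) (At-lookup labels (cast (sym ∣labels∣) u))

  φ-onto : ∀ {t y} → At labels t y → ∃ λ u → toℕ u ≡ t × φ u ≡ y
  φ-onto {t} {y} at = u , e , At-functional (φ-at u) (subst (λ s → At labels s y) (sym e) at)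
    where
    t< : t < 2 * r ∸ 1
    t< = subst (t <_) ∣labels∣ (At-< at)
    u = fromℕ< t<
    e = toℕ-fromℕ< t<

  φ-injective : ∀ {u v} → φ u ≡ φ v → u ≡ v
  φ-injective {u} {v} e = toℕ-injective
    (unique⇒At-injective labels-unique (φ-at u) (subst (At labels (toℕ v)) (sym e) (φ-at v)))

  <-to : ∀ {t o s : ℕ} {l : List (Fin n)} → length l ≡ s → t < o + length l → t < o + s
  <-to refl p = p

  <-from : ∀ {t o s : ℕ} {l : List (Fin n)} → length l ≡ s → t < o + s → t < o + length l
  <-from refl p = p

  image₁ : ∀ y → y ∈ toSet (I ++ B) ⇔ (∃ λ u → u ∈ tentEdge₁ r i × φ u ≡ y)
  image₁ y = mk⇔ to from
    where
    to : y ∈ toSet (I ++ B) → _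
    to y∈ with segment⁺ seg-IB (∈-toSet⁻ (I ++ B) y∈)
    ... | t , _ , t< , at with φ-onto at
    ...   | u , refl , e = u , Equivalence.from (∈-tentEdge₁ {r} {i} u) (subst (toℕ u <_) ∣IB∣ t<) , e
    from : _ → y ∈ toSet (I ++ B)
    from (u , u∈ , refl) = ∈-toSet⁺ (I ++ B)
      (segment⁻ seg-IB z≤n (subst (toℕ u <_) (sym ∣IB∣) (Equivalence.to (∈-tentEdge₁ {r} {i} u) u∈)) (φ-at u))

  2r∸i∸1≡ : 2 * r ∸ i ∸ 1 ≡ r+b
  2r∸i∸1≡ = cong (_∸ 1) 2r∸i≡

  image₂ : ∀ y → y ∈ toSet (D₂ ++ x ∷ I) ⇔ (∃ λ u → u ∈ tentEdge₂ r i × φ u ≡ y)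
  image₂ y = mk⇔ to from
    where
    to : y ∈ toSet (D₂ ++ x ∷ I) → _
    to y∈ with ∈-++⁻ D₂ (∈-toSet⁻ (D₂ ++ x ∷ I) y∈)
    ... | inj₁ y∈D₂ with segment⁺ seg-D₂ y∈D₂
    ...   | t , r≤t , t< , at with φ-onto at
    ...     | u , refl , e = u , Equivalence.from (∈-tentEdge₂ {r} {i} u)
      (inj₂ (inj₁ (r≤t , subst (toℕ u <_) (sym 2r∸i∸1≡) (<-to {l = D₂} ∣D₂∣ t<)))) , e
    to y∈ | inj₂ (here y≡x) with segment⁺ seg-x (here y≡x)
    ...   | t , ≤t , t< , at with φ-onto at
    ...     | u , refl , e = u , Equivalence.from (∈-tentEdge₂ {r} {i} u)
      (inj₂ (inj₂ (trans (cong suc (≤-antisym (s≤s⁻¹ (subst (toℕ u <_) (+-comm r+b+i′ 1) t<)) ≤t)) (sym 2r∸1≡)))) , e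
    to y∈ | inj₂ (there y∈I) with segment⁺ seg-I y∈I
    ...   | t , _ , t< , at with φ-onto at
    ...     | u , refl , e = u , Equivalence.from (∈-tentEdge₂ {r} {i} u) (inj₁ (subst (toℕ u <_) ∣I∣ t<)) , e
    from : _ → y ∈ toSet (D₂ ++ x ∷ I)
    from (u , u∈ , refl) with Equivalence.to (∈-tentEdge₂ {r} {i} u) u∈
    ... | inj₁ t<i = ∈-toSet⁺ (D₂ ++ x ∷ I) (∈-++⁺ʳ D₂ (there
          (segment⁻ seg-I z≤n (subst (toℕ u <_) (sym ∣I∣) t<i) (φ-at u))))
    ... | inj₂ (inj₁ (r≤t , t<)) = ∈-toSet⁺ (D₂ ++ x ∷ I) (∈-++⁺ˡ
          (segment⁻ seg-D₂ r≤t (<-from {l = D₂} ∣D₂∣ (subst (toℕ u <_) 2r∸i∸1≡ t<)) (φ-at u)))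
    ... | inj₂ (inj₂ e) with segment⁻ seg-x (≤-reflexive (sym t≡)) (subst (_< r+b+i′ + 1) (sym t≡) (≤-reflexive (+-comm 1 r+b+i′))) (φ-at u)
      where
      t≡ : toℕ u ≡ r+b+i′
      t≡ = suc-injective (trans e 2r∸1≡)
    ...   | here φu≡x = ∈-toSet⁺ (D₂ ++ x ∷ I) (∈-++⁺ʳ D₂ (here φu≡x))

  image₃ : ∀ y → y ∈ toSet (D₃ ++ x ∷ B) ⇔ (∃ λ u → u ∈ tentEdge₃ r i × φ u ≡ y)
  image₃ y = mk⇔ to from
    where
    tail : y LM.∈ D₃ ++ [ x ] → (∃ λ u → u ∈ tentEdge₃ r i × φ u ≡ y)
    tail y∈ with segment⁺ seg-D₃x y∈
    ... | t , ≤t , t< , at with φ-onto at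
    ...   | u , refl , e = u , Equivalence.from (∈-tentEdge₃ {r} {i} u) (inj₂ (subst (_≤ suc (toℕ u)) (sym 2r∸i≡) (s≤s ≤t))) , e
    to : y ∈ toSet (D₃ ++ x ∷ B) → _
    to y∈ with ∈-++⁻ D₃ (∈-toSet⁻ (D₃ ++ x ∷ B) y∈)
    ... | inj₁ y∈D₃ = tail (∈-++⁺ˡ y∈D₃)
    ... | inj₂ (here y≡x) = tail (∈-++⁺ʳ D₃ (here y≡x))
    ... | inj₂ (there y∈B) with segment⁺ seg-B y∈B
    ...   | t , i≤t , t< , at with φ-onto at
    ...     | u , refl , e = u , Equivalence.from (∈-tentEdge₃ {r} {i} u) (inj₁ (i≤t , <-to {l = B} ∣B∣ t<)) , e
    from : _ → y ∈ toSet (D₃ ++ x ∷ B)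
    from (u , u∈ , refl) with Equivalence.to (∈-tentEdge₃ {r} {i} u) u∈
    ... | inj₁ (i≤t , t<r) = ∈-toSet⁺ (D₃ ++ x ∷ B) (∈-++⁺ʳ D₃ (there
          (segment⁻ seg-B i≤t (<-from {l = B} ∣B∣ t<r) (φ-at u))))
    ... | inj₂ le with ∈-++⁻ D₃ (segment⁻ seg-D₃x (s≤s⁻¹ (subst (_≤ suc (toℕ u)) 2r∸i≡ le))
          (<-from {l = D₃ ++ [ x ]} ∣D₃x∣ (subst (toℕ u <_) (trans 2r∸1≡ (sym (+-suc r+b i′))) (toℕ<n u))) (φ-at u))
    ...   | inj₁ φu∈D₃ = ∈-toSet⁺ (D₃ ++ x ∷ B) (∈-++⁺ˡ φu∈D₃)
    ...   | inj₂ (here φu≡x) = ∈-toSet⁺ (D₃ ++ x ∷ B) (∈-++⁺ʳ D₃ (here φu≡x))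

  contains-tent : ContainsTent i H
  contains-tent = φ , φ-injective , λ
    { _ (here refl)                 → toSet (I ++ B) , e₁∈ , image₁
    ; _ (there (here refl))         → toSet (D₂ ++ x ∷ I) , e₂∈ , image₂
    ; _ (there (there (here refl))) → toSet (D₃ ++ x ∷ B) , e₃∈ , image₃ }

-- Discarding edges with few extensions

count-∈≤length : ∀ {n} (f : Fin n → ℕ) (Z : List (Fin n)) → (∀ x → f x ≤ 1) →
  (∀ x → 0 < f x → x LM.∈ Z) → sum f ≤ length Z
count-∈≤length f Z f≤1 f⊆Z = ≤-trans (sum-mono bound) (≤-trans (≤-reflexive (sum-𝟙∈ (toSet Z))) (∣toSet∣≤length Z))
  where
  bound : ∀ x → f x ≤ 𝟙 (x ∈? toSet Z)
  bound x with pos⊎0 (f x)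
  ... | inj₁ fx≡0 rewrite fx≡0 = z≤n
  ... | inj₂ 0<fx = ≤-trans (f≤1 x) (≤-reflexive (sym (𝟙-yes (x ∈? toSet Z) (∈-toSet⁺ Z (f⊆Z x 0<fx)))))

module Cleaning {r n : ℕ} (H : Hypergraph r n) where

  open import Data.List.Membership.DecPropositional (_≟ₛ_ {n}) using () renaming (_∈?_ to _∈ₑ?_)
  open import Data.List.Membership.DecPropositional (Fin._≟_ {n}) using () renaming (_∈?_ to _∈ᵥ?_)

  edge? : (s : Subset n) → Dec (s LM.∈ edges H)
  edge? s = s ∈ₑ? edges H

  -- rich p m = 1 if the tuple p can be completed to an edge by m further vertices, with more
  -- than r choices available at each step.
  rich : List (Fin n) → ℕ → ℕ
  rich p zero    = 𝟙 (edge? (toSet p))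
  rich p (suc m) = 𝟙 (r <? sum λ x → rich (x ∷ p) m)

  rich≤1 : ∀ p m → rich p m ≤ 1
  rich≤1 p zero    = 𝟙≤1 (edge? (toSet p))
  rich≤1 p (suc m) = 𝟙≤1 (r <? sum λ x → rich (x ∷ p) m)

  -- The threshold in `rich` is chosen for this: among more than r choices one lies outside a set of
  -- at most r vertices.
  rich-avoids : ∀ m p (Z : List (Fin n)) → length Z ≤ r → 0 < rich p m →
    ∃ λ D → length D ≡ m × Disjoint D Z × toSet (D ++ p) LM.∈ edges H
  rich-avoids zero    p Z _  0<rich = [] , refl , (λ { (() , _) }) , 𝟙-pos (edge? (toSet p)) 0<rich
  rich-avoids (suc m) p Z Z≤ 0<rich with Fin.any? (λ x → fresh? x)
    where
    fresh? : ∀ x → Dec (0 < rich (x ∷ p) m × ¬ (x LM.∈ Z))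
    fresh? x = (0 <? rich (x ∷ p) m) ×-dec ¬? (x ∈ᵥ? Z)
  ... | no  none = ⊥-elim (<⇒≱ (𝟙-pos (r <? sum λ x → rich (x ∷ p) m) 0<rich)
    (≤-trans (count-∈≤length (λ x → rich (x ∷ p) m) Z (λ x → rich≤1 (x ∷ p) m) λ x 0<r → stable x 0<r) Z≤))
    where
    stable : ∀ x → 0 < rich (x ∷ p) m → x LM.∈ Z
    stable x 0<r with x ∈ᵥ? Z
    ... | yes x∈Z = x∈Z
    ... | no  x∉Z = ⊥-elim (none (x , 0<r , x∉Z))
  ... | yes (x , 0<r , x∉Z) with rich-avoids m (x ∷ p) Z Z≤ 0<r
  ...   | D , refl , D#Z , D∈ = x ∷ D , refl ,
    (λ { (here refl , z∈Z) → x∉Z z∈Z ; (there z∈D , z∈Z) → D#Z (z∈D , z∈Z) }) ,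
    subst (LM._∈ edges H) (toSet-↭ (shift x D p)) D∈

  -- The number of steps at which the process of revealing w after p turns rich.
  bad : List (Fin n) → List (Fin n) → ℕ
  bad p []      = 0
  bad p (x ∷ w) = (1 ∸ rich p (suc (length w))) * rich (x ∷ p) (length w) + bad (x ∷ p) w

  poor-step : ∀ p m → (1 ∸ rich p (suc m)) * sum (λ x → rich (x ∷ p) m) ≤ r
  poor-step p m = go (r <? sum λ x → rich (x ∷ p) m)
    where
    go : ∀ {S} (d : Dec (r < S)) → (1 ∸ 𝟙 d) * S ≤ r
    go (yes _)  = z≤n
    go (no r≮)  = ≤-trans (≤-reflexive (+-identityʳ _)) (≮⇒≥ r≮)

  -- At each of the m steps a poor prefix turns rich for at most r choices of the next vertex, the
  -- other m - 1 coordinates being free. The factor n on the left avoids the exponent m - 1.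
  Σ-bad : ∀ m p → Σt m (bad p) * n ≤ m * r * n ^ m
  Σ-bad zero    p = ≤-reflexive (cong (_* n) (Σt-zero (bad p)))
  Σ-bad (suc m) p = begin
    Σt (suc m) (bad p) * n
      ≡⟨ cong (_* n) (Σt-suc m (bad p)) ⟩
    sum (λ x → Σt m (λ w → bad p (x ∷ w))) * n
      ≡⟨ cong (_* n) (trans (sum-cong-≗ split) (∑-distrib-+ {n} (λ x → n ^ m * (c * rich (x ∷ p) m)) (λ x → Σt m (bad (x ∷ p))))) ⟩
    (sum (λ x → n ^ m * (c * rich (x ∷ p) m)) + sum (λ x → Σt m (bad (x ∷ p)))) * n
      ≡⟨ *-distribʳ-+ n (sum λ x → n ^ m * (c * rich (x ∷ p) m)) _ ⟩
    sum (λ x → n ^ m * (c * rich (x ∷ p) m)) * n + sum (λ x → Σt m (bad (x ∷ p))) * n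
      ≡⟨ cong₂ _+_ (cong (_* n) (trans (sym (*-distribˡ-sum {n} (n ^ m) (λ x → c * rich (x ∷ p) m)))
           (cong (n ^ m *_) (sym (*-distribˡ-sum {n} c (λ x → rich (x ∷ p) m))))))
           (*-distribʳ-sum {n} n (λ x → Σt m (bad (x ∷ p)))) ⟩
    n ^ m * (c * sum (λ x → rich (x ∷ p) m)) * n + sum (λ x → Σt m (bad (x ∷ p)) * n)
      ≤⟨ +-mono-≤ (*-monoˡ-≤ n (*-monoʳ-≤ (n ^ m) (poor-step p m))) (sum-mono λ x → Σ-bad m (x ∷ p)) ⟩
    n ^ m * r * n + sum {n} (λ _ → m * r * n ^ m)
      ≡⟨ cong (n ^ m * r * n +_) (sum-const n (m * r * n ^ m)) ⟩
    n ^ m * r * n + n * (m * r * n ^ m)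
      ≡⟨ eq n (n ^ m) r m ⟩
    suc m * r * (n * n ^ m) ∎
    where
    open ≤-Reasoning
    c = 1 ∸ rich p (suc m)
    split : ∀ x → Σt m (λ w → bad p (x ∷ w)) ≡ n ^ m * (c * rich (x ∷ p) m) + Σt m (bad (x ∷ p))
    split x = trans (Σt-cong m {g = λ w → c * rich (x ∷ p) m + bad (x ∷ p) w} λ { w refl → refl })
      (trans (Σt-+ m _ _) (cong (_+ Σt m (bad (x ∷ p))) (Σt-const m (c * rich (x ∷ p) m))))
    eq : ∀ n q r m → q * r * n + n * (m * r * q) ≡ suc m * r * (n * q)
    eq = solve-∀

  -- Read backwards from the complete tuple, which is an edge and hence rich: if no step turns from
  -- poor to rich, every earlier prefix is rich too.
  bad≡0⇒rich : ∀ p w → 0 < rich (w ++ p) 0 → bad p w ≡ 0 → 0 < rich p (length w)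
  bad≡0⇒rich p []      0<rich _ = 0<rich
  bad≡0⇒rich p (x ∷ w) 0<rich bad≡0
    with bad≡0⇒rich (x ∷ p) w
           (subst (λ s → 0 < 𝟙 (edge? s)) (toSet-↭ (↭-sym (shift x w p))) 0<rich)
           (m+n≡0⇒n≡0 ((1 ∸ rich p (suc (length w))) * rich (x ∷ p) (length w)) bad≡0)
  ... | 0<rich′ with rich p (suc (length w)) | m+n≡0⇒m≡0 ((1 ∸ rich p (suc (length w))) * rich (x ∷ p) (length w)) bad≡0
  ...   | suc _ | _ = s≤s z≤n
  ...   | zero  | e = ⊥-elim (<-irrefl (sym (trans (sym (+-identityʳ _)) e)) 0<rich′)

  -- All orderings of e are counted, so an edge of badness 0 has only rich prefixes in whatever
  -- order it is revealed.
  badness : Subset n → ℕ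
  badness e = Σt r (λ v → 𝟙 (toSet v ≟ₛ e) * bad [] v)

  good : List (Subset n)
  good = filter (λ e → badness e ≟ 0) (edges H)

  good-unique : Unique good
  good-unique = Unique.filter⁺ (λ e → badness e ≟ 0) (unique H)

  -- A discarded edge has badness at least 1, and the total badness is at most the sum of `bad`
  -- because a tuple orders at most one edge.
  edges≤good+bad : length (edges H) ≤ length good + Σt r (bad [])
  edges≤good+bad = ≤-trans (removed (edges H)) (+-monoʳ-≤ (length good) (≤-trans (≤-reflexive (Σt-list r (edges H) (bad [])))
      (Σt-mono r λ v _ → ≤-trans (*-monoˡ-≤ (bad [] v) (≤-trans (sum-𝟙≟ (toSet v) (edge? (toSet v)) (unique H)) (𝟙≤1 (edge? (toSet v)))))
        (≤-reflexive (*-identityˡ (bad [] v))))))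
    where
    removed : ∀ L → length L ≤ length (filter (λ e → badness e ≟ 0) L) + sumₗ (map badness L)
    removed []      = z≤n
    removed (e ∷ L) with badness e ≟ 0
    ... | yes ≡0 = begin
      suc (length L)
        ≤⟨ s≤s (removed L) ⟩
      suc (length (filter (λ e → badness e ≟ 0) L)) + sumₗ (map badness L)
        ≡⟨ cong (λ l → length l + sumₗ (map badness L)) (filter-accept (λ e → badness e ≟ 0) ≡0) ⟨
      length (filter (λ e → badness e ≟ 0) (e ∷ L)) + sumₗ (map badness L)
        ≤⟨ +-monoʳ-≤ (length (filter (λ e → badness e ≟ 0) (e ∷ L))) (m≤n+m _ (badness e)) ⟩
      length (filter (λ e → badness e ≟ 0) (e ∷ L)) + sumₗ (map badness (e ∷ L)) ∎
      where open ≤-Reasoning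
    ... | no  ≢0 = begin
      suc (length L)
        ≤⟨ s≤s (removed L) ⟩
      suc (length (filter (λ e → badness e ≟ 0) L) + sumₗ (map badness L))
        ≡⟨ cong (λ l → suc (length l + sumₗ (map badness L))) (filter-reject (λ e → badness e ≟ 0) ≢0) ⟨
      suc (length (filter (λ e → badness e ≟ 0) (e ∷ L)) + sumₗ (map badness L))
        ≡⟨ +-suc _ _ ⟨
      length (filter (λ e → badness e ≟ 0) (e ∷ L)) + suc (sumₗ (map badness L))
        ≤⟨ +-monoʳ-≤ (length (filter (λ e → badness e ≟ 0) (e ∷ L))) (+-monoˡ-≤ (sumₗ (map badness L)) (n≢0⇒n>0 ≢0)) ⟩
      length (filter (λ e → badness e ≟ 0) (e ∷ L)) + sumₗ (map badness (e ∷ L)) ∎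
      where open ≤-Reasoning

  good? : (s : Subset n) → Dec (s LM.∈ good)
  good? s = s ∈ₑ? good

  G : List (Fin n) → ℕ
  G v = 𝟙 (good? (toSet v))

  G-↭ : ∀ {u w} → u ↭ w → G u ≡ G w
  G-↭ p = cong (λ s → 𝟙 (good? s)) (toSet-↭ p)

  good⇒edge : ∀ {e} → e LM.∈ good → e LM.∈ edges H
  good⇒edge e∈ = proj₁ (∈-filter⁻ (λ e → badness e ≟ 0) e∈)

  good-orderings : r ! * length good ≤ Σt r G
  good-orderings = ≤-trans (≤-reflexive (*-comm (r !) (length good)))
    (≤-trans (count good (λ e∈ → All.lookup (uniform H) (good⇒edge e∈)))
      (≤-trans (≤-reflexive (Σt-list r good (λ _ → 1)))
        (Σt-mono r λ v _ → ≤-trans (≤-reflexive (*-identityʳ _)) (sum-𝟙≟ (toSet v) (good? (toSet v)) good-unique))))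
    where
    count : ∀ L → (∀ {e} → e LM.∈ L → ∣ e ∣ ≡ r) →
      length L * r ! ≤ sumₗ (map (λ e → Σt r (λ v → 𝟙 (toSet v ≟ₛ e) * 1)) L)
    count []      _ = z≤n
    count (e ∷ L) h = +-mono-≤
      (≤-trans (orderings r e (h (here refl))) (≤-reflexive (Σt-cong r λ v _ → sym (*-identityʳ _))))
      (count L λ e∈ → h (there e∈))

  good-prefix-rich : ∀ p w → length (p ++ w) ≡ r → 0 < G (p ++ w) → 0 < rich p (length w)
  good-prefix-rich p w len 0<G = bad≡0⇒rich p w
      (≤-reflexive (sym (𝟙-yes (edge? (toSet (w ++ p))) (subst (LM._∈ edges H) (toSet-↭ (++-comm p w)) (good⇒edge e∈)))))
      (subst (λ q → bad q w ≡ 0) (reverse-involutive p) (split (reverse p) [] bad≡0))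
    where
    split : ∀ u q → bad q (u ++ w) ≡ 0 → bad (u ʳ++ q) w ≡ 0
    split []      q e = e
    split (x ∷ u) q e = split u (x ∷ q)
      (m+n≡0⇒n≡0 ((1 ∸ rich q (suc (length (u ++ w)))) * rich (x ∷ q) (length (u ++ w))) e)
    e∈ : toSet (p ++ w) LM.∈ good
    e∈ = 𝟙-pos (good? (toSet (p ++ w))) 0<G
    -- `bad` collects the revealed vertices in front, so revealing the reversal of p produces the
    -- prefix p.
    v = reverse p ++ w
    v↭ : v ↭ p ++ w
    v↭ = ++⁺ʳ w (↭-reverse p)
    lenv : length v ≡ r
    lenv = trans (↭-length v↭) len
    bad≡0 : bad [] v ≡ 0
    bad≡0 = n≤0⇒n≡0 (begin
      bad [] v
        ≡⟨ *-identityˡ _ ⟨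
      1 * bad [] v
        ≡⟨ cong (_* bad [] v) (𝟙-yes (toSet v ≟ₛ toSet (p ++ w)) (toSet-↭ v↭)) ⟨
      𝟙 (toSet v ≟ₛ toSet (p ++ w)) * bad [] v
        ≤⟨ f≤Σt (λ u → 𝟙 (toSet u ≟ₛ toSet (p ++ w)) * bad [] u) v ⟩
      Σt (length v) (λ u → 𝟙 (toSet u ≟ₛ toSet (p ++ w)) * bad [] u)
        ≡⟨ cong (λ m → Σt m (λ u → 𝟙 (toSet u ≟ₛ toSet (p ++ w)) * bad [] u)) lenv ⟩
      badness (toSet (p ++ w))
        ≡⟨ proj₂ (∈-filter⁻ (λ e → badness e ≟ 0) {xs = edges H} e∈) ⟩
      0 ∎)
      where open ≤-Reasoning

  edge-unique : ∀ {v} → length v ≡ r → toSet v LM.∈ edges H → Unique v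
  edge-unique {v} len v∈ = ∣toSet∣≡length⇒unique v (trans (All.lookup (uniform H) v∈) (sym len))

-- D₂ is chosen off B, then D₃ off I and D₂, sets of at most r vertices. All other coincidences are
-- impossible because each of the three edges has r distinct vertices.
tent-from-rich : ∀ {n} r (H : Hypergraph r n) i b (I B : List (Fin n)) x → r ≡ suc i + suc b →
  length I ≡ suc i → length B ≡ suc b → toSet (I ++ B) LM.∈ edges H →
  0 < Cleaning.rich H (x ∷ I) b → 0 < Cleaning.rich H (x ∷ B) i → ContainsTent (suc i) H
tent-from-rich .(suc i + suc b) H i b I B x refl ∣I∣ ∣B∣ IB∈ richI richB
  with Cleaning.rich-avoids H b (x ∷ I) B (≤-trans (≤-reflexive ∣B∣) (m≤n+m (suc b) (suc i))) richI
... | D₂ , ∣D₂∣ , D₂#B , D₂∈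
  with Cleaning.rich-avoids H i (x ∷ B) (I ++ D₂) ∣ID₂∣≤r richB
  where
  ∣ID₂∣≤r : length (I ++ D₂) ≤ suc i + suc b
  ∣ID₂∣≤r = ≤-trans (≤-reflexive (trans (length-++ I) (cong₂ _+_ ∣I∣ ∣D₂∣))) (+-monoʳ-≤ (suc i) (n≤1+n b))
... | D₃ , ∣D₃∣ , D₃#ID₂ , D₃∈
  with unique-++⁻ I (Cleaning.edge-unique H (trans (length-++ I) (cong₂ _+_ ∣I∣ ∣B∣)) IB∈)
     | unique-++⁻ D₂ (Cleaning.edge-unique H (trans (length-++ D₂) (trans (cong₂ (λ s t → s + suc t) ∣D₂∣ ∣I∣) (eq₂ i b))) D₂∈)
     | unique-++⁻ D₃ (Cleaning.edge-unique H (trans (length-++ D₃) (trans (cong₂ (λ s t → s + suc t) ∣D₃∣ ∣B∣) (eq₃ i b))) D₃∈)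
  where
  eq₂ : ∀ i b → b + suc (suc i) ≡ suc i + suc b
  eq₂ = solve-∀
  eq₃ : ∀ i b → i + suc (suc b) ≡ suc i + suc b
  eq₃ = solve-∀
... | uI , uB , I#B | uD₂ , (x∉I ∷ _) , D₂#xI | uD₃ , (x∉B ∷ _) , D₃#xB =
  Tent.contains-tent i b H I B D₂ D₃ x ∣I∣ ∣B∣ ∣D₂∣ ∣D₃∣ IB∈ D₂∈ D₃∈
    (Unique.++⁺ uI (Unique.++⁺ uB (Unique.++⁺ uD₂ (Unique.++⁺ uD₃ ([] ∷ []) D₃#x) D₂#) B#) I#)
  where
  D₃#x : Disjoint D₃ [ x ]
  D₃#x (z∈D₃ , here refl) = D₃#xB (z∈D₃ , here refl)
  D₂# : Disjoint D₂ (D₃ ++ [ x ])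
  D₂# (z∈D₂ , z∈) with ∈-++⁻ D₃ z∈
  ... | inj₁ z∈D₃        = D₃#ID₂ (z∈D₃ , ∈-++⁺ʳ I z∈D₂)
  ... | inj₂ (here refl) = D₂#xI (z∈D₂ , here refl)
  B# : Disjoint B (D₂ ++ D₃ ++ [ x ])
  B# (z∈B , z∈) with ∈-++⁻ D₂ z∈
  ... | inj₁ z∈D₂ = D₂#B (z∈D₂ , z∈B)
  ... | inj₂ z∈′ with ∈-++⁻ D₃ z∈′
  ...   | inj₁ z∈D₃        = D₃#xB (z∈D₃ , there z∈B)
  ...   | inj₂ (here refl) = All.lookup x∉B z∈B refl
  I# : Disjoint I (B ++ D₂ ++ D₃ ++ [ x ])
  I# (z∈I , z∈) with ∈-++⁻ B z∈
  ... | inj₁ z∈B = I#B (z∈I , z∈B)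
  ... | inj₂ z∈′ with ∈-++⁻ D₂ z∈′
  ...   | inj₁ z∈D₂ = D₂#xI (z∈D₂ , there z∈I)
  ...   | inj₂ z∈″ with ∈-++⁻ D₃ z∈″
  ...     | inj₁ z∈D₃        = D₃#ID₂ (z∈D₃ , ∈-++⁺ˡ z∈I)
  ...     | inj₂ (here refl) = All.lookup x∉I z∈I refl

module _ {n : ℕ} (k r′ : ℕ) (H : Hypergraph (suc r′) n) (free : FFree k H) where

  open Cleaning H
  open OrderedEdges {n} k r′ G G-↭ using (edges#-bound)

  private r = suc r′

  -- The tent has base I and B = C J. The completion of x C I serves only to show that x I is rich:
  -- C and w₂ are then forgotten and chosen anew, which removes the overlap in C.
  free⇒disjoint : OrderedEdges.DisjointExtensions k r′ G G-↭
  free⇒disjoint C I J x i j ∣I∣ ∣J∣ i<k e 0<G 0<ext₁ 0<ext₂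
    with Σt-pos i (λ w → G ((x ∷ C ++ J) ++ w)) 0<ext₁ | Σt-pos j (λ w → G ((x ∷ C ++ I) ++ w)) 0<ext₂
  ... | w₁ , ∣w₁∣ , 0<G₁ | w₂ , ∣w₂∣ , 0<G₂ =
    free (suc i) (s≤s z≤n) i<k (tent-from-rich r H i b I (C ++ J) x r≡ ∣I∣ ∣CJ∣ IB∈ richI richB)
    where
    b = length C + j
    r≡ : r ≡ suc i + suc b
    r≡ = trans (sym e) (eq (length C) i j)
      where
      eq : ∀ c i j → c + (suc i + suc j) ≡ suc i + suc (c + j)
      eq = solve-∀
    ∣CJ∣ : length (C ++ J) ≡ suc b
    ∣CJ∣ = trans (length-++ C) (trans (cong (length C +_) ∣J∣) (+-suc (length C) j))
    IB∈ : toSet (I ++ C ++ J) LM.∈ edges H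
    IB∈ = subst (LM._∈ edges H) (toSet-↭ (↭-trans (++⁺ʳ J (++-comm C I)) (↭-reflexive (++-assoc I C J))))
      (good⇒edge (𝟙-pos (good? (toSet ((C ++ I) ++ J))) 0<G))
    richB : 0 < rich (x ∷ C ++ J) i
    richB = subst (λ m → 0 < rich (x ∷ C ++ J) m) ∣w₁∣
      (good-prefix-rich (x ∷ C ++ J) w₁
        (trans (cong suc (trans (length-++ (C ++ J)) (cong₂ _+_ ∣CJ∣ ∣w₁∣))) (trans (eq b i) (sym r≡))) 0<G₁)
      where
      eq : ∀ b i → suc (suc b + i) ≡ suc i + suc b
      eq = solve-∀
    ∣Cw₂∣ : length (C ++ w₂) ≡ b
    ∣Cw₂∣ = trans (length-++ C) (cong (length C +_) ∣w₂∣)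
    richI : 0 < rich (x ∷ I) b
    richI = subst (λ m → 0 < rich (x ∷ I) m) ∣Cw₂∣
      (good-prefix-rich (x ∷ I) (C ++ w₂)
        (trans (cong suc (trans (length-++ I) (cong₂ _+_ ∣I∣ ∣Cw₂∣))) (trans (eq b i) (sym r≡)))
        (subst (0 <_) (G-↭ (prep x (↭-trans (++⁺ʳ w₂ (++-comm C I)) (↭-reflexive (++-assoc I C w₂))))) 0<G₂))
      where
      eq : ∀ b i → suc (suc i + b) ≡ suc i + suc b
      eq = solve-∀

  free⇒few-edges : 1 ≤ k → k ≤ r → Σ₁ (r ∸ k) (λ d → inv (k + d)) ℚ.≤ ℚ.1ℚ → 1 ≤ n →
    e[ H ] * r ^ r * n ≤ n ^ r * n + r ^ r * (r * r * n ^ r)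
  free⇒few-edges 1≤k k≤r H≤1 1≤n = begin
    e[ H ] * r ^ r * n
      ≤⟨ *-monoˡ-≤ n (*-monoˡ-≤ (r ^ r) edges≤good+bad) ⟩
    (length good + Σt r (bad [])) * r ^ r * n
      ≡⟨ eq (length good) (Σt r (bad [])) (r ^ r) n ⟩
    length good * r ^ r * n + r ^ r * (Σt r (bad []) * n)
      ≤⟨ +-mono-≤ (*-monoˡ-≤ n few-good) (*-monoʳ-≤ (r ^ r) (Σ-bad r [])) ⟩
    n ^ r * n + r ^ r * (r * r * n ^ r) ∎
    where
    open ≤-Reasoning
    eq : ∀ g b q n → (g + b) * q * n ≡ g * q * n + q * (b * n)
    eq = solve-∀
    few-good : length good * r ^ r ≤ n ^ r
    few-good = *-cancelˡ-≤ (r !) {{r !≢0}} (begin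
      r ! * (length good * r ^ r)     ≡⟨ *-assoc (r !) (length good) (r ^ r) ⟨
      r ! * length good * r ^ r       ≤⟨ *-monoˡ-≤ (r ^ r) good-orderings ⟩
      Σt r G * r ^ r                  ≤⟨ edges#-bound (λ w → 𝟙≤1 (good? (toSet w))) free⇒disjoint 1≤k k≤r H≤1 1≤n ⟩
      r ! * n ^ r                     ∎)

-- The complete multipartite hypergraph and the density

open import Data.Nat.Combinatorics using (_C_; nCk≡n!/k![n-k]!; k![n∸k]!∣n!)

length-cartesianProductWith : ∀ {a b c} {A : Set a} {B : Set b} {C : Set c} (f : A → B → C) xs ys →
  length (cartesianProductWith f xs ys) ≡ length xs * length ys
length-cartesianProductWith f []       ys = refl
length-cartesianProductWith f (x ∷ xs) ys = trans (length-++ (map (f x) ys))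
  (cong₂ _+_ (length-map (f x) ys) (length-cartesianProductWith f xs ys))

allVecs : ∀ q r → List (Vec (Fin q) r)
allVecs q zero    = Vec.[] ∷ []
allVecs q (suc r) = cartesianProductWith Vec._∷_ (allFin q) (allVecs q r)

allVecs-unique : ∀ q r → Unique (allVecs q r)
allVecs-unique q zero    = [] ∷ []
allVecs-unique q (suc r) = Unique.cartesianProductWith⁺ Vec._∷_ ∷-injective (Unique.allFin⁺ q) (allVecs-unique q r)

length-allVecs : ∀ q r → length (allVecs q r) ≡ q ^ r
length-allVecs q zero    = refl
length-allVecs q (suc r) = trans (length-cartesianProductWith Vec._∷_ (allFin q) (allVecs q r))
  (cong₂ _*_ (length-tabulate {n = q} (λ x → x)) (length-allVecs q r))

-- The first r q vertices form r classes of size q; the remaining vertices are isolated.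
module Multipartite (r q n : ℕ) (rq≤n : r * q ≤ n) where

  vertex : Fin r → Fin q → Fin n
  vertex a b = inject≤ (combine a b) rq≤n

  vertex-injective : ∀ {a b a′ b′} → vertex a b ≡ vertex a′ b′ → a ≡ a′ × b ≡ b′
  vertex-injective {a} {b} {a′} {b′} e = combine-injective a b a′ b′ (inject≤-injective rq≤n rq≤n (combine a b) (combine a′ b′) e)

  transversal : Vec (Fin q) r → List (Fin n)
  transversal v = tabulate λ a → vertex a (Vec.lookup v a)

  edge : Vec (Fin q) r → Subset n
  edge v = toSet (transversal v)

  ∈-edge⁻ : ∀ {y} v → y ∈ edge v → ∃ λ a → y ≡ vertex a (Vec.lookup v a)
  ∈-edge⁻ v y∈ = ∈-tabulate⁻ (∈-toSet⁻ (transversal v) y∈)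

  edge-injective : ∀ {v w} → edge v ≡ edge w → v ≡ w
  edge-injective {v} {w} e = Pointwise-≡⇒≡ (ext same)
    where
    same : ∀ a → Vec.lookup v a ≡ Vec.lookup w a
    same a with ∈-edge⁻ w (subst (vertex a (Vec.lookup v a) ∈_) e (∈-toSet⁺ (transversal v) (∈-tabulate⁺ a)))
    ... | a′ , eq with vertex-injective eq
    ...   | refl , eq′ = eq′

  multipartite : Hypergraph r n
  edges   multipartite = map edge (allVecs q r)
  unique  multipartite = Unique.map⁺ edge-injective (allVecs-unique q r)
  uniform multipartite = All.tabulate λ e∈ → size e∈
    where
    size : ∀ {e} → e LM.∈ map edge (allVecs q r) → ∣ e ∣ ≡ r
    size e∈ with ∈-map⁻ edge e∈
    ... | v , _ , refl = trans
      (unique⇒∣toSet∣≡length (Unique.tabulate⁺ λ eq → proj₁ (vertex-injective eq)))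
      (length-tabulate (λ a → vertex a (Vec.lookup v a)))

  e[multipartite] : e[ multipartite ] ≡ q ^ r
  e[multipartite] = trans (length-map edge (allVecs q r)) (length-allVecs q r)

  -- An edge has a single vertex in each class, so two of its vertices in one class coincide.
  same-class : ∀ v {y a b} → y ∈ edge v → y ≡ vertex a b → y ≡ vertex a (Vec.lookup v a)
  same-class v y∈ refl with ∈-edge⁻ v y∈
  ... | a′ , eq with vertex-injective eq
  ...   | refl , _ = eq

  -- The apex lies in the class of some vertex u of the first edge, and u and the apex
  -- share one of the two other edges.
  multipartite-free : ∀ {k} → 2 ≤ r → k < r → FFree k multipartite
  multipartite-free {k} 2≤r k<r i 1≤i i≤k (φ , φ-inj , covered)
    with covered (tentEdge₁ r i) (here refl) | covered (tentEdge₂ r i) (there (here refl))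
       | covered (tentEdge₃ r i) (there (there (here refl)))
  ... | e₁ , e₁∈ , c₁ | e₂ , e₂∈ , c₂ | e₃ , e₃∈ , c₃
    with ∈-map⁻ edge e₁∈ | ∈-map⁻ edge e₂∈ | ∈-map⁻ edge e₃∈
  ... | v₁ , _ , refl | v₂ , _ , refl | v₃ , _ , refl = clash
    where
    N = 2 * r ∸ 1
    r<N : r < N
    r<N = ∸-monoˡ-≤ 1 (≤-trans (≤-reflexive (+-comm 2 r)) (≤-trans (+-monoʳ-≤ r 2≤r) (≤-reflexive (cong (r +_) (sym (+-identityʳ r))))))
    0<N : 0 < N
    0<N = ≤-<-trans z≤n r<N
    pred<N : N ∸ 1 < N
    pred<N = ≤-reflexive (m+[n∸m]≡n 0<N)
    apex : Fin N
    apex = fromℕ< pred<N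
    suc-apex : suc (toℕ apex) ≡ N
    suc-apex = trans (cong suc (toℕ-fromℕ< pred<N)) (m+[n∸m]≡n 0<N)
    apex∈₂ : φ apex ∈ edge v₂
    apex∈₂ = Equivalence.from (c₂ (φ apex)) (apex , Equivalence.from (∈-tentEdge₂ {r} {i} apex) (inj₂ (inj₂ suc-apex)) , refl)
    apex∈₃ : φ apex ∈ edge v₃
    apex∈₃ = Equivalence.from (c₃ (φ apex)) (apex , Equivalence.from (∈-tentEdge₃ {r} {i} apex)
      (inj₂ (subst (2 * r ∸ i ≤_) (sym suc-apex) (∸-monoʳ-≤ (2 * r) 1≤i))) , refl)
    clash : ⊥
    clash with ∈-edge⁻ v₂ apex∈₂
    ... | a , apex≡ with Equivalence.to (c₁ (vertex a (Vec.lookup v₁ a))) (∈-toSet⁺ (transversal v₁) (∈-tabulate⁺ a))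
    ...   | u , u∈₁ , φu≡ = absurd (toℕ u <? i)
      where
      u<r : toℕ u < r
      u<r = Equivalence.to (∈-tentEdge₁ {r} {i} u) u∈₁
      distinct : φ u ≡ φ apex → ⊥
      distinct e = <⇒≱ (<-≤-trans (s≤s u<r) r<N) (≤-reflexive (sym (trans (cong (λ z → suc (toℕ z)) (φ-inj e)) suc-apex)))
      absurd : _ → ⊥
      absurd (yes u<i) = distinct (trans
        (same-class v₂ (Equivalence.from (c₂ (φ u)) (u , Equivalence.from (∈-tentEdge₂ {r} {i} u) (inj₁ u<i) , refl)) φu≡)
        (sym (same-class v₂ apex∈₂ apex≡)))
      absurd (no u≮i) = distinct (trans
        (same-class v₃ (Equivalence.from (c₃ (φ u)) (u , Equivalence.from (∈-tentEdge₃ {r} {i} u) (inj₁ (≮⇒≥ u≮i , u<r)) , refl)) φu≡)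
        (sym (same-class v₃ apex∈₃ apex≡)))

-- Estimates for powers and binomial coefficients

power-shift : ∀ r x y → (x + y) ^ suc r ≤ x ^ suc r + suc r * y * (x + y) ^ r
power-shift zero    x y = ≤-reflexive (eq x y)
  where
  eq : ∀ x y → (x + y) * 1 ≡ x * 1 + 1 * y * 1
  eq = solve-∀
power-shift (suc r) x y = begin
  (x + y) * (x + y) ^ suc r
    ≡⟨ *-distribʳ-+ ((x + y) ^ suc r) x y ⟩
  x * (x + y) ^ suc r + y * (x + y) ^ suc r
    ≤⟨ +-monoˡ-≤ (y * (x + y) ^ suc r) (*-monoʳ-≤ x (power-shift r x y)) ⟩
  x * (x ^ suc r + suc r * y * (x + y) ^ r) + y * (x + y) ^ suc r
    ≤⟨ m≤m+n _ (suc r * y * y * (x + y) ^ r) ⟩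
  x * (x ^ suc r + suc r * y * (x + y) ^ r) + y * (x + y) ^ suc r + suc r * y * y * (x + y) ^ r
    ≡⟨ eq r x y (x ^ suc r) ((x + y) ^ r) ⟩
  x ^ suc (suc r) + suc (suc r) * y * (x + y) ^ suc r ∎
  where
  open ≤-Reasoning
  eq : ∀ r x y p s → x * (p + suc r * y * s) + y * ((x + y) * s) + suc r * y * y * s ≡ x * p + suc (suc r) * y * ((x + y) * s)
  eq = solve-∀

-- This is `power-shift` at n = (n ∸ d) + d; if d exceeds n, the linear term alone dominates n ^ (r
-- + 1).
power-∸ : ∀ r n d → n ^ suc r ≤ (n ∸ d) ^ suc r + suc r * d * n ^ r
power-∸ r n d with d ≤? n
... | yes d≤n = subst (λ m → m ^ suc r ≤ (n ∸ d) ^ suc r + suc r * d * m ^ r) (m∸n+n≡m d≤n) (power-shift r (n ∸ d) d)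
... | no  d≰n = ≤-trans (*-monoˡ-≤ (n ^ r) (≤-trans (<⇒≤ (≰⇒> d≰n)) (m≤m+n d (r * d)))) (m≤n+m _ _)

factorial-lower : ∀ d r → d ^ r * d ! ≤ (d + r) !
factorial-lower d zero    = ≤-reflexive (trans (+-identityʳ (d !)) (cong _! (sym (+-identityʳ d))))
factorial-lower d (suc r) = begin
  d * d ^ r * d !             ≡⟨ *-assoc d (d ^ r) (d !) ⟩
  d * (d ^ r * d !)           ≤⟨ *-mono-≤ (≤-trans (m≤m+n d r) (n≤1+n _)) (factorial-lower d r) ⟩
  suc (d + r) * (d + r) !     ≡⟨ cong _! (+-suc d r) ⟨
  (d + suc r) !               ∎
  where open ≤-Reasoning

factorial-upper : ∀ d r → (d + r) ! ≤ (d + r) ^ r * d !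
factorial-upper d zero    = ≤-reflexive (trans (cong _! (+-identityʳ d)) (sym (+-identityʳ (d !))))
factorial-upper d (suc r) = begin
  (d + suc r) !                              ≡⟨ cong _! (+-suc d r) ⟩
  suc (d + r) * (d + r) !                    ≤⟨ *-monoʳ-≤ (suc (d + r)) (factorial-upper d r) ⟩
  suc (d + r) * ((d + r) ^ r * d !)          ≤⟨ *-monoʳ-≤ (suc (d + r)) (*-monoˡ-≤ (d !) (^-monoˡ-≤ r (n≤1+n (d + r)))) ⟩
  suc (d + r) * (suc (d + r) ^ r * d !)      ≡⟨ *-assoc (suc (d + r)) (suc (d + r) ^ r) (d !) ⟨
  suc (d + r) ^ suc r * d !                  ≡⟨ cong (λ z → z ^ suc r * d !) (+-suc d r) ⟨
  (d + suc r) ^ suc r * d !                  ∎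
  where open ≤-Reasoning

module _ {n r : ℕ} (r≤n : r ≤ n) where

  private instance
    d!≢0 = (n ∸ r) !≢0

  r!*nCr*[n∸r]! : r ! * (n C r) * (n ∸ r) ! ≡ n !
  r!*nCr*[n∸r]! = trans (eq (r !) (n C r) ((n ∸ r) !))
    (trans (cong (_* (r ! * (n ∸ r) !)) (nCk≡n!/k![n-k]! r≤n))
      (m/n*n≡m {{r !* (n ∸ r) !≢0}} (k![n∸k]!∣n! r≤n)))
    where
    eq : ∀ a c d → a * c * d ≡ c * (a * d)
    eq = solve-∀

  r!*nCr-lower : (n ∸ r) ^ r ≤ r ! * (n C r)
  r!*nCr-lower = *-cancelʳ-≤ _ _ ((n ∸ r) !) (≤-trans (factorial-lower (n ∸ r) r)
    (≤-reflexive (trans (cong _! (m∸n+n≡m r≤n)) (sym r!*nCr*[n∸r]!))))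

  r!*nCr-upper : r ! * (n C r) ≤ n ^ r
  r!*nCr-upper = *-cancelʳ-≤ _ _ ((n ∸ r) !) (≤-trans (≤-reflexive (trans r!*nCr*[n∸r]! (cong _! (sym (m∸n+n≡m r≤n)))))
    (≤-trans (factorial-upper (n ∸ r) r) (≤-reflexive (cong (λ z → z ^ r * (n ∸ r) !) (m∸n+n≡m r≤n)))))

∣m-n∣≤ : ∀ m n c → m ≤ n + c → n ≤ m + c → ℤ.∣ ℤ.+ m ℤ.- ℤ.+ n ∣ ≤ c
∣m-n∣≤ m n c m≤ n≤ rewrite m-n≡m⊖n m n with ≤-total m n
... | inj₁ m≤n rewrite ∣⊖∣-≤ m≤n = m≤n+o⇒m∸n≤o n m n≤
... | inj₂ n≤m rewrite ∣m⊖n∣≡∣n⊖m∣ m n | ∣⊖∣-≤ n≤m = m≤n+o⇒m∸n≤o m n m≤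

-- The extremal number and its limit

many-edges : ∀ r′ k n m → let r = suc r′ in 2 ≤ r → k < r → IsEx r k n m → (n ∸ r) ^ r ≤ m * r ^ r
many-edges r′ k n m 2≤r k<r (_ , max) = begin
  (n ∸ r) ^ r              ≤⟨ ^-monoˡ-≤ r n∸r≤ ⟩
  (q * r) ^ r              ≡⟨ ^-distribʳ-* r q r ⟩
  q ^ r * r ^ r            ≡⟨ cong (_* r ^ r) e[multipartite] ⟨
  e[ multipartite ] * r ^ r ≤⟨ *-monoˡ-≤ (r ^ r) (max multipartite (multipartite-free 2≤r k<r)) ⟩
  m * r ^ r                ∎
  where
  open ≤-Reasoning
  r = suc r′
  q = n / r
  n≡ : n ≡ n % r + q * r
  n≡ = m≡m%n+[m/n]*n n r
  open Multipartite r q n (≤-trans (≤-reflexive (*-comm r q)) (≤-trans (m≤n+m (q * r) (n % r)) (≤-reflexive (sym n≡))))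
  n∸r≤ : n ∸ r ≤ q * r
  n∸r≤ = m≤n+o⇒m∸n≤o n r (≤-trans (≤-reflexive n≡) (+-monoˡ-≤ (q * r) (<⇒≤ (m%n<n n r))))

⌈r/e⌉<r : ∀ r k → 4 ≤ r → ¬ (r < (k ∸ 1) ·e) → k < r
⌈r/e⌉<r r zero    4≤r _    = ≤-trans (s≤s z≤n) 4≤r
-- The witness 1 stands for the partial sum 2 of e: r ≤ k + 1 < 2 k, since r ≥ 4 forces k ≥ 3.
⌈r/e⌉<r r (suc k) 4≤r r≮ke = ≰⇒> λ r≤1+k → r≮ke (1 , ≤-trans (≤-reflexive (cong suc (*-identityʳ r)))
  (≤-trans (s≤s r≤1+k) (big k (s≤s⁻¹ (≤-trans 4≤r r≤1+k)))))
  where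
  big : ∀ k → 3 ≤ k → suc (suc k) ≤ k * 2
  big k 3≤k = ≤-trans (+-monoˡ-≤ k (≤-trans (n≤1+n 2) 3≤k)) (≤-reflexive (eq k))
    where
    eq : ∀ k → k + k ≡ k * 2
    eq = solve-∀

theorem1p3 : ∀ (r k : ℕ) → 4 ≤ r → IsCeilDivE r k →
    TuranDensityIs r k (r !) (r ^ r)
theorem1p3 r@(suc r′) k 4≤r (1≤k , r<ke , r≮[k-1]e) p Q 1≤p 1≤Q = N , bound
  where
  F R c₁ c₂ c N : ℕ
  F  = r !
  R  = r ^ r
  -- In units of n ^ (r - 1), `c₁` accounts for the discarded edges, scaled by r ^ r, and `c₂` for
  -- the gap between (n - r) ^ r and n ^ r, which enclose r ! C(n, r).
  c₁ = R * (r * r)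
  c₂ = r * r
  c  = c₁ + c₂
  N  = suc (F * (Q * c) + c₂ + r)
  k<r : k < r
  k<r = ⌈r/e⌉<r r k 4≤r r≮[k-1]e
  bound : ∀ n → N ≤ n → ∀ m → IsEx r k n m → Q * ℤ.∣ ℤ.+ (m * R) ℤ.- ℤ.+ (F * (n C r)) ∣ < p * (n C r) * R
  bound n N≤n m ex@((H , free , e[H]≡m) , _) = begin-strict
    Q * ℤ.∣ ℤ.+ (m * R) ℤ.- ℤ.+ (F * (n C r)) ∣
      ≤⟨ *-monoʳ-≤ Q (∣m-n∣≤ (m * R) (F * (n C r)) (c * M) upper lower) ⟩
    Q * (c * M)
      <⟨ *-cancelˡ-< F _ _ large ⟩
    n C r
      ≤⟨ m≤n*m (n C r) p {{>-nonZero 1≤p}} ⟩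
    p * (n C r)
      ≤⟨ m≤m*n (p * (n C r)) R {{m^n≢0 r r}} ⟩
    p * (n C r) * R ∎
    where
    open ≤-Reasoning
    M = n ^ r′
    r≤n : r ≤ n
    r≤n = ≤-trans (≤-trans (m≤n+m r (F * (Q * c) + c₂)) (n≤1+n _)) N≤n
    1≤n : 1 ≤ n
    1≤n = ≤-trans (s≤s z≤n) r≤n
    n^r≤FC : n ^ r ≤ F * (n C r) + c₂ * M
    n^r≤FC = ≤-trans (power-∸ r′ n r) (+-monoˡ-≤ (c₂ * M) (r!*nCr-lower r≤n))
    mR≤ : m * R ≤ n ^ r + c₁ * M
    mR≤ = *-cancelʳ-≤ _ _ n {{>-nonZero 1≤n}} (begin
      m * R * n                           ≡⟨ cong (λ z → z * R * n) e[H]≡m ⟨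
      e[ H ] * R * n                      ≤⟨ free⇒few-edges k r′ H free 1≤k (<⇒≤ k<r) (harmonicFrom≤1 k r 1≤k (<⇒≤ k<r) r<ke) 1≤n ⟩
      n ^ r * n + R * (r * r * (n * M))   ≡⟨ eq n M R (r * r) ⟩
      (n ^ r + c₁ * M) * n                ∎)
      where
      eq : ∀ n M R s → n * M * n + R * (s * (n * M)) ≡ (n * M + R * s * M) * n
      eq = solve-∀
    upper : m * R ≤ F * (n C r) + c * M
    upper = begin
      m * R                                ≤⟨ mR≤ ⟩
      n ^ r + c₁ * M                       ≤⟨ +-monoˡ-≤ (c₁ * M) n^r≤FC ⟩
      F * (n C r) + c₂ * M + c₁ * M        ≡⟨ eq (F * (n C r)) c₂ M c₁ ⟩
      F * (n C r) + c * M                  ∎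
      where
      eq : ∀ a c₂ M c₁ → a + c₂ * M + c₁ * M ≡ a + (c₁ + c₂) * M
      eq = solve-∀
    lower : F * (n C r) ≤ m * R + c * M
    lower = begin
      F * (n C r)                          ≤⟨ r!*nCr-upper r≤n ⟩
      n ^ r                                ≤⟨ power-∸ r′ n r ⟩
      (n ∸ r) ^ r + c₂ * M                 ≤⟨ +-mono-≤ (many-edges r′ k n m (≤-trans (s≤s (s≤s z≤n)) 4≤r) k<r ex) (*-monoˡ-≤ M (m≤n+m c₂ c₁)) ⟩
      m * R + c * M                        ∎
    -- F C(n, r) is at least n ^ r - c₂ M = (n - c₂) M, so n > F Q c + c₂ suffices; this fixes `N`.
    large : F * (Q * (c * M)) < F * (n C r)
    large = +-cancelʳ-< (c₂ * M) _ _ (begin-strict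
      F * (Q * (c * M)) + c₂ * M           ≡⟨ eq F Q c M c₂ ⟩
      (F * (Q * c) + c₂) * M               <⟨ *-monoˡ-< M {{m^n≢0 n r′ {{>-nonZero 1≤n}}}} (≤-trans (s≤s (m≤m+n (F * (Q * c) + c₂) r)) N≤n) ⟩
      n * M                                ≤⟨ n^r≤FC ⟩
      F * (n C r) + c₂ * M                 ∎)
      where
      eq : ∀ F Q c M d → F * (Q * (c * M)) + d * M ≡ (F * (Q * c) + d) * M
      eq = solve-∀
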